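{- Let $p\ge 11$ be a prime, $\beta\in\mathbb{F}_{p^2}^*$ with $\beta^{p-1}=-1$, $\gamma$ a fixed primitive element of $\mathbb{F}_{p^2}$, and $f:\mathbb{F}_{p^2}\to\mathbb{F}_{p^2}$ a planar function with $f(\lambda x)=\lambda^d f(x)$ for all $\lambda\in\mathbb{F}_p$, $x\in\mathbb{F}_{p^2}$ (some fixed positive integer $d$), and $f(1)=1$, $f(\beta)=\beta^2$, $f(\gamma)=\gamma^2$. For $t\in\mathbb{F}_{p^2}^*$ let $$S_t=\left\{\langle \mathrm{Tr}(tx)^2,\ \mathrm{Tr}(f(x)),\ \mathrm{Tr}(\beta f(x))\rangle : x\in\mathbb{F}_{p^2}^*\right\}\subseteq PG(2,p).$$ Then for each $t\neq 0$, $S_t$ is an oval of $PG(2,p)$.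
   Context: $\mathrm{Tr}$ is the trace from $\mathbb{F}_{p^2}$ to $\mathbb{F}_p$; $\langle X_0,X_1,X_2\rangle$ denotes a point of the projective plane $PG(2,p)$ in homogeneous coordinates. A function is planar if for every $a\neq0$ the map $x\mapsto f(x+a)-f(x)-f(a)$ is a permutation. An oval of $PG(2,p)$ is a set of $p+1$ points no three of which are collinear. -}

module Defs where

open import Data.Nat using (ℕ; zero; suc; NonZero)
import Data.Nat as ℕ
open import Data.Nat.DivMod using (_%_; m%n<n)
open import Data.Fin using (Fin; toℕ; fromℕ<)
open import Data.Product using (Σ; _×_; _,_; proj₁; proj₂; ∃)
open import Relation.Binary.PropositionalEquality using (_≡_)
open import Relation.Nullary using (¬_)
open import Function.Definitions using (Bijective)

-- Arithmetic of F_p (elements: Fin p, residues mod p) and of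
-- F_{p^2} = F_p[ω]/(ω² - n), for a non-square n of F_p.
module Field (p : ℕ) .{{_ : NonZero p}} where

  Fp : Set
  Fp = Fin p

  red : ℕ → Fp
  red m = fromℕ< (m%n<n m p)

  0ₚ 1ₚ : Fp
  0ₚ = red 0
  1ₚ = red 1

  _+ₚ_ _*ₚ_ _-ₚ_ : Fp → Fp → Fp
  a +ₚ b = red (toℕ a ℕ.+ toℕ b)
  a *ₚ b = red (toℕ a ℕ.* toℕ b)
  a -ₚ b = red (toℕ a ℕ.+ (p ℕ.∸ toℕ b))

  NonSquare : Fp → Set
  NonSquare n = ∀ (a : Fp) → ¬ (a *ₚ a ≡ n)

  module Ext (n : Fp) where

    -- (a , b) represents a + b ω with ω² = n
    F : Set
    F = Fp × Fp

    0F 1F : F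
    0F = (0ₚ , 0ₚ)
    1F = (1ₚ , 0ₚ)

    ι : Fp → F
    ι a = (a , 0ₚ)

    _+F_ _-F_ _*F_ : F → F → F
    (a , b) +F (c , d) = (a +ₚ c , b +ₚ d)
    (a , b) -F (c , d) = (a -ₚ c , b -ₚ d)
    (a , b) *F (c , d) = ((a *ₚ c) +ₚ (n *ₚ (b *ₚ d)) , (a *ₚ d) +ₚ (b *ₚ c))

    -F_ : F → F
    -F x = 0F -F x

    _^F_ : F → ℕ → F
    x ^F zero = 1F
    x ^F suc k = x *F (x ^F k)

    Primitive : F → Set
    Primitive γ = ∀ (y : F) → ¬ (y ≡ 0F) → ∃ λ (k : ℕ) → γ ^F k ≡ y

    -- absolute trace F_{p^2} → F_p, Tr(x) = x + x^p, read in F_p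
    -- (x + x^p always has zero ω-component; we take its F_p component)
    Tr : F → Fp
    Tr x = proj₁ (x +F (x ^F p))

    Planar : (F → F) → Set
    Planar f = ∀ (a : F) → ¬ (a ≡ 0F) →
      Bijective _≡_ _≡_ (λ x → (f (x +F a) -F f x) -F f a)

  -- Projective plane PG(2,p): points are nonzero triples up to
  -- nonzero scalars.
  Triple : Set
  Triple = Fp × Fp × Fp

  NonZeroT : Triple → Set
  NonZeroT (a , b , c) = ¬ ((a ≡ 0ₚ) × (b ≡ 0ₚ) × (c ≡ 0ₚ))

  _·ₜ_ : Fp → Triple → Triple
  l ·ₜ (a , b , c) = (l *ₚ a , l *ₚ b , l *ₚ c)

  SamePoint : Triple → Triple → Set
  SamePoint u v = ∃ λ (l : Fp) → ¬ (l ≡ 0ₚ) × (v ≡ l ·ₜ u)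

  OnLine : Triple → Triple → Set
  OnLine (a , b , c) (x , y , z) = ((a *ₚ x) +ₚ (b *ₚ y)) +ₚ (c *ₚ z) ≡ 0ₚ

  Collinear : Triple → Triple → Triple → Set
  Collinear u v w = ∃ λ (L : Triple) → NonZeroT L × OnLine L u × OnLine L v × OnLine L w

  Oval : (Triple → Set) → Set
  Oval S =
    (∀ u → S u → NonZeroT u) ×
    (Σ (Fin (suc p) → Triple) λ e →
        (∀ i → S (e i)) ×
        (∀ i j → SamePoint (e i) (e j) → i ≡ j) ×
        (∀ u → S u → ∃ λ i → SamePoint (e i) u)) ×
    (∀ u v w → S u → S v → S w →
        ¬ SamePoint u v → ¬ SamePoint u w → ¬ SamePoint v w →
        ¬ Collinear u v w)

  module SetS (n : Fp) where
    open Ext n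

    S : (F → F) → F → F → Triple → Set
    S f β t v = ∃ λ (x : F) → ¬ (x ≡ 0F) ×
      SamePoint (Tr (t *F x) *ₚ Tr (t *F x) , Tr (f x) , Tr (β *F f x)) v

-- Write s(x) = Tr(tx) and g = Tr(B f) with B ≠ 0. Restricted to 𝔽_p, f is the planar power x^d, and a power sum computation
-- gives x^d = x² there; so f(lx) = l² f(x), and S_t is indexed by the p + 1 lines of 𝔽_{p²} through 0.
--
-- Planarity makes every h_b = g - b s bent, that is, h_b(x + a) - h_b(x) takes each value p times for a ≠ 0. Hence the
-- element Σ_e #{h_b = e} ζ^e of ℤ[ζ], ζ^p = 1, has norm p² over the real subfield, so it is divisible by p, and so
-- #{h_b = e} = p + c_b (1 - p [e = j_b]) with c_b = ±1. Homogeneity gives c_b = c and j_b = b² j. Summing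
-- #{h_b = e - b} over b counts the points with s = 1 and g = e: their number is 1 + c - c #{b : e - b = b² j} ≤ 2.
-- So at most two classes with s ≠ 0 lie on a line a s² + g = 0. If a class x with s(x) = 0 lies there too and y ≠ z had s = 1,
-- then y - z would be a multiple v of x with f(z + v) - f(z) ∈ ⟨f(v)⟩, and planarity in direction v would give z ∈ ⟨v⟩.
module Submission where

open import Defs
open import Algebra.Bundles using (AbelianGroup; CommutativeRing; RawRing)
import Algebra.Properties.CommutativeSemiring.Binomial as Binomial
import Algebra.Properties.CommutativeSemiring.Exp as Exp
import Algebra.Properties.Ring as RingProperties
import Algebra.Properties.Semiring.Mult as Mult
import Algebra.Properties.Semiring.Sum as Sum
import Algebra.Solver.Ring as RingSolver
open import Algebra.Solver.Ring.AlmostCommutativeRing using (fromCommutativeRing; _-Raw-AlmostCommutative⟶_)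
open import Algebra.Structures using (IsCommutativeRing)
open import Data.Bool using (Bool; true; false; if_then_else_)
open import Data.Empty using (⊥; ⊥-elim)
open import Data.Fin using (Fin; zero; suc; toℕ; fromℕ; fromℕ<; inject₁; punchIn; punchOut; _≟_)
open import Data.Fin.Permutation using (Permutation; permutation)
open import Data.Fin.Properties
  using (toℕ<n; toℕ-fromℕ<; toℕ-fromℕ; toℕ-inject₁; toℕ-injective; any?; punchOut-injective; injective⇒≤; punchInᵢ≢i)
open import Data.Integer using (ℤ; 0ℤ; 1ℤ; -1ℤ)
import Data.Integer as ℤ
open import Data.Integer.Divisibility.Signed using (_∣_; divides; ∣⇒∣ᵤ; ∣ᵤ⇒∣; *-cancelˡ-∣)
import Data.Integer.Properties as ℤ
open import Data.Integer.Tactic.RingSolver using (solve-∀)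
import Data.Maybe
open import Data.Nat as ℕ using (ℕ; zero; suc; NonZero; _∸_; _≤_)
open import Data.Nat.Combinatorics using (_C_; nCk+nC[k+1]≡[n+1]C[k+1]; nCn≡1; nC1≡n; nCk≡nC[n∸k]; k>n⇒nCk≡0)
import Data.Nat.Divisibility as ℕ
open import Data.Nat.DivMod
  using (_%_; _/_; m%n<n; %-distribˡ-+; %-distribˡ-*; m<n⇒m%n≡m; [m+n]%n≡m%n; m≡m%n+[m/n]*n)
open import Data.Nat.Induction using (<-rec)
open import Data.Nat.Primality using (Prime; euclidsLemma; prime⇒irreducible)
import Data.Nat.Properties as ℕ
import Data.Nat.Tactic.RingSolver as ℕ-Solver
open import Data.Product using (∃; ∃₂; _×_; _,_; proj₁; proj₂)
open import Data.Product.Properties using (≡-dec)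
open import Data.Sum using (_⊎_; inj₁; inj₂)
open import Function using (_∘_)
open import Function.Definitions using (Injective; Bijective)
open import Level using (0ℓ)
open import Relation.Binary.Definitions using (tri<; tri≈; tri>)
open import Relation.Binary.PropositionalEquality
  using (_≡_; refl; sym; trans; cong; cong₂; subst; subst₂; isEquivalence; module ≡-Reasoning)
open import Relation.Nullary using (¬_; Dec; yes; no; does)
open import Relation.Nullary.Decidable using (dec-true; dec-false; dec⇒maybe)

import Algebra.Properties.Semiring.Sum ℕ.+-*-semiring as ∑ℕ
import Algebra.Properties.Semiring.Sum ℤ.+-*-semiring as ∑
open ∑ using (sum)
open import Algebra.Properties.Group (AbelianGroup.group ℤ.+-0-abelianGroup) using () renaming (∙-cancelˡ to +-cancelˡ)

-- The ring ℤ[ζ] never appears: its elements are p-periodic integer sequences modulo constants, with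
-- `T` (shift minus identity) for the prime ζ - 1, the period sum `S` modulo p for the residue map
-- at that prime, and the correlation `R` for multiplication by a conjugate. Divisibility by `T`
-- then means that a difference equation has a periodic solution, and `S` is the obstruction.
-- Homogeneity relates the functions h_b with b ≠ 0 to one another, but b = 0 is an orbit of its
-- own. Its exceptional value is 0 because multiplication by 4 fixes it, and 3 is invertible. Its
-- sign agrees with the others because the count of points with s = 1 is an integer, which forces p
-- to divide a difference of two signs. That the p + 1 classes give p + 1 different points is a
-- second consequence of planarity: f(x) = f(y) only if y = x or y = -x. The condition β^(p-1) = -1
-- keeps β outside the prime field, so y is determined by Tr(y) and Tr(βy). Hence every line of the
-- plane has the form a s² + Tr(Bf) = 0, and B = 0 only for the line s² = 0.

module IntegerSequences where

  open import Data.Integer using (+_; -[1+_]; _+_; _*_; -_; _-_; _^_)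

  -- Divisibility by a prime and binomial coefficients.

  prime∣*⇒∣⊎∣ : ∀ {p} → Prime p → ∀ m n → + p ∣ m * n → + p ∣ m ⊎ + p ∣ n
  prime∣*⇒∣⊎∣ {p} pp m n d
    with euclidsLemma ℤ.∣ m ∣ ℤ.∣ n ∣ pp (subst (p ℕ.∣_) (ℤ.abs-* m n) (∣⇒∣ᵤ d))
  ... | inj₁ e = inj₁ (∣ᵤ⇒∣ e)
  ... | inj₂ e = inj₂ (∣ᵤ⇒∣ e)

  prime∣²⇒∣ : ∀ {p} → Prime p → ∀ m → + p ∣ m * m → + p ∣ m
  prime∣²⇒∣ pp m d with prime∣*⇒∣⊎∣ pp m m d
  ... | inj₁ e = e
  ... | inj₂ e = e

  -- Lets a prime be traced along Pascal's triangle: it serves both to show that p divides a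
  -- coefficient and to show that it does not.
  absorption : ∀ n k → suc k ℕ.* (suc n C suc k) ≡ suc n ℕ.* (n C k)
  absorption zero zero = refl
  absorption zero (suc k) = begin
    suc (suc k) ℕ.* (1 C suc (suc k)) ≡⟨ cong (suc (suc k) ℕ.*_) (k>n⇒nCk≡0 {1} {suc (suc k)} (ℕ.s≤s (ℕ.s≤s ℕ.z≤n))) ⟩
    suc (suc k) ℕ.* 0                 ≡⟨ ℕ.*-zeroʳ k ⟩
    0                                 ≡⟨ cong (1 ℕ.*_) (k>n⇒nCk≡0 {0} {suc k} (ℕ.s≤s ℕ.z≤n)) ⟨
    1 ℕ.* (0 C suc k)                 ∎
    where open ≡-Reasoning
  absorption (suc n) zero = begin
    1 ℕ.* (suc (suc n) C 1)                     ≡⟨ cong (1 ℕ.*_) (nCk+nC[k+1]≡[n+1]C[k+1] (suc n) 0) ⟨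
    1 ℕ.* (1 ℕ.+ (suc n C 1))                   ≡⟨ ring (suc n C 1) ⟩
    1 ℕ.+ 1 ℕ.* (suc n C 1)                     ≡⟨ cong (1 ℕ.+_) (absorption n 0) ⟩
    1 ℕ.+ suc n ℕ.* 1                           ∎
    where
    open ≡-Reasoning
    ring : ∀ a → 1 ℕ.* (1 ℕ.+ a) ≡ 1 ℕ.+ 1 ℕ.* a
    ring = ℕ-Solver.solve-∀
  absorption (suc n) (suc k) = begin
    suc (suc k) ℕ.* (suc (suc n) C suc (suc k))       ≡⟨ cong (suc (suc k) ℕ.*_) (nCk+nC[k+1]≡[n+1]C[k+1] (suc n) (suc k)) ⟨
    suc (suc k) ℕ.* (a ℕ.+ b)                         ≡⟨ split k a b ⟩
    a ℕ.+ (suc k ℕ.* a ℕ.+ suc (suc k) ℕ.* b)         ≡⟨ cong (a ℕ.+_) (cong₂ ℕ._+_ (absorption n k) (absorption n (suc k))) ⟩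
    a ℕ.+ (suc n ℕ.* (n C k) ℕ.+ suc n ℕ.* (n C suc k)) ≡⟨ cong (a ℕ.+_) (ℕ.*-distribˡ-+ (suc n) (n C k) (n C suc k)) ⟨
    a ℕ.+ suc n ℕ.* ((n C k) ℕ.+ (n C suc k))         ≡⟨ cong (λ z → a ℕ.+ suc n ℕ.* z) (nCk+nC[k+1]≡[n+1]C[k+1] n k) ⟩
    suc (suc n) ℕ.* a                                 ∎
    where
    open ≡-Reasoning
    a = suc n C suc k
    b = suc n C suc (suc k)
    split : ∀ k a b → suc (suc k) ℕ.* (a ℕ.+ b) ≡ a ℕ.+ (suc k ℕ.* a ℕ.+ suc (suc k) ℕ.* b)
    split = ℕ-Solver.solve-∀

  -- By `absorption`, p divides `suc k` times the coefficient, and `suc k` lies strictly between 0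
  -- and p.
  prime∣C : ∀ {q k} → Prime (suc q) → k ℕ.< q → suc q ℕ.∣ suc q C suc k
  prime∣C {q} {k} pp k<q
    with euclidsLemma (suc k) (suc q C suc k) pp
           (ℕ.divides (q C k) (trans (absorption q k) (ℕ.*-comm (suc q) (q C k))))
  ... | inj₁ d = ⊥-elim (ℕ.<⇒≱ k<q (ℕ.s≤s⁻¹ (ℕ.∣⇒≤ d)))
  ... | inj₂ d = d

  sum-const : ∀ n c → sum {n} (λ _ → c) ≡ + n * c
  sum-const zero    c = refl
  sum-const (suc n) c = trans (cong (λ z → c + z) (sum-const n c)) (sym (ℤ.suc-* (+ n) c))

  -- Sequences and their forward differences

  Seq : Set
  Seq = ℕ → ℤ

  Σ< : ℕ → Seq → ℤ
  Σ< n u = sum {n} (λ i → u (toℕ i))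

  T : Seq → Seq
  T u m = u (suc m) - u m

  T^ : ℕ → Seq → Seq
  T^ zero    u = u
  T^ (suc k) u = T (T^ k u)

  T^-T : ∀ k u m → T^ k (T u) m ≡ T^ (suc k) u m
  T^-T zero    u m = refl
  T^-T (suc k) u m = cong₂ _-_ (T^-T k u (suc m)) (T^-T k u m)

  T^-cong : ∀ k {u w} → (∀ m → u m ≡ w m) → ∀ m → T^ k u m ≡ T^ k w m
  T^-cong zero    e m = e m
  T^-cong (suc k) e m = cong₂ _-_ (T^-cong k e (suc m)) (T^-cong k e m)

  T^-+ : ∀ j k u m → T^ j (T^ k u) m ≡ T^ (j ℕ.+ k) u m
  T^-+ zero    k u m = refl
  T^-+ (suc j) k u m = cong₂ _-_ (T^-+ j k u (suc m)) (T^-+ j k u m)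

  T^-affine : ∀ k c a u m → T^ (suc k) (λ i → c + a * u i) m ≡ a * T^ (suc k) u m
  T^-affine zero    c a u m = ring c a (u (suc m)) (u m)
    where
    ring : ∀ c a x y → (c + a * x) - (c + a * y) ≡ a * (x - y)
    ring = solve-∀
  T^-affine (suc k) c a u m =
    trans (cong₂ _-_ (T^-affine k c a u (suc m)) (T^-affine k c a u m)) (ring a _ _)
    where
    ring : ∀ a x y → a * x - a * y ≡ a * (x - y)
    ring = solve-∀

  -- A difference kills the constant, but for k = 0 it survives as c′ = c; the existential treats
  -- both cases at once.
  T^-const-+ : ∀ k u c → ∃ λ c′ → ∀ m → T^ k (λ i → u i + c) m ≡ T^ k u m + c′
  T^-const-+ zero    u c = c , λ m → refl
  T^-const-+ (suc k) u c with T^-const-+ k u c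
  ... | c′ , e = 0ℤ , λ m → trans (cong₂ _-_ (e (suc m)) (e m)) (ring (T^ k u (suc m)) (T^ k u m) c′)
    where
    ring : ∀ x y z → (x + z) - (y + z) ≡ (x - y) + 0ℤ
    ring = solve-∀

  Σ<-last : ∀ n u → Σ< (suc n) u ≡ Σ< n u + u n
  Σ<-last zero    u = ℤ.+-comm (u 0) 0ℤ
  Σ<-last (suc n) u = trans (cong (_+_ (u 0)) (Σ<-last n (u ∘ suc))) (sym (ℤ.+-assoc (u 0) _ _))

  Σ<-cong : ∀ n {u w : Seq} → (∀ m → u m ≡ w m) → Σ< n u ≡ Σ< n w
  Σ<-cong n e = ∑.sum-cong-≗ {n} (λ i → e (toℕ i))

  Σ<-+ : ∀ n u w → Σ< n (λ i → u i + w i) ≡ Σ< n u + Σ< n w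
  Σ<-+ n u w = ∑.∑-distrib-+ {n} (u ∘ toℕ) (w ∘ toℕ)

  Σ<-*ˡ : ∀ n c u → Σ< n (λ i → c * u i) ≡ c * Σ< n u
  Σ<-*ˡ n c u = sym (∑.*-distribˡ-sum {n} c (u ∘ toℕ))

  Σ<-*ʳ : ∀ n c u → Σ< n (λ i → u i * c) ≡ Σ< n u * c
  Σ<-*ʳ n c u = sym (∑.*-distribʳ-sum {n} c (u ∘ toℕ))

  Σ<-- : ∀ n u w → Σ< n (λ i → u i - w i) ≡ Σ< n u - Σ< n w
  Σ<-- n u w = begin
    Σ< n (λ i → u i - w i)              ≡⟨ Σ<-cong n (λ i → ring (u i) (w i)) ⟩
    Σ< n (λ i → u i + -1ℤ * w i)        ≡⟨ Σ<-+ n u (λ i → -1ℤ * w i) ⟩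
    Σ< n u + Σ< n (λ i → -1ℤ * w i)     ≡⟨ cong (λ z → Σ< n u + z) (Σ<-*ˡ n -1ℤ w) ⟩
    Σ< n u + -1ℤ * Σ< n w               ≡⟨ ring (Σ< n u) (Σ< n w) ⟨
    Σ< n u - Σ< n w                     ∎
    where
    open ≡-Reasoning
    ring : ∀ x y → x - y ≡ x + -1ℤ * y
    ring = solve-∀

  -- With 1 + T the shift, this is ((1 + T)^n - 1) / T expanded by the binomial theorem. The
  -- induction moves the base point from m to m + 1 and recombines coefficients by Pascal's rule.
  Σ<-newton : ∀ n u m → Σ< n (λ i → u (i ℕ.+ m)) ≡ Σ< n (λ k → + (n C suc k) * T^ k u m)
  Σ<-newton zero    u m = refl
  Σ<-newton (suc n) u m = begin
    u m + Σ< n (λ i → u (suc i ℕ.+ m))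
      ≡⟨ cong (λ z → u m + z) (Σ<-cong n (λ i → cong u (sym (ℕ.+-suc i m)))) ⟩
    u m + Σ< n (λ i → u (i ℕ.+ suc m))
      ≡⟨ cong (_+_ (u m)) (Σ<-newton n u (suc m)) ⟩
    u m + Σ< n (λ k → + (n C suc k) * T^ k u (suc m))
      ≡⟨ cong (_+_ (u m)) (Σ<-cong n (λ k → ring₁ (+ (n C suc k)) (T^ k u (suc m)) (T^ k u m))) ⟩
    u m + Σ< n (λ k → B k + A k)
      ≡⟨ cong (_+_ (u m)) (Σ<-+ n B A) ⟩
    u m + (Σ< n B + Σ< n A)
      ≡⟨ ring₂ (u m) (Σ< n B) (Σ< n A) ⟩
    (1ℤ * u m + Σ< n B) + (Σ< n A + 0ℤ * T^ n u m)
      -- A term with the zero coefficient n C (n + 1) is appended, so that both sums run over k ≤ n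
      -- and can be added.
      ≡⟨ cong (λ c → (1ℤ * u m + Σ< n B) + (Σ< n A + + c * T^ n u m)) (sym (k>n⇒nCk≡0 (ℕ.n<1+n n))) ⟩
    (1ℤ * u m + Σ< n B) + (Σ< n A + + (n C suc n) * T^ n u m)
      ≡⟨ cong (_+_ (1ℤ * u m + Σ< n B)) (sym (Σ<-last n A)) ⟩
    Σ< (suc n) (λ k → + (n C k) * T^ k u m) + Σ< (suc n) A
      ≡⟨ sym (Σ<-+ (suc n) (λ k → + (n C k) * T^ k u m) A) ⟩
    Σ< (suc n) (λ k → + (n C k) * T^ k u m + A k)
      ≡⟨ Σ<-cong (suc n) (λ k → sym (ℤ.*-distribʳ-+ (T^ k u m) (+ (n C k)) (+ (n C suc k)))) ⟩
    Σ< (suc n) (λ k → + (n C k ℕ.+ n C suc k) * T^ k u m)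
      ≡⟨ Σ<-cong (suc n) (λ k → cong (λ c → + c * T^ k u m) (nCk+nC[k+1]≡[n+1]C[k+1] n k)) ⟩
    Σ< (suc n) (λ k → + (suc n C suc k) * T^ k u m) ∎
    where
    open ≡-Reasoning
    A B : Seq
    A k = + (n C suc k) * T^ k u m
    B k = + (n C suc k) * T^ (suc k) u m
    ring₁ : ∀ c x y → c * x ≡ c * (x - y) + c * y
    ring₁ = solve-∀
    ring₂ : ∀ a b c → a + (b + c) ≡ (1ℤ * a + b) + (c + 0ℤ)
    ring₂ = solve-∀

  -- Periodic sequences, their correlations, and divisibility by powers of `T`.

  module Periodicity {q : ℕ} (p-prime : Prime (suc q)) (0<q : 0 ℕ.< q) where

    p : ℕ
    p = suc q

    Periodic : Seq → Set
    Periodic u = ∀ m → u (m ℕ.+ p) ≡ u m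

    S : Seq → ℤ
    S = Σ< p

    S-suc : ∀ {u} → Periodic u → S (u ∘ suc) ≡ S u
    S-suc {u} per = +-cancelˡ (u 0) _ _ (begin
      u 0 + S (u ∘ suc) ≡⟨ Σ<-last p u ⟩
      S u + u p         ≡⟨ cong (_+_ (S u)) (per 0) ⟩
      S u + u 0         ≡⟨ ℤ.+-comm (S u) (u 0) ⟩
      u 0 + S u         ∎)
      where open ≡-Reasoning

    S-shift : ∀ {u} → Periodic u → ∀ m → S (λ i → u (i ℕ.+ m)) ≡ S u
    S-shift {u} per zero    = Σ<-cong p (λ i → cong u (ℕ.+-identityʳ i))
    S-shift {u} per (suc m) = begin
      S (λ i → u (i ℕ.+ suc m)) ≡⟨ Σ<-cong p (λ i → cong u (ℕ.+-suc i m)) ⟩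
      S (λ i → u (suc i ℕ.+ m)) ≡⟨ S-suc (λ i → trans (cong u (swap i m p)) (per (i ℕ.+ m))) ⟩
      S (λ i → u (i ℕ.+ m))     ≡⟨ S-shift per m ⟩
      S u                       ∎
      where
      open ≡-Reasoning
      swap : ∀ a b c → (a ℕ.+ c) ℕ.+ b ≡ (a ℕ.+ b) ℕ.+ c
      swap = ℕ-Solver.solve-∀

    T^-periodic : ∀ k {u} → Periodic u → Periodic (T^ k u)
    T^-periodic zero    per = per
    T^-periodic (suc k) per m = cong₂ _-_ (T^-periodic k per (suc m)) (T^-periodic k per m)

    S-T : ∀ {u} → Periodic u → S (T u) ≡ 0ℤ
    S-T {u} per = trans (Σ<-- p (u ∘ suc) u) (trans (cong (_- S u) (S-suc per)) (ℤ.+-inverseʳ (S u)))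

    -- T = σ - 1 for the shift σ, and (σ - 1)^(p-1) ≡ 1 + σ + ... + σ^(p-1) modulo p.
    T^q≡S : ∀ {u} → Periodic u → ∃ λ h → Periodic h × (∀ m → T^ q u m ≡ S u + + p * h m)
    T^q≡S {u} per = h , h-periodic , expand
      where
      c : Fin q → ℕ
      c i = ℕ.quotient (prime∣C p-prime (toℕ<n i))
      h : Seq
      h m = - sum {q} (λ i → + c i * T^ (toℕ i) u m)
      h-periodic : Periodic h
      h-periodic m = cong -_ (∑.sum-cong-≗ {q} (λ i → cong (+ c i *_) (T^-periodic (toℕ i) per m)))
      expand : ∀ m → T^ q u m ≡ S u + + p * h m
      expand m = trans (solveFor (S u) _ (T^ q u m) (begin
        S u                                                    ≡⟨ S-shift per m ⟨
        S (λ i → u (i ℕ.+ m))                                  ≡⟨ Σ<-newton p u m ⟩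
        Σ< p (λ k → + (p C suc k) * T^ k u m)                  ≡⟨ Σ<-last q (λ k → + (p C suc k) * T^ k u m) ⟩
        Σ< q (λ k → + (p C suc k) * T^ k u m) + + (p C p) * T^ q u m
          ≡⟨ cong₂ (λ a b → a + + b * T^ q u m)
               (trans (∑.sum-cong-≗ {q} (λ i → cong (_* T^ (toℕ i) u m) (coeff i)))
                 (trans (∑.sum-cong-≗ {q} (λ i → ℤ.*-assoc (+ p) (+ c i) (T^ (toℕ i) u m)))
                        (sym (∑.*-distribˡ-sum {q} (+ p) _))))
               (nCn≡1 p) ⟩
        + p * sum {q} (λ i → + c i * T^ (toℕ i) u m) + 1ℤ * T^ q u m ∎))
        (cong (_+_ (S u)) (ℤ.neg-distribʳ-* (+ p) (sum {q} (λ i → + c i * T^ (toℕ i) u m))))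
        where
        open ≡-Reasoning
        coeff : ∀ i → + (p C suc (toℕ i)) ≡ + p * + c i
        coeff i = trans (cong +_ (trans (ℕ._∣_.equality (prime∣C p-prime (toℕ<n i))) (ℕ.*-comm (c i) p))) (ℤ.pos-* p (c i))
        solveFor : ∀ s x t → s ≡ x + 1ℤ * t → t ≡ s + - x
        solveFor s x t refl = ring x t
          where
          ring : ∀ x t → t ≡ (x + 1ℤ * t) + - x
          ring = solve-∀

    T^[1+]-S : ∀ {k} → 0 ℕ.< k → ∀ {u} → Periodic u → S (T^ k u) ≡ 0ℤ
    T^[1+]-S {suc k} _ per = S-T (T^-periodic k per)

    T^affine : ∀ {k} → 0 ℕ.< k → ∀ c a u m → T^ k (λ i → c + a * u i) m ≡ a * T^ k u m
    T^affine {suc k} _ = T^-affine k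

    -- Apply `T^q≡S` to u and then to its remainder h. Summing the first congruence over a period
    -- gives 0 = p (S u + S h), hence S h = - S u. Thus divisibility of `T^ (q ℕ.+ q) u` by p²
    -- forces p to divide S u.
    T^2q≡-pS : ∀ {u} → Periodic u → ∃ λ h → ∀ m → T^ (q ℕ.+ q) u m ≡ - (+ p * S u) + (+ p * + p) * h m
    T^2q≡-pS {u} per with T^q≡S per
    ... | h , h-per , e with T^q≡S h-per
    ... | h′ , _ , e′ = h′ , λ m → begin
      T^ (q ℕ.+ q) u m                 ≡⟨ T^-+ q q u m ⟨
      T^ q (T^ q u) m                  ≡⟨ T^-cong q e m ⟩
      T^ q (λ i → S u + + p * h i) m   ≡⟨ T^affine 0<q (S u) (+ p) h m ⟩
      + p * T^ q h m                   ≡⟨ cong (+ p *_) (e′ m) ⟩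
      + p * (S h + + p * h′ m)         ≡⟨ cong (λ z → + p * (z + + p * h′ m)) Sh ⟩
      + p * (- S u + + p * h′ m)       ≡⟨ ring (+ p) (S u) (h′ m) ⟩
      - (+ p * S u) + (+ p * + p) * h′ m ∎
      where
      open ≡-Reasoning
      ring : ∀ p s h → p * (- s + p * h) ≡ - (p * s) + (p * p) * h
      ring = solve-∀
      Sh : S h ≡ - S u
      Sh = ℤ.*-cancelˡ-≡ (+ p) (S h) (- S u) (begin
        + p * S h                        ≡⟨ ring′ (+ p * S u) (+ p * S h) ⟩
        (+ p * S u + + p * S h) - + p * S u ≡⟨ cong (_- (+ p * S u)) (cong₂ _+_ (sum-const p (S u)) (Σ<-*ˡ p (+ p) h)) ⟨
        (S (λ _ → S u) + S (λ i → + p * h i)) - + p * S u ≡⟨ cong (_- (+ p * S u)) (Σ<-+ p (λ _ → S u) (λ i → + p * h i)) ⟨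
        S (λ i → S u + + p * h i) - + p * S u ≡⟨ cong (_- (+ p * S u)) (Σ<-cong p e) ⟨
        S (T^ q u) - + p * S u           ≡⟨ cong (_- (+ p * S u)) (T^[1+]-S 0<q per) ⟩
        0ℤ - + p * S u                   ≡⟨ ring″ (+ p) (S u) ⟩
        + p * - S u                      ∎)
        where
        ring′ : ∀ x y → y ≡ (x + y) - x
        ring′ = solve-∀
        ring″ : ∀ x y → 0ℤ - x * y ≡ x * - y
        ring″ = solve-∀

    -- In group ring terms, the product of w with the conjugate of u, so that `R u u` plays the role
    -- of a norm to the real subfield.
    R : Seq → Seq → Seq
    R u w ε = S (λ i → u i * w (i ℕ.+ ε))

    R-T^ʳ : ∀ k u w ε → R u (T^ k w) ε ≡ T^ k (R u w) ε
    R-T^ʳ zero    u w ε = refl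
    R-T^ʳ (suc k) u w ε = begin
      S (λ i → u i * (w′ (suc (i ℕ.+ ε)) - w′ (i ℕ.+ ε)))
        ≡⟨ Σ<-cong p (λ i → ℤ.*-distribˡ-+ (u i) (w′ (suc (i ℕ.+ ε))) (- w′ (i ℕ.+ ε))) ⟩
      S (λ i → u i * w′ (suc (i ℕ.+ ε)) + u i * - w′ (i ℕ.+ ε))
        ≡⟨ Σ<-cong p (λ i → cong₂ _+_ (cong (λ z → u i * w′ z) (sym (ℕ.+-suc i ε))) (sym (ℤ.neg-distribʳ-* (u i) (w′ (i ℕ.+ ε))))) ⟩
      S (λ i → u i * w′ (i ℕ.+ suc ε) - u i * w′ (i ℕ.+ ε))
        ≡⟨ Σ<-- p (λ i → u i * w′ (i ℕ.+ suc ε)) (λ i → u i * w′ (i ℕ.+ ε)) ⟩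
      R u w′ (suc ε) - R u w′ ε
        ≡⟨ cong₂ _-_ (R-T^ʳ k u w (suc ε)) (R-T^ʳ k u w ε) ⟩
      T^ (suc k) (R u w) ε ∎
      where
      open ≡-Reasoning
      w′ = T^ k w

    R-suc : ∀ {u w} → Periodic u → Periodic w → ∀ ε → R (u ∘ suc) w (suc ε) ≡ R u w ε
    R-suc {u} {w} pu pw ε = begin
      S (λ i → u (suc i) * w (i ℕ.+ suc ε)) ≡⟨ Σ<-cong p (λ i → cong (λ z → u (suc i) * w z) (ℕ.+-suc i ε)) ⟩
      S (λ i → u (suc i) * w (suc i ℕ.+ ε)) ≡⟨ S-suc (λ i → cong₂ _*_ (pu i) (trans (cong w (swap i ε p)) (pw (i ℕ.+ ε)))) ⟩
      S (λ i → u i * w (i ℕ.+ ε))           ∎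
      where
      open ≡-Reasoning
      swap : ∀ a b c → (a ℕ.+ c) ℕ.+ b ≡ (a ℕ.+ b) ℕ.+ c
      swap = ℕ-Solver.solve-∀

    -- For the shift σ, conjugation turns σ - 1 into σ⁻¹ - 1 = -σ⁻¹ (σ - 1); this accounts for the
    -- sign and for the displacement of the argument by k.
    R-T^ˡ : ∀ k {u w} → Periodic u → Periodic w → ∀ ε → T^ k (R u w) ε ≡ (-1ℤ ^ k) * R (T^ k u) w (k ℕ.+ ε)
    R-T^ˡ zero    pu pw ε = sym (ℤ.*-identityˡ _)
    R-T^ˡ (suc k) {u} {w} pu pw ε = begin
      T^ k (R u w) (suc ε) - T^ k (R u w) ε
        ≡⟨ cong₂ _-_ (R-T^ˡ k pu pw (suc ε)) (R-T^ˡ k pu pw ε) ⟩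
      s * R u′ w (k ℕ.+ suc ε) - s * R u′ w (k ℕ.+ ε)
        ≡⟨ cong (λ z → s * R u′ w z - s * R u′ w (k ℕ.+ ε)) (ℕ.+-suc k ε) ⟩
      s * R u′ w (suc (k ℕ.+ ε)) - s * R u′ w (k ℕ.+ ε)
        ≡⟨ cong (λ z → s * R u′ w (suc (k ℕ.+ ε)) - s * z) (R-suc (T^-periodic k pu) pw (k ℕ.+ ε)) ⟨
      s * R u′ w (suc (k ℕ.+ ε)) - s * R (u′ ∘ suc) w (suc (k ℕ.+ ε))
        ≡⟨ ring s _ _ ⟩
      (-1ℤ * s) * (R (u′ ∘ suc) w (suc (k ℕ.+ ε)) - R u′ w (suc (k ℕ.+ ε)))
        ≡⟨ cong ((-1ℤ * s) *_) (Σ<-- p (λ i → u′ (suc i) * w (i ℕ.+ suc (k ℕ.+ ε))) (λ i → u′ i * w (i ℕ.+ suc (k ℕ.+ ε)))) ⟨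
      (-1ℤ * s) * S (λ i → u′ (suc i) * w (i ℕ.+ suc (k ℕ.+ ε)) - u′ i * w (i ℕ.+ suc (k ℕ.+ ε)))
        ≡⟨ cong ((-1ℤ * s) *_) (Σ<-cong p (λ i → ring′ (u′ (suc i)) (u′ i) (w (i ℕ.+ suc (k ℕ.+ ε))))) ⟩
      (-1ℤ * s) * R (T u′) w (suc k ℕ.+ ε) ∎
      where
      open ≡-Reasoning
      s = -1ℤ ^ k
      u′ = T^ k u
      ring : ∀ s x y → s * x - s * y ≡ (-1ℤ * s) * (y - x)
      ring = solve-∀
      ring′ : ∀ x y z → x * z - y * z ≡ (x - y) * z
      ring′ = solve-∀

    -- The augmentation of a group ring is multiplicative. With u = w it turns p dividing S (R W W)
    -- into p dividing the square of S W.
    S-R : ∀ {u w} → Periodic w → S (R u w) ≡ S u * S w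
    S-R {u} {w} pw = begin
      S (λ ε → S (λ i → u i * w (i ℕ.+ ε)))  ≡⟨ ∑.∑-comm {p} {p} (λ ε i → u (toℕ i) * w (toℕ i ℕ.+ toℕ ε)) ⟩
      S (λ i → S (λ ε → u i * w (i ℕ.+ ε)))  ≡⟨ Σ<-cong p (λ i → Σ<-*ˡ p (u i) (λ ε → w (i ℕ.+ ε))) ⟩
      S (λ i → u i * S (λ ε → w (i ℕ.+ ε)))  ≡⟨ Σ<-cong p (λ i → cong (u i *_)
                                                   (trans (Σ<-cong p (λ ε → cong w (ℕ.+-comm i ε))) (S-shift pw i))) ⟩
      S (λ i → u i * S w)                    ≡⟨ Σ<-*ʳ p (S w) u ⟩
      S u * S w                              ∎
      where open ≡-Reasoning

    R-periodic : ∀ {u w} → Periodic w → Periodic (R u w)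
    R-periodic {u} {w} pw ε = Σ<-cong p (λ i → cong (u i *_) (trans (cong w (sym (ℕ.+-assoc i ε p))) (pw (i ℕ.+ ε))))

    -- The partial sums solve the difference equation, and they close up after p steps because the
    -- period sum is zero.
    antidifference : ∀ {u} → Periodic u → S u ≡ 0ℤ → ∃ λ w → Periodic w × (∀ m → u m ≡ T w m)
    antidifference {u} per Su≡0 = w , w-periodic , u≡Tw
      where
      open ≡-Reasoning
      w : Seq
      w m = Σ< m u
      u≡Tw : ∀ m → u m ≡ T w m
      u≡Tw m = trans (ring (w m) (u m)) (cong (_- w m) (sym (Σ<-last m u)))
        where
        ring : ∀ a b → b ≡ (a + b) - a
        ring = solve-∀
      w-periodic : Periodic w
      w-periodic zero    = Su≡0
      w-periodic (suc m) = begin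
        w (suc (m ℕ.+ p))        ≡⟨ Σ<-last (m ℕ.+ p) u ⟩
        w (m ℕ.+ p) + u (m ℕ.+ p) ≡⟨ cong₂ _+_ (w-periodic m) (per m) ⟩
        w m + u m                ≡⟨ Σ<-last m u ⟨
        w (suc m)                ∎

    -- In ℤ[ζ], the group ring of ℤ/p modulo constants, the hypothesis says V V̄ = p². Since p is up to a unit the
    -- (p-1)-st power of the prime T = ζ - 1, and T̄ is associated with T, V is divisible by T^(p-1), hence by p.
    module FlatAutocorrelation (V : Seq) (V-periodic : Periodic V) (A₀ : ℤ) (δ : Seq)
      (flat : ∀ ε → R V V ε ≡ A₀ + (+ p * + p) * δ ε) where

      -- Divisibility of V by the k-th power of `T` modulo constants, with quotient W.
      Step : ℕ → Set
      Step k = ∃₂ λ W κ → Periodic W × (∀ m → V m ≡ T^ k W m + κ)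

      -- The autocorrelation of T^k W is constant modulo p², and up to sign and shift it is T^(2k)
      -- of that of W. Further differences remove the constant, so T^(2q) (R W W) vanishes modulo
      -- p²; `T^2q≡-pS` then gives p dividing S (R W W) = (S W)².
      p∣S : ∀ {k} → k ℕ.< q → (st : Step k) → + p ∣ S (proj₁ st)
      p∣S {k} k<q (W , κ , W-per , e) =
        prime∣²⇒∣ p-prime (S W) (*-cancelˡ-∣ (+ p) (divides (h 0 - x) (begin
          + p * (S W * S W)            ≡⟨ cong (+ p *_) (S-R {W} W-per) ⟨
          + p * S (R W W)              ≡⟨ solveFor (+ p * S (R W W)) (+ p * + p) (h 0) x (trans (sym (hyp 0)) (div 0)) ⟩
          (h 0 - x) * (+ p * + p)      ∎)))
        where
        open ≡-Reasoning
        W′ = T^ k W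
        solveFor : ∀ s P h x → - s + P * h ≡ P * x → s ≡ (h - x) * P
        solveFor s P h x eq = trans (ring s P h) (trans (cong (λ z → P * h - z) eq) (ring′ P h x))
          where
          ring : ∀ s P h → s ≡ P * h - (- s + P * h)
          ring = solve-∀
          ring′ : ∀ P h x → P * h - P * x ≡ (h - x) * P
          ring′ = solve-∀
        h = proj₁ (T^2q≡-pS (R-periodic {W} W-per))
        hyp = proj₂ (T^2q≡-pS (R-periodic {W} W-per))
        -- Passing from V to V - κ changes the autocorrelation only by a constant, since the sum
        -- over a period is invariant under shifts.
        A₁ = A₀ - (S W′ * κ + κ * S W′ + + p * (κ * κ))
        flat′ : ∀ ε → R W′ W′ ε ≡ A₁ + (+ p * + p) * δ ε
        flat′ ε = trans (ring (R W′ W′ ε) K) (trans (cong (_- K) (trans (sym expand) (flat ε))) (ring′ A₀ ((+ p * + p) * δ ε) K))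
          where
          K = S W′ * κ + κ * S W′ + + p * (κ * κ)
          ring : ∀ r k → r ≡ (r + k) - k
          ring = solve-∀
          ring′ : ∀ c d k → (c + d) - k ≡ (c - k) + d
          ring′ = solve-∀
          distr : ∀ a b k → (a + k) * (b + k) ≡ a * b + (a * k + (k * b + k * k))
          distr = solve-∀
          assoc : ∀ a b c d → a + (b + (c + d)) ≡ a + (b + c + d)
          assoc = solve-∀
          expand : R V V ε ≡ R W′ W′ ε + K
          expand = begin
            S (λ i → V i * V (i ℕ.+ ε))
              ≡⟨ Σ<-cong p (λ i → trans (cong₂ _*_ (e i) (e (i ℕ.+ ε))) (distr (W′ i) (W′ (i ℕ.+ ε)) κ)) ⟩
            S (λ i → W′ i * W′ (i ℕ.+ ε) + (W′ i * κ + (κ * W′ (i ℕ.+ ε) + κ * κ)))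
              ≡⟨ trans (Σ<-+ p (λ i → W′ i * W′ (i ℕ.+ ε)) (λ i → W′ i * κ + (κ * W′ (i ℕ.+ ε) + κ * κ))) (cong (_+_ (R W′ W′ ε))
                   (trans (Σ<-+ p (λ i → W′ i * κ) (λ i → κ * W′ (i ℕ.+ ε) + κ * κ)) (cong (_+_ (S (λ i → W′ i * κ)))
                     (Σ<-+ p (λ i → κ * W′ (i ℕ.+ ε)) (λ _ → κ * κ))))) ⟩
            R W′ W′ ε + (S (λ i → W′ i * κ) + (S (λ i → κ * W′ (i ℕ.+ ε)) + S (λ _ → κ * κ)))
              ≡⟨ cong (_+_ (R W′ W′ ε)) (cong₂ _+_ (Σ<-*ʳ p κ W′) (cong₂ _+_
                   (trans (Σ<-*ˡ p κ (λ i → W′ (i ℕ.+ ε))) (cong (κ *_) (S-shift (T^-periodic k W-per) ε)))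
                   (sum-const p (κ * κ)))) ⟩
            R W′ W′ ε + (S W′ * κ + (κ * S W′ + + p * (κ * κ)))
              ≡⟨ assoc (R W′ W′ ε) (S W′ * κ) (κ * S W′) (+ p * (κ * κ)) ⟩
            R W′ W′ ε + K ∎
        s = -1ℤ ^ k
        η : Seq
        η ε = s * δ (k ℕ.+ ε)
        T^k+k : ∀ ε → T^ (k ℕ.+ k) (R W W) ε ≡ s * A₁ + (+ p * + p) * η ε
        T^k+k ε = begin
          T^ (k ℕ.+ k) (R W W) ε            ≡⟨ T^-+ k k (R W W) ε ⟨
          T^ k (T^ k (R W W)) ε             ≡⟨ T^-cong k (λ m → sym (R-T^ʳ k W W m)) ε ⟩
          T^ k (R W W′) ε                   ≡⟨ R-T^ˡ k W-per (T^-periodic k W-per) ε ⟩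
          s * R W′ W′ (k ℕ.+ ε)             ≡⟨ cong (s *_) (flat′ (k ℕ.+ ε)) ⟩
          s * (A₁ + (+ p * + p) * δ (k ℕ.+ ε)) ≡⟨ ring s A₁ (+ p * + p) (δ (k ℕ.+ ε)) ⟩
          s * A₁ + (+ p * + p) * η ε        ∎
          where
          ring : ∀ s c P d → s * (c + P * d) ≡ s * c + P * (s * d)
          ring = solve-∀
        -- The number of differences that raises 2k to 2q; it is positive because k < q, so the
        -- constant `s * A₁` disappears.
        j = (q ∸ k) ℕ.+ (q ∸ k)
        j+2k≡2q : j ℕ.+ (k ℕ.+ k) ≡ q ℕ.+ q
        j+2k≡2q = trans (ring (q ∸ k) k) (cong (λ z → z ℕ.+ z) (ℕ.m∸n+n≡m (ℕ.<⇒≤ k<q)))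
          where
          ring : ∀ a b → (a ℕ.+ a) ℕ.+ (b ℕ.+ b) ≡ (a ℕ.+ b) ℕ.+ (a ℕ.+ b)
          ring = ℕ-Solver.solve-∀
        x = T^ j η 0
        div : ∀ m → T^ (q ℕ.+ q) (R W W) m ≡ (+ p * + p) * T^ j η m
        div m = begin
          T^ (q ℕ.+ q) (R W W) m               ≡⟨ cong (λ z → T^ z (R W W) m) j+2k≡2q ⟨
          T^ (j ℕ.+ (k ℕ.+ k)) (R W W) m       ≡⟨ T^-+ j (k ℕ.+ k) (R W W) m ⟨
          T^ j (T^ (k ℕ.+ k) (R W W)) m        ≡⟨ T^-cong j T^k+k m ⟩
          T^ j (λ ε → s * A₁ + (+ p * + p) * η ε) m
            ≡⟨ T^affine (ℕ.≤-trans (ℕ.m<n⇒0<n∸m k<q) (ℕ.m≤m+n (q ∸ k) (q ∸ k))) (s * A₁) (+ p * + p) η m ⟩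
          (+ p * + p) * T^ j η m               ∎

      -- Since p divides S W, subtracting the constant r = S W / p makes the period sum zero, and W
      -- - r is then a difference. The subtracted constant is absorbed into κ.
      extend : ∀ {k} → k ℕ.< q → Step k → Step (suc k)
      extend {k} k<q st@(W , κ , W-per , e) =
        W₁ , κ₁ + κ , proj₁ (proj₂ anti) , λ m → begin
          V m                             ≡⟨ e m ⟩
          T^ k W m + κ                    ≡⟨ cong (_+ κ) (trans (T^-cong k (λ i → ring (W i) r) m) (eq m)) ⟩
          (T^ k W₀ m + κ₁) + κ            ≡⟨ ℤ.+-assoc (T^ k W₀ m) κ₁ κ ⟩
          T^ k W₀ m + (κ₁ + κ)            ≡⟨ cong (_+ (κ₁ + κ)) (trans (T^-cong k (proj₂ (proj₂ anti)) m) (T^-T k W₁ m)) ⟩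
          T^ (suc k) W₁ m + (κ₁ + κ)      ∎
        where
        open ≡-Reasoning
        d = p∣S k<q st
        r = _∣_.quotient d
        W₀ : Seq
        W₀ i = W i - r
        ring : ∀ a b → a ≡ (a - b) + b
        ring = solve-∀
        κ₁ = proj₁ (T^-const-+ k W₀ r)
        eq = proj₂ (T^-const-+ k W₀ r)
        anti = antidifference {W₀} (λ m → cong (_- r) (W-per m))
          (trans (Σ<-- p W (λ _ → r)) (trans (cong₂ _-_ (trans (_∣_.equality d) (ℤ.*-comm r (+ p))) (sum-const p r)) (ℤ.+-inverseʳ (+ p * r))))
        W₁ = proj₁ anti

      step : ∀ k → k ℕ.≤ q → Step k
      step zero    _   = V , 0ℤ , V-periodic , λ m → sym (ℤ.+-identityʳ (V m))
      step (suc k) k<q = extend k<q (step k (ℕ.<⇒≤ k<q))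

      -- After q steps V is T^q W plus a constant, and T^q W is congruent to the constant S W modulo
      -- p by `T^q≡S`.
      V≡const[mod-p] : ∃₂ λ κ (z : Seq) → ∀ m → V m ≡ κ + + p * z m
      V≡const[mod-p] with step q ℕ.≤-refl
      ... | W , κ , W-per , e with T^q≡S W-per
      ... | h , _ , e′ = S W + κ , h , λ m → trans (e m) (trans (cong (_+ κ) (e′ m)) (ring (S W) (+ p * h m) κ))
        where
        ring : ∀ a b c → (a + b) + c ≡ (a + c) + b
        ring = solve-∀

  -- Kronecker deltas and integer vectors of small norm.

  𝟙 : Bool → ℤ
  𝟙 b = if b then 1ℤ else 0ℤ

  δ : ∀ {n} → Fin n → Fin n → ℤ
  δ i j = 𝟙 (does (i ≟ j))

  δ-≡ : ∀ {n} {i j : Fin n} → i ≡ j → δ i j ≡ 1ℤ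
  δ-≡ {i = i} {j} e = cong 𝟙 (dec-true (i ≟ j) e)

  δ-≢ : ∀ {n} {i j : Fin n} → ¬ i ≡ j → δ i j ≡ 0ℤ
  δ-≢ {i = i} {j} ne = cong 𝟙 (dec-false (i ≟ j) ne)

  δ-cong : ∀ {m n} {i j : Fin m} {k l : Fin n} → (i ≡ j → k ≡ l) → (k ≡ l → i ≡ j) → δ i j ≡ δ k l
  δ-cong {i = i} {j} f g with i ≟ j
  ... | yes e = sym (δ-≡ (f e))
  ... | no ne = sym (δ-≢ (ne ∘ g))

  sum-zero : ∀ {n} {h : Fin n → ℤ} → (∀ i → h i ≡ 0ℤ) → sum h ≡ 0ℤ
  sum-zero {n} e = trans (∑.sum-cong-≗ {n} e) (∑.sum-replicate-zero n)

  sum-δ : ∀ {n} (a : Fin n) (h : Fin n → ℤ) → sum (λ i → δ i a * h i) ≡ h a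
  sum-δ {suc n} zero h = begin
    1ℤ * h zero + sum (λ i → 0ℤ * h (suc i)) ≡⟨ cong (_+_ (1ℤ * h zero)) (sum-zero {n} (λ _ → refl)) ⟩
    1ℤ * h zero + 0ℤ                         ≡⟨ ring (h zero) ⟩
    h zero                                   ∎
    where
    open ≡-Reasoning
    ring : ∀ x → 1ℤ * x + 0ℤ ≡ x
    ring = solve-∀
  sum-δ {suc n} (suc a) h = begin
    0ℤ * h zero + sum (λ i → δ i a * h (suc i)) ≡⟨ cong (_+_ (0ℤ * h zero)) (sum-δ a (h ∘ suc)) ⟩
    0ℤ * h zero + h (suc a)                     ≡⟨ ℤ.+-identityˡ (h (suc a)) ⟩
    h (suc a)                                   ∎
    where open ≡-Reasoning

  sum-pos : ∀ {n} (a : Fin n → ℕ) → sum (λ i → + a i) ≡ + ∑ℕ.sum a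
  sum-pos {zero}  a = refl
  sum-pos {suc n} a = cong (λ z → + a zero + z) (sum-pos (a ∘ suc))

  square≡∣∣² : ∀ z → z * z ≡ + (ℤ.∣ z ∣ ℕ.* ℤ.∣ z ∣)
  square≡∣∣² (+ n)    = sym (ℤ.pos-* n n)
  square≡∣∣² -[1+ n ] = refl

  sumℕ≡0 : ∀ {n} (a : Fin n → ℕ) → ∑ℕ.sum a ≡ 0 → ∀ i → a i ≡ 0
  sumℕ≡0 a e zero    = ℕ.m+n≡0⇒m≡0 (a zero) e
  sumℕ≡0 a e (suc i) = sumℕ≡0 (a ∘ suc) (ℕ.m+n≡0⇒n≡0 (a zero) e) i

  ∣z∣²≡0⇒z≡0 : ∀ z → ℤ.∣ z ∣ ℕ.* ℤ.∣ z ∣ ≡ 0 → z ≡ 0ℤ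
  ∣z∣²≡0⇒z≡0 (+ zero) _ = refl

  sum-squares≡1 : ∀ {n} (z : Fin n → ℤ) → ∑ℕ.sum (λ i → ℤ.∣ z i ∣ ℕ.* ℤ.∣ z i ∣) ≡ 1 →
                  ∃ λ j → ∀ i → ¬ i ≡ j → z i ≡ 0ℤ
  sum-squares≡1 {suc n} z e with z zero in eq
  ... | + zero = let j , f = sum-squares≡1 (z ∘ suc) e in
    suc j , λ { zero _ → eq ; (suc i) ne → f i (ne ∘ cong suc) }
  ... | + suc m = zero , λ
    { zero ne → ⊥-elim (ne refl)
    ; (suc i) _ → ∣z∣²≡0⇒z≡0 (z (suc i)) (sumℕ≡0 (λ i → ℤ.∣ z (suc i) ∣ ℕ.* ℤ.∣ z (suc i) ∣)
                    (ℕ.m+n≡0⇒n≡0 (m ℕ.+ m ℕ.* suc m) (ℕ.suc-injective e)) i) }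
  ... | -[1+ m ] = zero , λ
    { zero ne → ⊥-elim (ne refl)
    ; (suc i) _ → ∣z∣²≡0⇒z≡0 (z (suc i)) (sumℕ≡0 (λ i → ℤ.∣ z (suc i) ∣ ℕ.* ℤ.∣ z (suc i) ∣)
                    (ℕ.m+n≡0⇒n≡0 (m ℕ.+ m ℕ.* suc m) (ℕ.suc-injective e)) i) }

  -- The one nonzero entry is written as the total, because the total is what is known where the
  -- lemma is applied.
  sum-squares≡1⇒single : ∀ {n} (z : Fin n → ℤ) → sum (λ i → z i * z i) ≡ 1ℤ →
                         ∃ λ j → ∀ i → z i ≡ sum z * δ i j
  sum-squares≡1⇒single {n} z e = j , λ i → trans (single i) (cong (_* δ i j) (sym total))
    where
    found = sum-squares≡1 z (ℤ.+-injective (trans (sym (sum-pos (λ i → ℤ.∣ z i ∣ ℕ.* ℤ.∣ z i ∣)))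
              (trans (∑.sum-cong-≗ {n} (λ i → sym (square≡∣∣² (z i)))) e)))
    j = proj₁ found
    single : ∀ i → z i ≡ z j * δ i j
    single i with i ≟ j
    ... | yes refl = sym (ℤ.*-identityʳ (z i))
    ... | no ne    = trans (proj₂ found i ne) (sym (ℤ.*-zeroʳ (z j)))
    total : sum z ≡ z j
    total = trans (∑.sum-cong-≗ {n} (λ i → trans (single i) (ℤ.*-comm (z j) (δ i j)))) (sum-δ j (λ _ → z j))

  sum-affine : ∀ {n} a b (f : Fin n → ℤ) → sum (λ i → a + b * f i) ≡ + n * a + b * sum f
  sum-affine {n} a b f = trans (∑.∑-distrib-+ (λ _ → a) (λ i → b * f i))
    (cong₂ _+_ (sum-const n a) (sym (∑.*-distribˡ-sum b f)))

  sum-affine² : ∀ {n} a b (f : Fin n → ℤ) →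
    sum (λ i → (a + b * f i) * (a + b * f i)) ≡ (+ n * (a * a) + (a * b + a * b) * sum f) + (b * b) * sum (λ i → f i * f i)
  sum-affine² {n} a b f = begin
    sum (λ i → (a + b * f i) * (a + b * f i))
      ≡⟨ ∑.sum-cong-≗ {n} (λ i → ring a b (f i)) ⟩
    sum (λ i → (a * a + (a * b + a * b) * f i) + (b * b) * (f i * f i))
      ≡⟨ ∑.∑-distrib-+ (λ i → a * a + (a * b + a * b) * f i) (λ i → (b * b) * (f i * f i)) ⟩
    sum (λ i → a * a + (a * b + a * b) * f i) + sum (λ i → (b * b) * (f i * f i))
      ≡⟨ cong₂ _+_ (sum-affine (a * a) (a * b + a * b) f) (sym (∑.*-distribˡ-sum (b * b) (λ i → f i * f i))) ⟩
    (+ n * (a * a) + (a * b + a * b) * sum f) + (b * b) * sum (λ i → f i * f i) ∎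
    where
    open ≡-Reasoning
    ring : ∀ a b x → (a + b * x) * (a + b * x) ≡ (a * a + (a * b + a * b) * x) + (b * b) * (x * x)
    ring = solve-∀

  Unit : ℤ → Set
  Unit c = c ≡ 1ℤ ⊎ c ≡ -1ℤ

  Unit⇒²≡1 : ∀ {c} → Unit c → c * c ≡ 1ℤ
  Unit⇒²≡1 (inj₁ refl) = refl
  Unit⇒²≡1 (inj₂ refl) = refl

  module _ {q : ℕ} (p-prime : Prime (suc q)) where

    private
      P : ℤ
      P = + suc q

    unit-mod-p : ∀ {a} → P ∣ a * a - 1ℤ → ∃₂ λ c r → Unit c × a ≡ c + P * r
    unit-mod-p {a} d with prime∣*⇒∣⊎∣ p-prime (a - 1ℤ) (a + 1ℤ) (subst (P ∣_) (ring a) d)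
      where
      ring : ∀ a → a * a - 1ℤ ≡ (a - 1ℤ) * (a + 1ℤ)
      ring = solve-∀
    ... | inj₁ (divides r e) = 1ℤ , r , inj₁ refl , solve′ a P r e
      where
      solve′ : ∀ a P r → a - 1ℤ ≡ r * P → a ≡ 1ℤ + P * r
      solve′ a P r e = trans (ring a) (cong (_+_ 1ℤ) (trans e (ℤ.*-comm r P)))
        where
        ring : ∀ a → a ≡ 1ℤ + (a - 1ℤ)
        ring = solve-∀
    ... | inj₂ (divides r e) = -1ℤ , r , inj₂ refl , solve′ a P r e
      where
      solve′ : ∀ a P r → a + 1ℤ ≡ r * P → a ≡ -1ℤ + P * r
      solve′ a P r e = trans (ring a) (cong (_+_ -1ℤ) (trans e (ℤ.*-comm r P)))
        where
        ring : ∀ a → a ≡ -1ℤ + (a + 1ℤ)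
        ring = solve-∀

    -- Writing V = P + c + P z with c = ±1, the two hypotheses become Σ z = - c and Σ z² = 1.
    two-valued : (V : Fin (suc q) → ℤ) (κ : ℤ) (z : Fin (suc q) → ℤ) → (∀ i → V i ≡ κ + P * z i) →
      sum V ≡ P * P → sum (λ i → V i * V i) ≡ (P * P * P + P * P) - P →
      ∃₂ λ c j → Unit c × (∀ i → V i ≡ (P + c) - (c * P) * δ i j)
    two-valued V κ z V≡ ΣV ΣV² = c , j , c-unit , λ i → begin
        V i                             ≡⟨ V≡ i ⟩
        κ + P * z i                     ≡⟨ ring₅ κ P (z i) r ⟩
        κ - P * r + P * (z i + r)       ≡⟨ cong (λ w → κ - P * r + P * w) (trans (proj₂ single i) (cong (_* δ i j) Σw)) ⟩
        κ - P * r + P * (- c * δ i j)   ≡⟨ cong (_+ P * (- c * δ i j)) κ-Pr ⟩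
        (P + c) + P * (- c * δ i j)     ≡⟨ ring₆ (P + c) P c (δ i j) ⟩
        (P + c) - (c * P) * δ i j       ∎
      where
      open ≡-Reasoning
      n = suc q
      a = κ - P
      Z = sum z
      Z² = sum (λ i → z i * z i)
      ring₅ : ∀ κ P z r → κ + P * z ≡ κ - P * r + P * (z + r)
      ring₅ = solve-∀
      ring₆ : ∀ x P c d → x + P * (- c * d) ≡ x - (c * P) * d
      ring₆ = solve-∀
      Z≡ : Z ≡ - a
      Z≡ = ℤ.*-cancelˡ-≡ P Z (- a) (begin
        P * Z                    ≡⟨ ring₁ P κ Z ⟩
        (P * κ + P * Z) - P * κ  ≡⟨ cong (_- P * κ) (sum-affine κ P z) ⟨
        sum (λ i → κ + P * z i) - P * κ ≡⟨ cong (_- P * κ) (trans (sym (∑.sum-cong-≗ {n} V≡)) ΣV) ⟩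
        P * P - P * κ            ≡⟨ ring₂ P κ ⟩
        P * - (κ - P)            ∎)
        where
        ring₁ : ∀ P κ Z → P * Z ≡ (P * κ + P * Z) - P * κ
        ring₁ = solve-∀
        ring₂ : ∀ P κ → P * P - P * κ ≡ P * - (κ - P)
        ring₂ = solve-∀
      PZ² : P * Z² ≡ P + a * a - 1ℤ
      PZ² = ℤ.*-cancelˡ-≡ P (P * Z²) (P + a * a - 1ℤ) (begin
        P * (P * Z²)
          ≡⟨ ring₁ P κ Z Z² ⟩
        ((P * (κ * κ) + (κ * P + κ * P) * Z) + (P * P) * Z²) - P * (κ * κ) - (κ * P + κ * P) * Z
          ≡⟨ cong₂ (λ x y → x - P * (κ * κ) - (κ * P + κ * P) * y)
               (trans (sym (sum-affine² κ P z)) (trans (∑.sum-cong-≗ {n} (λ i → cong₂ _*_ (sym (V≡ i)) (sym (V≡ i)))) ΣV²)) Z≡ ⟩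
        ((P * P * P + P * P) - P) - P * (κ * κ) - (κ * P + κ * P) * - a
          ≡⟨ ring₂ P κ ⟩
        P * (P + a * a - 1ℤ) ∎)
        where
        ring₁ : ∀ P κ Z Z² → P * (P * Z²) ≡ ((P * (κ * κ) + (κ * P + κ * P) * Z) + (P * P) * Z²) - P * (κ * κ) - (κ * P + κ * P) * Z
        ring₁ = solve-∀
        ring₂ : ∀ P κ → ((P * P * P + P * P) - P) - P * (κ * κ) - (κ * P + κ * P) * - (κ - P) ≡ P * (P + (κ - P) * (κ - P) - 1ℤ)
        ring₂ = solve-∀
      -- `PZ²` exhibits a² - 1 as a multiple of P, so a = κ - P is congruent to 1 or -1.
      unit = unit-mod-p {a} (divides (Z² - 1ℤ) (trans (ring₁ P a) (trans (cong (_- P) (sym PZ²)) (ring₂ P Z²))))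
        where
        ring₁ : ∀ P a → a * a - 1ℤ ≡ (P + a * a - 1ℤ) - P
        ring₁ = solve-∀
        ring₂ : ∀ P z → P * z - P ≡ (z - 1ℤ) * P
        ring₂ = solve-∀
      c = proj₁ unit
      r = proj₁ (proj₂ unit)
      c-unit = proj₁ (proj₂ (proj₂ unit))
      a≡ : a ≡ c + P * r
      a≡ = proj₂ (proj₂ (proj₂ unit))
      κ-Pr : κ - P * r ≡ P + c
      κ-Pr = trans (ring₁ κ P r) (trans (cong (λ x → P + x - P * r) a≡) (ring₂ P c r))
        where
        ring₁ : ∀ κ P r → κ - P * r ≡ P + (κ - P) - P * r
        ring₁ = solve-∀
        ring₂ : ∀ P c r → P + (c + P * r) - P * r ≡ P + c
        ring₂ = solve-∀
      -- The constant κ matters only modulo P: moving P r from κ into P z normalises it to P + c.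
      w : Fin n → ℤ
      w i = z i + r
      Σw : sum w ≡ - c
      Σw = trans (∑.∑-distrib-+ z (λ _ → r)) (trans (cong₂ _+_ (trans Z≡ (cong -_ a≡)) (sum-const n r)) (ring₁ P c r))
        where
        ring₁ : ∀ P c r → - (c + P * r) + P * r ≡ - c
        ring₁ = solve-∀
      Σw² : sum (λ i → w i * w i) ≡ 1ℤ
      Σw² = ℤ.*-cancelˡ-≡ P (sum (λ i → w i * w i)) 1ℤ (begin
        P * sum (λ i → w i * w i)
          ≡⟨ cong (P *_) (∑.sum-cong-≗ {n} (λ i → ring₀ (z i) r)) ⟩
        P * sum (λ i → (r + 1ℤ * z i) * (r + 1ℤ * z i))
          ≡⟨ cong (P *_) (sum-affine² r 1ℤ z) ⟩
        P * ((P * (r * r) + (r * 1ℤ + r * 1ℤ) * Z) + (1ℤ * 1ℤ) * Z²)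
          ≡⟨ ring₁ P r Z Z² ⟩
        P * (P * (r * r) + (r + r) * Z) + P * Z²
          ≡⟨ cong₂ (λ x y → P * (P * (r * r) + (r + r) * x) + y) Z≡ PZ² ⟩
        P * (P * (r * r) + (r + r) * - a) + (P + a * a - 1ℤ)
          ≡⟨ cong (λ x → P * (P * (r * r) + (r + r) * - x) + (P + x * x - 1ℤ)) a≡ ⟩
        P * (P * (r * r) + (r + r) * - (c + P * r)) + (P + (c + P * r) * (c + P * r) - 1ℤ)
          ≡⟨ ring₂ P r c ⟩
        P + (c * c - 1ℤ)
          ≡⟨ cong (λ x → P + (x - 1ℤ)) (Unit⇒²≡1 c-unit) ⟩
        P + 0ℤ
          ≡⟨ ring₃ P ⟩
        P * 1ℤ ∎)
        where
        ring₀ : ∀ z r → (z + r) * (z + r) ≡ (r + 1ℤ * z) * (r + 1ℤ * z)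
        ring₀ = solve-∀
        ring₁ : ∀ P r Z Z² → P * ((P * (r * r) + (r * 1ℤ + r * 1ℤ) * Z) + (1ℤ * 1ℤ) * Z²) ≡ P * (P * (r * r) + (r + r) * Z) + P * Z²
        ring₁ = solve-∀
        ring₂ : ∀ P r c → P * (P * (r * r) + (r + r) * - (c + P * r)) + (P + (c + P * r) * (c + P * r) - 1ℤ) ≡ P + (c * c - 1ℤ)
        ring₂ = solve-∀
        ring₃ : ∀ P → P + 0ℤ ≡ P * 1ℤ
        ring₃ = solve-∀
      single = sum-squares≡1⇒single w Σw²
      j = proj₁ single

open IntegerSequences

-- The operations of Defs as fields: rigid, they do not unfold to arithmetic of ℕ during unification.
record PrimeField (q : ℕ) : Set where
  infixl 6 _+_ _-_
  infixl 7 _*_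
  field
    _+_ _*_ _-_ : Fin (suc q) → Fin (suc q) → Fin (suc q)
    0# 1#       : Fin (suc q)
    red         : ℕ → Fin (suc q)
    isCommutativeRing : IsCommutativeRing _≡_ _+_ _*_ (0# -_) 0# 1#
    minus       : ∀ x y → x - y ≡ x + (0# - y)
    red-0       : red 0 ≡ 0#
    red-1       : red 1 ≡ 1#
    red-+       : ∀ m n → red (m ℕ.+ n) ≡ red m + red n
    red-*       : ∀ m n → red (m ℕ.* n) ≡ red m * red n
    red-toℕ     : ∀ x → red (toℕ x) ≡ x
    red-p       : red (suc q) ≡ 0#
    red≡0⇒p∣    : ∀ m → red m ≡ 0# → suc q ℕ.∣ m

-- The ring of residues modulo p.

module Residues (p : ℕ) .{{_ : NonZero p}} where
  open Field p

  red-cong : ∀ {m n} → m % p ≡ n % p → red m ≡ red n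
  red-cong {m} {n} e = toℕ-injective (trans (toℕ-fromℕ< (m%n<n m p)) (trans e (sym (toℕ-fromℕ< (m%n<n n p)))))

  toℕ-red : ∀ m → toℕ (red m) ≡ m % p
  toℕ-red m = toℕ-fromℕ< (m%n<n m p)

  red-toℕ : ∀ x → red (toℕ x) ≡ x
  red-toℕ x = toℕ-injective (trans (toℕ-red (toℕ x)) (m<n⇒m%n≡m (toℕ<n x)))

  red-+ : ∀ m n → red (m ℕ.+ n) ≡ red m +ₚ red n
  red-+ m n = red-cong (trans (%-distribˡ-+ m n p) (cong₂ (λ a b → (a ℕ.+ b) % p) (sym (toℕ-red m)) (sym (toℕ-red n))))

  red-* : ∀ m n → red (m ℕ.* n) ≡ red m *ₚ red n
  red-* m n = red-cong (trans (%-distribˡ-* m n p) (cong₂ (λ a b → (a ℕ.* b) % p) (sym (toℕ-red m)) (sym (toℕ-red n))))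

  -- Every residue is `red` of a natural number and `red` respects sums and products, so the ring
  -- laws descend from ℕ.
  via-red₁ : {P : Fp → Set} → (∀ a → P (red a)) → ∀ x → P x
  via-red₁ {P} h x = subst P (red-toℕ x) (h (toℕ x))

  via-red₂ : {P : Fp → Fp → Set} → (∀ a b → P (red a) (red b)) → ∀ x y → P x y
  via-red₂ h x y = via-red₁ (λ a → via-red₁ (λ b → h a b) y) x

  via-red₃ : {P : Fp → Fp → Fp → Set} → (∀ a b c → P (red a) (red b) (red c)) → ∀ x y z → P x y z
  via-red₃ h x y z = via-red₂ (λ a b → via-red₁ (λ c → h a b c) z) x y

  open ≡-Reasoning

  +ₚ-comm : ∀ x y → x +ₚ y ≡ y +ₚ x
  +ₚ-comm x y = cong red (ℕ.+-comm (toℕ x) (toℕ y))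

  *ₚ-comm : ∀ x y → x *ₚ y ≡ y *ₚ x
  *ₚ-comm x y = cong red (ℕ.*-comm (toℕ x) (toℕ y))

  +ₚ-assoc : ∀ x y z → (x +ₚ y) +ₚ z ≡ x +ₚ (y +ₚ z)
  +ₚ-assoc = via-red₃ {λ x y z → (x +ₚ y) +ₚ z ≡ x +ₚ (y +ₚ z)} λ a b c → begin
    (red a +ₚ red b) +ₚ red c ≡⟨ cong (_+ₚ red c) (red-+ a b) ⟨
    red (a ℕ.+ b) +ₚ red c    ≡⟨ red-+ (a ℕ.+ b) c ⟨
    red (a ℕ.+ b ℕ.+ c)       ≡⟨ cong red (ℕ.+-assoc a b c) ⟩
    red (a ℕ.+ (b ℕ.+ c))     ≡⟨ red-+ a (b ℕ.+ c) ⟩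
    red a +ₚ red (b ℕ.+ c)    ≡⟨ cong (red a +ₚ_) (red-+ b c) ⟩
    red a +ₚ (red b +ₚ red c) ∎

  *ₚ-assoc : ∀ x y z → (x *ₚ y) *ₚ z ≡ x *ₚ (y *ₚ z)
  *ₚ-assoc = via-red₃ {λ x y z → (x *ₚ y) *ₚ z ≡ x *ₚ (y *ₚ z)} λ a b c → begin
    (red a *ₚ red b) *ₚ red c ≡⟨ cong (_*ₚ red c) (red-* a b) ⟨
    red (a ℕ.* b) *ₚ red c    ≡⟨ red-* (a ℕ.* b) c ⟨
    red (a ℕ.* b ℕ.* c)       ≡⟨ cong red (ℕ.*-assoc a b c) ⟩
    red (a ℕ.* (b ℕ.* c))     ≡⟨ red-* a (b ℕ.* c) ⟩
    red a *ₚ red (b ℕ.* c)    ≡⟨ cong (red a *ₚ_) (red-* b c) ⟩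
    red a *ₚ (red b *ₚ red c) ∎

  distribˡ : ∀ x y z → x *ₚ (y +ₚ z) ≡ (x *ₚ y) +ₚ (x *ₚ z)
  distribˡ = via-red₃ {λ x y z → x *ₚ (y +ₚ z) ≡ (x *ₚ y) +ₚ (x *ₚ z)} λ a b c → begin
    red a *ₚ (red b +ₚ red c)              ≡⟨ cong (red a *ₚ_) (red-+ b c) ⟨
    red a *ₚ red (b ℕ.+ c)                 ≡⟨ red-* a (b ℕ.+ c) ⟨
    red (a ℕ.* (b ℕ.+ c))                  ≡⟨ cong red (ℕ.*-distribˡ-+ a b c) ⟩
    red (a ℕ.* b ℕ.+ a ℕ.* c)              ≡⟨ red-+ (a ℕ.* b) (a ℕ.* c) ⟩
    red (a ℕ.* b) +ₚ red (a ℕ.* c)         ≡⟨ cong₂ _+ₚ_ (red-* a b) (red-* a c) ⟩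
    (red a *ₚ red b) +ₚ (red a *ₚ red c)   ∎

  distribʳ : ∀ x y z → (y +ₚ z) *ₚ x ≡ (y *ₚ x) +ₚ (z *ₚ x)
  distribʳ x y z = trans (*ₚ-comm (y +ₚ z) x) (trans (distribˡ x y z) (cong₂ _+ₚ_ (*ₚ-comm x y) (*ₚ-comm x z)))

  +ₚ-identityˡ : ∀ x → 0ₚ +ₚ x ≡ x
  +ₚ-identityˡ = via-red₁ {λ x → 0ₚ +ₚ x ≡ x} λ a → sym (red-+ 0 a)

  *ₚ-identityˡ : ∀ x → 1ₚ *ₚ x ≡ x
  *ₚ-identityˡ = via-red₁ {λ x → 1ₚ *ₚ x ≡ x} λ a → trans (sym (red-* 1 a)) (cong red (ℕ.*-identityˡ a))

  red-p : red p ≡ 0ₚ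
  red-p = red-cong ([m+n]%n≡m%n 0 p)

  -ₚ+ₚ : ∀ x y → (x -ₚ y) +ₚ y ≡ x
  -ₚ+ₚ x y = begin
    red (toℕ x ℕ.+ (p ∸ toℕ y)) +ₚ y                ≡⟨ cong (red (toℕ x ℕ.+ (p ∸ toℕ y)) +ₚ_) (red-toℕ y) ⟨
    red (toℕ x ℕ.+ (p ∸ toℕ y)) +ₚ red (toℕ y)      ≡⟨ red-+ (toℕ x ℕ.+ (p ∸ toℕ y)) (toℕ y) ⟨
    red (toℕ x ℕ.+ (p ∸ toℕ y) ℕ.+ toℕ y)           ≡⟨ cong red (ℕ.+-assoc (toℕ x) (p ∸ toℕ y) (toℕ y)) ⟩
    red (toℕ x ℕ.+ ((p ∸ toℕ y) ℕ.+ toℕ y))         ≡⟨ cong (λ z → red (toℕ x ℕ.+ z)) (ℕ.m∸n+n≡m (ℕ.<⇒≤ (toℕ<n y))) ⟩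
    red (toℕ x ℕ.+ p)                               ≡⟨ red-cong ([m+n]%n≡m%n (toℕ x) p) ⟩
    red (toℕ x)                                     ≡⟨ red-toℕ x ⟩
    x                                               ∎

  -ₚ-inverseˡ : ∀ y → (0ₚ -ₚ y) +ₚ y ≡ 0ₚ
  -ₚ-inverseˡ = -ₚ+ₚ 0ₚ

  +ₚ-*ₚ-isCommutativeRing : IsCommutativeRing _≡_ _+ₚ_ _*ₚ_ (0ₚ -ₚ_) 0ₚ 1ₚ
  +ₚ-*ₚ-isCommutativeRing = record
    { isRing = record
      { +-isAbelianGroup = record
        { isGroup = record
          { isMonoid = record
            { isSemigroup = record
              { isMagma = record { isEquivalence = isEquivalence ; ∙-cong = cong₂ _+ₚ_ }
              ; assoc = +ₚ-assoc }
            ; identity = +ₚ-identityˡ , λ x → trans (+ₚ-comm x 0ₚ) (+ₚ-identityˡ x) }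
          ; inverse = -ₚ-inverseˡ , λ x → trans (+ₚ-comm x (0ₚ -ₚ x)) (-ₚ-inverseˡ x)
          ; ⁻¹-cong = cong (0ₚ -ₚ_) }
        ; comm = +ₚ-comm }
      ; *-cong = cong₂ _*ₚ_
      ; *-assoc = *ₚ-assoc
      ; *-identity = *ₚ-identityˡ , λ x → trans (*ₚ-comm x 1ₚ) (*ₚ-identityˡ x)
      ; distrib = distribˡ , distribʳ }
    ; *-comm = *ₚ-comm }

  -ₚ-def : ∀ x y → x -ₚ y ≡ x +ₚ (0ₚ -ₚ y)
  -ₚ-def x y = begin
    x -ₚ y                          ≡⟨ trans (+ₚ-comm (x -ₚ y) 0ₚ) (+ₚ-identityˡ (x -ₚ y)) ⟨
    (x -ₚ y) +ₚ 0ₚ                  ≡⟨ cong ((x -ₚ y) +ₚ_) (trans (+ₚ-comm y (0ₚ -ₚ y)) (-ₚ-inverseˡ y)) ⟨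
    (x -ₚ y) +ₚ (y +ₚ (0ₚ -ₚ y))    ≡⟨ +ₚ-assoc (x -ₚ y) y (0ₚ -ₚ y) ⟨
    ((x -ₚ y) +ₚ y) +ₚ (0ₚ -ₚ y)    ≡⟨ cong (_+ₚ (0ₚ -ₚ y)) (-ₚ+ₚ x y) ⟩
    x +ₚ (0ₚ -ₚ y)                  ∎

  red≡0⇒p∣ : ∀ m → red m ≡ 0ₚ → p ℕ.∣ m
  red≡0⇒p∣ m e = ℕ.m%n≡0⇒n∣m m p (trans (sym (toℕ-red m)) (trans (cong toℕ e) (trans (toℕ-red 0) (m<n⇒m%n≡m (ℕ.>-nonZero⁻¹ p)))))

residueField : ∀ q → PrimeField q
residueField q = record
  { _+_ = _+ₚ_ ; _*_ = _*ₚ_ ; _-_ = _-ₚ_ ; 0# = 0ₚ ; 1# = 1ₚ ; red = red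
  ; isCommutativeRing = +ₚ-*ₚ-isCommutativeRing
  ; minus = -ₚ-def ; red-0 = refl ; red-1 = refl
  ; red-+ = red-+ ; red-* = red-* ; red-toℕ = red-toℕ ; red-p = red-p ; red≡0⇒p∣ = red≡0⇒p∣ }
  where
  open Field (suc q)
  open Residues (suc q)

-- Additivity of the p-th power in characteristic p.

module Frobenius {c ℓ} (R : CommutativeRing c ℓ) {q : ℕ} (p-prime : Prime (suc q))
  (p×1≈0 : CommutativeRing._≈_ R (Mult._×_ (CommutativeRing.semiring R) (suc q) (CommutativeRing.1# R)) (CommutativeRing.0# R)) where

  open CommutativeRing R hiding (refl; sym; trans; isEquivalence; zero)
  open CommutativeRing R using () renaming (trans to ≈-trans)
  open Mult semiring using (×-assoc-*; ×-assocˡ; ×-congʳ; ×-congˡ) renaming (_×_ to _⨯_)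
  open Exp commutativeSemiring using (_^_)
  open import Relation.Binary.Reasoning.Setoid setoid
  open Binomial commutativeSemiring using (binomialTerm; theorem)
  private module ∑ᴿ = Sum semiring

  p⨯≈0 : ∀ x → suc q ⨯ x ≈ 0#
  p⨯≈0 x = begin
    suc q ⨯ x          ≈⟨ ×-congʳ (suc q) (*-identityˡ x) ⟨
    suc q ⨯ (1# * x)   ≈⟨ ×-assoc-* (suc q) 1# x ⟨
    (suc q ⨯ 1#) * x   ≈⟨ *-congʳ p×1≈0 ⟩
    0# * x             ≈⟨ zeroˡ x ⟩
    0#                 ∎

  p∣⇒⨯≈0 : ∀ {m} → suc q ℕ.∣ m → ∀ x → m ⨯ x ≈ 0#
  p∣⇒⨯≈0 (ℕ.divides k refl) x = begin
    (k ℕ.* suc q) ⨯ x  ≈⟨ ×-congˡ (ℕ.*-comm k (suc q)) ⟩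
    (suc q ℕ.* k) ⨯ x  ≈⟨ ×-assocˡ x (suc q) k ⟨
    suc q ⨯ (k ⨯ x)    ≈⟨ p⨯≈0 (k ⨯ x) ⟩
    0#                 ∎


  -- Only the two outer binomial coefficients escape divisibility by p. The ring is arbitrary
  -- because the prime field uses this for Fermat's theorem and the quadratic extension for the
  -- trace.
  ^p-+ : ∀ x y → (x + y) ^ suc q ≈ x ^ suc q + y ^ suc q
  ^p-+ x y = begin
    (x + y) ^ suc q            ≈⟨ theorem (suc q) x y ⟩
    t zero + ∑ᴿ.sum (t ∘ suc)  ≈⟨ +-cong first (∑ᴿ.sum-init-last (t ∘ suc)) ⟩
    y ^ suc q + (∑ᴿ.sum (λ i → t (suc (inject₁ i))) + t (suc (fromℕ q)))
      ≈⟨ +-congˡ (+-cong (≈-trans (∑ᴿ.sum-cong-≋ middle) (∑ᴿ.sum-replicate-zero q)) last) ⟩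
    y ^ suc q + (0# + x ^ suc q) ≈⟨ +-congˡ (+-identityˡ (x ^ suc q)) ⟩
    y ^ suc q + x ^ suc q      ≈⟨ +-comm (y ^ suc q) (x ^ suc q) ⟩
    x ^ suc q + y ^ suc q      ∎
    where
    t = binomialTerm x y (suc q)
    first : t zero ≈ y ^ suc q
    first = ≈-trans (+-identityʳ (1# * y ^ suc q)) (*-identityˡ (y ^ suc q))
    last : t (suc (fromℕ q)) ≈ x ^ suc q
    last = begin
      (suc q C suc (toℕ (fromℕ q))) ⨯ (x ^ suc (toℕ (fromℕ q)) * y ^ (q ∸ toℕ (fromℕ q)))
        ≡⟨ cong (λ k → (suc q C suc k) ⨯ (x ^ suc k * y ^ (q ∸ k))) (toℕ-fromℕ q) ⟩
      (suc q C suc q) ⨯ (x ^ suc q * y ^ (q ∸ q))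
        ≡⟨ cong₂ (λ b k → b ⨯ (x ^ suc q * y ^ k)) (nCn≡1 (suc q)) (ℕ.n∸n≡0 q) ⟩
      1 ⨯ (x ^ suc q * 1#)  ≈⟨ +-identityʳ (x ^ suc q * 1#) ⟩
      x ^ suc q * 1#        ≈⟨ *-identityʳ (x ^ suc q) ⟩
      x ^ suc q             ∎
    middle : ∀ i → t (suc (inject₁ i)) ≈ 0#
    middle i = p∣⇒⨯≈0 (prime∣C p-prime (ℕ.≤-trans (ℕ.≤-reflexive (cong suc (toℕ-inject₁ i))) (toℕ<n i))) _

-- Ring identities in the prime field.

module PrimeFieldProperties {q : ℕ} (p-prime : Prime (suc q)) (K : PrimeField q) where

  open PrimeField K public

  𝔽 : Set
  𝔽 = Fin (suc q)

  commutativeRing : CommutativeRing 0ℓ 0ℓ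
  commutativeRing = record { isCommutativeRing = isCommutativeRing }

  open CommutativeRing commutativeRing public
    using (-_; commutativeSemiring; semiring; +-assoc; +-comm; *-assoc; *-comm; distribˡ; distribʳ
          ; +-identityˡ; +-identityʳ; *-identityˡ; *-identityʳ; zeroˡ; zeroʳ; -‿inverseˡ; -‿inverseʳ)
  open RingProperties (CommutativeRing.ring commutativeRing) public using (-‿distribˡ-*; -‿distribʳ-*; -‿+-comm; -‿involutive; -0#≈0#)
  open Exp commutativeSemiring public using (_^_; ^-homo-*; ^-distrib-*; ^-assocʳ)
  open Mult semiring public using () renaming (_×_ to _⨯_)

  private
    fromℤ : ℤ → 𝔽
    fromℤ (ℤ.+ n)    = red n
    fromℤ ℤ.-[1+ n ] = - red (suc n)

    open ≡-Reasoning

    fromℤ-⊖ : ∀ m n → fromℤ (m ℤ.⊖ n) ≡ red m + - red n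
    fromℤ-⊖ m       zero    = begin
      red m            ≡⟨ +-identityʳ (red m) ⟨
      red m + 0#       ≡⟨ cong (red m +_) -0#≈0# ⟨
      red m + - 0#     ≡⟨ cong (λ z → red m + - z) red-0 ⟨
      red m + - red 0  ∎
    fromℤ-⊖ zero    (suc n) = trans (sym (+-identityˡ (- red (suc n)))) (cong (_+ - red (suc n)) (sym red-0))
    fromℤ-⊖ (suc m) (suc n) = begin
      fromℤ (suc m ℤ.⊖ suc n)           ≡⟨ cong fromℤ (ℤ.[1+m]⊖[1+n]≡m⊖n m n) ⟩
      fromℤ (m ℤ.⊖ n)                   ≡⟨ fromℤ-⊖ m n ⟩
      red m + - red n                   ≡⟨ cancel (red 1) (red m) (red n) ⟨
      (red 1 + red m) + - (red 1 + red n) ≡⟨ cong₂ (λ a b → a + - b) (red-+ 1 m) (red-+ 1 n) ⟨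
      red (suc m) + - red (suc n)       ∎
      where
      cancel : ∀ a x y → (a + x) + - (a + y) ≡ x + - y
      cancel a x y = begin
        (a + x) + - (a + y)     ≡⟨ cong₂ _+_ (+-comm a x) (sym (-‿+-comm a y)) ⟩
        (x + a) + (- a + - y)   ≡⟨ +-assoc x a (- a + - y) ⟩
        x + (a + (- a + - y))   ≡⟨ cong (x +_) (+-assoc a (- a) (- y)) ⟨
        x + ((a + - a) + - y)   ≡⟨ cong (λ z → x + (z + - y)) (-‿inverseʳ a) ⟩
        x + (0# + - y)          ≡⟨ cong (x +_) (+-identityˡ (- y)) ⟩
        x + - y                 ∎

    fromℤ-neg : ∀ i → fromℤ (ℤ.- i) ≡ - fromℤ i
    fromℤ-neg (ℤ.+ zero)  = trans red-0 (trans (sym -0#≈0#) (cong -_ (sym red-0)))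
    fromℤ-neg (ℤ.+ suc n) = refl
    fromℤ-neg ℤ.-[1+ n ]  = sym (-‿involutive (red (suc n)))

    fromℤ-+ : ∀ i j → fromℤ (i ℤ.+ j) ≡ fromℤ i + fromℤ j
    fromℤ-+ (ℤ.+ m)    (ℤ.+ n)    = red-+ m n
    fromℤ-+ (ℤ.+ m)    ℤ.-[1+ n ] = fromℤ-⊖ m (suc n)
    fromℤ-+ ℤ.-[1+ m ] (ℤ.+ n)    = trans (fromℤ-⊖ n (suc m)) (+-comm (red n) (- red (suc m)))
    fromℤ-+ ℤ.-[1+ m ] ℤ.-[1+ n ] = begin
      - red (suc (suc (m ℕ.+ n)))          ≡⟨ cong (λ k → - red k) (sym (ℕ.+-suc (suc m) n)) ⟩
      - red (suc m ℕ.+ suc n)              ≡⟨ cong -_ (red-+ (suc m) (suc n)) ⟩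
      - (red (suc m) + red (suc n))        ≡⟨ -‿+-comm (red (suc m)) (red (suc n)) ⟨
      - red (suc m) + - red (suc n)        ∎

    fromℤ-pos* : ∀ m j → fromℤ (ℤ.+ m ℤ.* j) ≡ red m * fromℤ j
    fromℤ-pos* m (ℤ.+ n)    = trans (cong fromℤ (sym (ℤ.pos-* m n))) (red-* m n)
    fromℤ-pos* m ℤ.-[1+ n ] = begin
      fromℤ (ℤ.+ m ℤ.* ℤ.-[1+ n ])      ≡⟨ cong fromℤ (sym (ℤ.neg-distribʳ-* (ℤ.+ m) (ℤ.+ suc n))) ⟩
      fromℤ (ℤ.- (ℤ.+ m ℤ.* ℤ.+ suc n)) ≡⟨ fromℤ-neg (ℤ.+ m ℤ.* ℤ.+ suc n) ⟩
      - fromℤ (ℤ.+ m ℤ.* ℤ.+ suc n)     ≡⟨ cong (λ z → - fromℤ z) (sym (ℤ.pos-* m (suc n))) ⟩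
      - red (m ℕ.* suc n)           ≡⟨ cong -_ (red-* m (suc n)) ⟩
      - (red m * red (suc n))       ≡⟨ -‿distribʳ-* (red m) (red (suc n)) ⟩
      red m * - red (suc n)         ∎

    fromℤ-* : ∀ i j → fromℤ (i ℤ.* j) ≡ fromℤ i * fromℤ j
    fromℤ-* (ℤ.+ m)    j = fromℤ-pos* m j
    fromℤ-* ℤ.-[1+ m ] j = begin
      fromℤ (ℤ.-[1+ m ] ℤ.* j)        ≡⟨ cong fromℤ (sym (ℤ.neg-distribˡ-* (ℤ.+ suc m) j)) ⟩
      fromℤ (ℤ.- (ℤ.+ suc m ℤ.* j))   ≡⟨ fromℤ-neg (ℤ.+ suc m ℤ.* j) ⟩
      - fromℤ (ℤ.+ suc m ℤ.* j)       ≡⟨ cong -_ (fromℤ-pos* (suc m) j) ⟩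
      - (red (suc m) * fromℤ j)     ≡⟨ -‿distribˡ-* (red (suc m)) (fromℤ j) ⟩
      - red (suc m) * fromℤ j       ∎

    ℤ-coefficients : RawRing 0ℓ 0ℓ
    ℤ-coefficients = CommutativeRing.rawRing ℤ.+-*-commutativeRing

    morphism : ℤ-coefficients -Raw-AlmostCommutative⟶ fromCommutativeRing commutativeRing
    morphism = record
      { ⟦_⟧ = fromℤ ; +-homo = fromℤ-+ ; *-homo = fromℤ-* ; -‿homo = fromℤ-neg ; 0-homo = red-0 ; 1-homo = red-1 }

  -- Normal forms have integer coefficients, which compute and can be compared while the operations
  -- of `K` stay abstract. A numeral `con (ℤ.+ m)` denotes `red m`; where an identity involves `1#`
  -- itself, it is passed as a variable.
  module Solver = RingSolver ℤ-coefficients (fromCommutativeRing commutativeRing) morphism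
    (λ i j → Data.Maybe.map (cong fromℤ) (dec⇒maybe (i ℤ.≟ j)))

-- Finite injections, and arithmetic for the exponents of the power sum argument.

-- Pigeonhole: a missed value could be punched out of the codomain, leaving an injection of `suc n`
-- elements into n.
injective⇒surjective : ∀ {n} {f : Fin n → Fin n} → Injective _≡_ _≡_ f → ∀ y → ∃ λ x → f x ≡ y
injective⇒surjective {suc n} {f} inj y with any? (λ x → f x ≟ y)
... | yes found = found
... | no missed = ⊥-elim (ℕ.1+n≰n (injective⇒≤ {f = λ x → punchOut (y≢ x)} (λ e → inj (punchOut-injective (y≢ _) (y≢ _) e))))
  where
  y≢ : ∀ x → ¬ y ≡ f x
  y≢ x e = missed (x , sym e)

injective⇒permutation : ∀ {n} {f : Fin n → Fin n} → Injective _≡_ _≡_ f → Permutation n n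
injective⇒permutation {f = f} inj = permutation f (λ y → proj₁ (injective⇒surjective inj y))
  (λ y → proj₂ (injective⇒surjective inj y)) (λ x → inj (proj₂ (injective⇒surjective inj (f x))))

-- If p divided the coefficient, `absorption` would pass the divisor on to (n + 1) times the entry
-- diagonally above; as 0 < n + 1 < p it would descend to an entry with k = 0, which is 1.
prime∤C : ∀ {p} → Prime p → ∀ n k → k ℕ.≤ n → n ℕ.< p → ¬ p ℕ.∣ n C k
prime∤C pp n       zero    _   n<p d = ℕ.<⇒≱ (prime>1 pp) (ℕ.∣⇒≤ d)
  where
  prime>1 : ∀ {p} → Prime p → 1 ℕ.< p
  prime>1 {suc (suc p)} _ = ℕ.s≤s (ℕ.s≤s ℕ.z≤n)
prime∤C {p} pp (suc n) (suc k) k≤n n<p d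
  with euclidsLemma (suc n) (n C k) pp (subst (p ℕ.∣_) (absorption n k) (ℕ.∣n⇒∣m*n (suc k) d))
... | inj₁ d′ = ℕ.<⇒≱ n<p (ℕ.∣⇒≤ d′)
... | inj₂ d′ = prime∤C pp n k (ℕ.s≤s⁻¹ k≤n) (ℕ.<⇒≤ n<p) d′

module _ {q d i₀ j₀ : ℕ} (q≡ : q ≡ d ℕ.* i₀ ℕ.+ j₀) where

  open ℕ.≤-Reasoning

  -- This is where d ≥ 3 enters: 2 i₀ will be the exponent applied to a permutation of the field,
  -- and `powerSum≡0` requires it below q. For d = 2 and even q the quotient has 2 i₀ = q.
  double-quotient< : 3 ℕ.≤ d → 0 ℕ.< i₀ → i₀ ℕ.+ i₀ ℕ.< q
  double-quotient< 3≤d 0<i₀ = begin-strict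
    i₀ ℕ.+ i₀               ≡⟨ ℕ.+-identityʳ (i₀ ℕ.+ i₀) ⟨
    (i₀ ℕ.+ i₀) ℕ.+ 0       <⟨ ℕ.+-monoʳ-< (i₀ ℕ.+ i₀) 0<i₀ ⟩
    (i₀ ℕ.+ i₀) ℕ.+ i₀      ≡⟨ three i₀ ⟩
    3 ℕ.* i₀                ≤⟨ ℕ.*-monoˡ-≤ i₀ 3≤d ⟩
    d ℕ.* i₀                ≤⟨ ℕ.m≤m+n (d ℕ.* i₀) j₀ ⟩
    d ℕ.* i₀ ℕ.+ j₀         ≡⟨ q≡ ⟨
    q                       ∎
    where
    three : ∀ i → (i ℕ.+ i) ℕ.+ i ≡ 3 ℕ.* i
    three = ℕ-Solver.solve-∀

  double-remainder< : j₀ ℕ.< d → 0 ℕ.< i₀ → j₀ ℕ.+ j₀ ℕ.< q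
  double-remainder< j₀<d 0<i₀ = begin-strict
    j₀ ℕ.+ j₀               <⟨ ℕ.+-monoˡ-< j₀ j₀<d ⟩
    d ℕ.+ j₀                ≡⟨ cong (ℕ._+ j₀) (ℕ.*-identityʳ d) ⟨
    d ℕ.* 1 ℕ.+ j₀          ≤⟨ ℕ.+-monoˡ-≤ j₀ (ℕ.*-monoʳ-≤ d 0<i₀) ⟩
    d ℕ.* i₀ ℕ.+ j₀         ≡⟨ q≡ ⟨
    q                       ∎

  -- More than uniqueness of division, since j may reach 2 j₀ and so exceed d. If i < i₀ then d i +
  -- j < d (i + 1) + j₀ ≤ q; if i > i₀ then already d i > q.
  quotient-unique : j₀ ℕ.< d → ∀ {i j} → j ℕ.≤ j₀ ℕ.+ j₀ → d ℕ.* i ℕ.+ j ≡ q → i ≡ i₀ × j ≡ j₀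
  quotient-unique j₀<d {i} {j} j≤ e with ℕ.<-cmp i i₀
  ... | tri≈ _ refl _ = refl , ℕ.+-cancelˡ-≡ (d ℕ.* i₀) j j₀ (trans e q≡)
  ... | tri< i<i₀ _ _ = ⊥-elim (ℕ.<⇒≱ (begin-strict
      d ℕ.* i ℕ.+ j            ≤⟨ ℕ.+-monoʳ-≤ (d ℕ.* i) j≤ ⟩
      d ℕ.* i ℕ.+ (j₀ ℕ.+ j₀)  <⟨ ℕ.+-monoʳ-< (d ℕ.* i) (ℕ.+-monoˡ-< j₀ j₀<d) ⟩
      d ℕ.* i ℕ.+ (d ℕ.+ j₀)   ≡⟨ factor d i j₀ ⟩
      d ℕ.* suc i ℕ.+ j₀       ≤⟨ ℕ.+-monoˡ-≤ j₀ (ℕ.*-monoʳ-≤ d i<i₀) ⟩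
      d ℕ.* i₀ ℕ.+ j₀          ≡⟨ q≡ ⟨
      q                        ∎) (ℕ.≤-reflexive (sym e)))
    where
    factor : ∀ d i j → d ℕ.* i ℕ.+ (d ℕ.+ j) ≡ d ℕ.* suc i ℕ.+ j
    factor = ℕ-Solver.solve-∀
  ... | tri> _ _ i₀<i = ⊥-elim (ℕ.<⇒≱ (begin-strict
      q                        ≡⟨ q≡ ⟩
      d ℕ.* i₀ ℕ.+ j₀          <⟨ ℕ.+-monoʳ-< (d ℕ.* i₀) j₀<d ⟩
      d ℕ.* i₀ ℕ.+ d           ≡⟨ factor d i₀ ⟩
      d ℕ.* suc i₀             ≤⟨ ℕ.*-monoʳ-≤ d i₀<i ⟩
      d ℕ.* i                  ≤⟨ ℕ.m≤m+n (d ℕ.* i) j ⟩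
      d ℕ.* i ℕ.+ j            ∎) (ℕ.≤-reflexive e))
    where
    factor : ∀ d i → d ℕ.* i ℕ.+ d ≡ d ℕ.* suc i
    factor = ℕ-Solver.solve-∀

-- Power sums over the prime field and planar powers.

module PowerSums {q : ℕ} (p-prime : Prime (suc q)) (K : PrimeField q) where

  open PrimeFieldProperties p-prime K public
  open ≡-Reasoning
  module ∑K = Sum semiring
  open ∑K using () renaming (sum to sumK) public

  red≡⨯ : ∀ m → m ⨯ 1# ≡ red m
  red≡⨯ zero    = sym red-0
  red≡⨯ (suc m) = trans (cong₂ _+_ (sym red-1) (red≡⨯ m)) (sym (red-+ 1 m))

  ⨯≡red* : ∀ m x → m ⨯ x ≡ red m * x
  ⨯≡red* zero    x = trans (sym (zeroˡ x)) (cong (_* x) (sym red-0))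
  ⨯≡red* (suc m) x = begin
    x + m ⨯ x           ≡⟨ cong₂ _+_ (sym (*-identityˡ x)) (⨯≡red* m x) ⟩
    1# * x + red m * x  ≡⟨ distribʳ x 1# (red m) ⟨
    (1# + red m) * x    ≡⟨ cong (λ z → (z + red m) * x) (sym red-1) ⟩
    (red 1 + red m) * x ≡⟨ cong (_* x) (sym (red-+ 1 m)) ⟩
    red (suc m) * x     ∎

  module Frob = Frobenius commutativeRing p-prime (trans (red≡⨯ (suc q)) red-p)

  p∣⇒red≡0 : ∀ m → suc q ℕ.∣ m → red m ≡ 0#
  p∣⇒red≡0 m (ℕ.divides k refl) = trans (red-* k (suc q)) (trans (cong (red k *_) red-p) (zeroʳ (red k)))

  red≢0 : ∀ {m} → 0 ℕ.< m → m ℕ.< suc q → ¬ red m ≡ 0#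
  red≢0 {suc m} _ m<p e = ℕ.<⇒≱ m<p (ℕ.∣⇒≤ (red≡0⇒p∣ (suc m) e))

  0^ : ∀ {m} → 0 ℕ.< m → 0# ^ m ≡ 0#
  0^ {suc m} _ = zeroˡ (0# ^ m)

  1^ : ∀ m → 1# ^ m ≡ 1#
  1^ zero    = refl
  1^ (suc m) = trans (*-identityˡ (1# ^ m)) (1^ m)

  -- Induction on the representative, using additivity of the p-th power on 1 + m.
  fermat : ∀ x → x ^ suc q ≡ x
  fermat x = trans (cong (_^ suc q) (sym (red-toℕ x))) (trans (go (toℕ x)) (red-toℕ x))
    where
    go : ∀ m → red m ^ suc q ≡ red m
    go zero    = trans (cong (_^ suc q) red-0) (trans (0^ (ℕ.s≤s (ℕ.z≤n {q}))) (sym red-0))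
    go (suc m) = begin
      red (suc m) ^ suc q                ≡⟨ cong (_^ suc q) (red-+ 1 m) ⟩
      (red 1 + red m) ^ suc q            ≡⟨ Frob.^p-+ (red 1) (red m) ⟩
      red 1 ^ suc q + red m ^ suc q      ≡⟨ cong₂ _+_ (trans (cong (_^ suc q) red-1) (trans (1^ (suc q)) (sym red-1))) (go m) ⟩
      red 1 + red m                      ≡⟨ red-+ 1 m ⟨
      red (suc m)                        ∎

  x*y≡0⇒x≡0⊎y≡0 : ∀ {x y} → x * y ≡ 0# → x ≡ 0# ⊎ y ≡ 0#
  x*y≡0⇒x≡0⊎y≡0 {x} {y} e with euclidsLemma (toℕ x) (toℕ y) p-prime (red≡0⇒p∣ (toℕ x ℕ.* toℕ y) (begin
      red (toℕ x ℕ.* toℕ y)      ≡⟨ red-* (toℕ x) (toℕ y) ⟩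
      red (toℕ x) * red (toℕ y)  ≡⟨ cong₂ _*_ (red-toℕ x) (red-toℕ y) ⟩
      x * y                      ≡⟨ e ⟩
      0#                         ∎))
  ... | inj₁ d = inj₁ (trans (sym (red-toℕ x)) (p∣⇒red≡0 (toℕ x) d))
  ... | inj₂ d = inj₂ (trans (sym (red-toℕ y)) (p∣⇒red≡0 (toℕ y) d))

  *≢0 : ∀ {x y} → ¬ x ≡ 0# → ¬ y ≡ 0# → ¬ x * y ≡ 0#
  *≢0 x≢0 y≢0 e with x*y≡0⇒x≡0⊎y≡0 e
  ... | inj₁ x≡0 = x≢0 x≡0
  ... | inj₂ y≡0 = y≢0 y≡0

  x≢0∧x*y≡0⇒y≡0 : ∀ {x y} → ¬ x ≡ 0# → x * y ≡ 0# → y ≡ 0#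
  x≢0∧x*y≡0⇒y≡0 x≢0 e with x*y≡0⇒x≡0⊎y≡0 e
  ... | inj₁ x≡0 = ⊥-elim (x≢0 x≡0)
  ... | inj₂ y≡0 = y≡0

  x*x≡0⇒x≡0 : ∀ {x} → x * x ≡ 0# → x ≡ 0#
  x*x≡0⇒x≡0 e with x*y≡0⇒x≡0⊎y≡0 e
  ... | inj₁ x≡0 = x≡0
  ... | inj₂ x≡0 = x≡0

  open Solver using (solve; con; _:+_; _:*_; _:-_; :-_; _:=_) public

  x+-y≡0⇒x≡y : ∀ {x y} → x + - y ≡ 0# → x ≡ y
  x+-y≡0⇒x≡y {x} {y} e = begin
    x             ≡⟨ solve 2 (λ x y → x := (x :+ :- y) :+ y) refl x y ⟩
    (x + - y) + y ≡⟨ cong (_+ y) e ⟩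
    0# + y        ≡⟨ +-identityˡ y ⟩
    y             ∎

  *-cancelˡ : ∀ {a x y} → ¬ a ≡ 0# → a * x ≡ a * y → x ≡ y
  *-cancelˡ {a} {x} {y} a≢0 e = x+-y≡0⇒x≡y (x≢0∧x*y≡0⇒y≡0 a≢0 (begin
    a * (x + - y)       ≡⟨ solve 3 (λ a x y → a :* (x :+ :- y) := a :* x :+ :- (a :* y)) refl a x y ⟩
    a * x + - (a * y)   ≡⟨ cong (_+ - (a * y)) e ⟩
    a * y + - (a * y)   ≡⟨ -‿inverseʳ (a * y) ⟩
    0#                  ∎))

  x^q≡1 : ∀ {x} → ¬ x ≡ 0# → x ^ q ≡ 1#
  x^q≡1 {x} x≢0 = *-cancelˡ x≢0 (trans (fermat x) (sym (*-identityʳ x)))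

  1≢0 : ¬ 1# ≡ 0#
  1≢0 e = red≢0 {1} (ℕ.s≤s ℕ.z≤n) (1<p p-prime) (trans red-1 e)
    where
    1<p : ∀ {q} → Prime (suc q) → 1 ℕ.< suc q
    1<p {suc q} _ = ℕ.s≤s (ℕ.s≤s ℕ.z≤n)

  -1≢0 : ¬ - 1# ≡ 0#
  -1≢0 e = 1≢0 (trans (sym (-‿involutive 1#)) (trans (cong -_ e) -0#≈0#))

  q≢0 : ¬ q ≡ 0
  q≢0 e = 1≢0 (trans (sym (trans (cong (red ∘ suc) e) red-1)) red-p)

  inverse : ∀ {x} → ¬ x ≡ 0# → ∃ λ y → x * y ≡ 1#
  inverse {x} x≢0 = x ^ (q ∸ 1) , x^q′ q refl
    where
    x^q′ : ∀ m → m ≡ q → x * x ^ (m ∸ 1) ≡ 1#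
    x^q′ zero    e = ⊥-elim (q≢0 (sym e))
    x^q′ (suc m) e = trans (cong (x ^_) e) (x^q≡1 x≢0)

  ^≢0 : ∀ {x} m → ¬ x ≡ 0# → ¬ x ^ m ≡ 0#
  ^≢0 zero    x≢0 = 1≢0
  ^≢0 (suc m) x≢0 = *≢0 x≢0 (^≢0 m x≢0)

  sum-zeroK : ∀ {n} (t : Fin n → 𝔽) → (∀ i → t i ≡ 0#) → sumK t ≡ 0#
  sum-zeroK {n} t e = trans (∑K.sum-cong-≗ {n} e) (∑K.sum-replicate-zero n)

  sum-single : ∀ {n} (t : Fin n → 𝔽) k → (∀ i → ¬ i ≡ k → t i ≡ 0#) → sumK t ≡ t k
  sum-single {suc n} t k e = begin
    sumK t                            ≡⟨ ∑K.sum-remove {i = k} t ⟩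
    t k + sumK (λ i → t (punchIn k i)) ≡⟨ cong (t k +_) (sum-zeroK (λ i → t (punchIn k i)) (λ i → e _ (punchInᵢ≢i k i))) ⟩
    t k + 0#                          ≡⟨ +-identityʳ (t k) ⟩
    t k                               ∎

  sum-injective : ∀ {f : 𝔽 → 𝔽} → Injective _≡_ _≡_ f → ∀ t → sumK (t ∘ f) ≡ sumK t
  sum-injective inj t = sym (∑K.sum-permute t (injective⇒permutation inj))

  +-injectiveˡ : ∀ a → Injective _≡_ _≡_ (a +_)
  +-injectiveˡ a {x} {y} e = trans (undo a x) (trans (cong (- a +_) e) (sym (undo a y)))
    where
    undo : ∀ a x → x ≡ - a + (a + x)
    undo = solve 2 (λ a x → x := :- a :+ (a :+ x)) refl

  open Binomial commutativeSemiring using (binomialTerm) renaming (theorem to binomial-theorem)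

  powerSum : ℕ → 𝔽
  powerSum k = sumK (λ x → x ^ k)

  -- Summing (x + 1)^(k+1) - x^(k+1) over x gives a triangular system for the power sums.
  powerSum≡0 : ∀ k → k ℕ.< q → powerSum k ≡ 0#
  powerSum≡0 = <-rec (λ k → k ℕ.< q → powerSum k ≡ 0#) go
    where
    go : ∀ k → (∀ {j} → j ℕ.< k → j ℕ.< q → powerSum j ≡ 0#) → k ℕ.< q → powerSum k ≡ 0#
    go k ih k<q = x≢0∧x*y≡0⇒y≡0 (red≢0 (ℕ.s≤s ℕ.z≤n) (ℕ.s≤s k<q)) (trans (sym next-to-top) lower≡0)
      where
      c : ℕ → 𝔽
      c j = red (suc k C j) * powerSum j
      expand : powerSum (suc k) ≡ sumK {suc (suc k)} (λ j → c (toℕ j))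
      expand = begin
        sumK (λ x → x ^ suc k)
          ≡⟨ sum-injective (+-injectiveˡ 1#) (λ x → x ^ suc k) ⟨
        sumK (λ x → (1# + x) ^ suc k)
          ≡⟨ ∑K.sum-cong-≗ {suc q} (λ x → trans (cong (_^ suc k) (+-comm 1# x)) (trans (binomial-theorem (suc k) x 1#)
               (∑K.sum-cong-≗ {suc (suc k)} (λ j → trans (⨯≡red* (suc k C toℕ j) (x ^ toℕ j * 1# ^ (suc k ∸ toℕ j)))
                 (cong (red (suc k C toℕ j) *_) (trans (cong (x ^ toℕ j *_) (1^ (suc k ∸ toℕ j))) (*-identityʳ (x ^ toℕ j)))))))) ⟩
        sumK {suc q} (λ x → sumK {suc (suc k)} (λ j → red (suc k C toℕ j) * x ^ toℕ j))
          ≡⟨ ∑K.∑-comm {suc q} {suc (suc k)} (λ x j → red (suc k C toℕ j) * x ^ toℕ j) ⟩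
        sumK {suc (suc k)} (λ j → sumK {suc q} (λ x → red (suc k C toℕ j) * x ^ toℕ j))
          ≡⟨ ∑K.sum-cong-≗ {suc (suc k)} (λ j → sym (∑K.*-distribˡ-sum (red (suc k C toℕ j)) (λ x → x ^ toℕ j))) ⟩
        sumK {suc (suc k)} (λ j → c (toℕ j)) ∎
      top : c (suc k) ≡ powerSum (suc k)
      top = trans (cong (λ m → red m * powerSum (suc k)) (nCn≡1 (suc k))) (trans (cong (_* powerSum (suc k)) red-1) (*-identityˡ (powerSum (suc k))))
      -- Translation by 1 does not change `powerSum (suc k)`, which is also the top term of its own
      -- expansion; the lower terms therefore sum to zero.
      lower≡0 : sumK {suc k} (λ j → c (toℕ j)) ≡ 0#
      lower≡0 = begin
        low                                     ≡⟨ solve 2 (λ a b → a := (a :+ b) :+ :- b) refl low (powerSum (suc k)) ⟩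
        (low + powerSum (suc k)) + - powerSum (suc k)
          ≡⟨ cong (_+ - powerSum (suc k)) (trans (sym (trans (∑K.sum-init-last {suc k} (λ j → c (toℕ j)))
               (cong₂ _+_ (∑K.sum-cong-≗ {suc k} (λ j → cong c (toℕ-inject₁ j)))
                          (trans (cong c (toℕ-fromℕ (suc k))) top)))) (sym expand)) ⟩
        powerSum (suc k) + - powerSum (suc k)   ≡⟨ -‿inverseʳ (powerSum (suc k)) ⟩
        0#                                      ∎
        where low = sumK {suc k} (λ j → c (toℕ j))
      -- The induction hypothesis removes all j < k; the surviving coefficient k + 1 is invertible
      -- because k < q.
      next-to-top : sumK {suc k} (λ j → c (toℕ j)) ≡ red (suc k) * powerSum k
      next-to-top = begin
        sumK {suc k} (λ j → c (toℕ j))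
          ≡⟨ sum-single {suc k} (λ j → c (toℕ j)) (fromℕ k) (λ j ne → trans (cong (red (suc k C toℕ j) *_)
               (let j<k = below j ne in ih j<k (ℕ.<-trans j<k k<q))) (zeroʳ (red (suc k C toℕ j)))) ⟩
        c (toℕ (fromℕ k))    ≡⟨ cong c (toℕ-fromℕ k) ⟩
        c k                  ≡⟨ cong (λ m → red m * powerSum k) C[1+k,k] ⟩
        red (suc k) * powerSum k ∎
        where
        below : ∀ (j : Fin (suc k)) → ¬ j ≡ fromℕ k → toℕ j ℕ.< k
        below j ne = ℕ.≤∧≢⇒< (ℕ.s≤s⁻¹ (toℕ<n j)) (λ e → ne (toℕ-injective (trans e (sym (toℕ-fromℕ k)))))
        C[1+k,k] : suc k C k ≡ suc k
        C[1+k,k] = trans (nCk≡nC[n∸k] (ℕ.n≤1+n k)) (trans (cong (suc k C_) (ℕ.m+n∸n≡m 1 k)) (nC1≡n (suc k)))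

  -- Each of the q nonzero elements contributes 1 and zero contributes 0, so the sum is q, which is
  -- nonzero modulo q + 1.
  powerSum-q≢0 : ¬ powerSum q ≡ 0#
  powerSum-q≢0 e = red≢0 0<q (ℕ.n<1+n q) (begin
    red q                  ≡⟨ red≡⨯ q ⟨
    q ⨯ 1#                 ≡⟨ ∑K.sum-replicate q ⟨
    sumK {q} (λ _ → 1#)    ≡⟨ ∑K.sum-cong-≗ {q} (λ i → sym (x^q≡1 (punchInᵢ≢i 0# i))) ⟩
    sumK {q} (λ i → punchIn 0# i ^ q) ≡⟨ +-identityˡ _ ⟨
    0# + sumK {q} (λ i → punchIn 0# i ^ q) ≡⟨ cong (_+ sumK {q} (λ i → punchIn 0# i ^ q)) (0^ 0<q) ⟨
    0# ^ q + sumK {q} (λ i → punchIn 0# i ^ q) ≡⟨ ∑K.sum-remove {i = 0#} (λ x → x ^ q) ⟨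
    powerSum q             ≡⟨ e ⟩
    0#                     ∎)
    where
    0<q : 0 ℕ.< q
    0<q = ℕ.n≢0⇒n>0 q≢0

  binomial-red : ∀ n x y → (x + y) ^ n ≡ sumK {suc n} (λ i → red (n C toℕ i) * (x ^ toℕ i * y ^ (n ∸ toℕ i)))
  binomial-red n x y = trans (binomial-theorem n x y)
    (∑K.sum-cong-≗ {suc n} (λ i → ⨯≡red* (n C toℕ i) (x ^ toℕ i * y ^ (n ∸ toℕ i))))

  neg-^ : ∀ z m → (- z) ^ m ≡ (- 1#) ^ m * z ^ m
  neg-^ z m = trans (cong (_^ m) (trans (cong -_ (sym (*-identityˡ z))) (-‿distribˡ-* 1# z))) (^-distrib-* (- 1#) z m)

  sum-*-sum : ∀ {m n} (s : Fin m → 𝔽) (t : Fin n → 𝔽) → sumK s * sumK t ≡ sumK (λ i → sumK (λ j → s i * t j))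
  sum-*-sum {m} s t = trans (∑K.*-distribʳ-sum (sumK t) s) (∑K.sum-cong-≗ {m} (λ i → ∑K.*-distribˡ-sum (s i) t))

  sum-rotate : ∀ {l m n} (t : Fin l → Fin m → Fin n → 𝔽) →
    sumK (λ x → sumK (λ y → sumK (λ i → t x y i))) ≡ sumK (λ i → sumK (λ x → sumK (λ y → t x y i)))
  sum-rotate {l} {m} {n} t = trans (∑K.sum-cong-≗ {l} (λ x → ∑K.∑-comm (t x))) (∑K.∑-comm (λ x i → sumK (λ y → t x y i)))

  -- With q = d i₀ + j₀, the sum over all x, y of (y^d - x^d)^(2 i₀) (y - x)^(2 j₀) vanishes because y^d - x^d permutes 𝔽 for
  -- each fixed y - x ≠ 0, whereas its expansion in power sums has a single nonzero term, that of x^q y^q.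
  planar-power-degree<3 : ∀ d → 3 ℕ.≤ d → d ℕ.≤ q →
    (∀ a → ¬ a ≡ 0# → Injective _≡_ _≡_ (λ x → (x + a) ^ d + - (x ^ d))) → ⊥
  planar-power-degree<3 d 3≤d d≤q inj = *≢0 (*≢0 coeff≢0 powerSum-q≢0) powerSum-q≢0 (begin
      (c i₀ j₀ * powerSum q) * powerSum q  ≡⟨ *-assoc (c i₀ j₀) (powerSum q) (powerSum q) ⟩
      c i₀ j₀ * (powerSum q * powerSum q)  ≡⟨ cong₂ (λ u v → c i₀ j₀ * (powerSum u * powerSum v)) q≡ q≡′ ⟩
      term i₀ j₀                           ≡⟨ single ⟨
      sumK {suc k} (λ i → sumK {suc l} (λ j → term (toℕ i) (toℕ j))) ≡⟨ expand ⟨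
      Z                                    ≡⟨ Z≡0 ⟩
      0#                                   ∎)
    where
    instance
      d-nonZero : NonZero d
      d-nonZero = ℕ.>-nonZero (ℕ.≤-trans (ℕ.s≤s ℕ.z≤n) 3≤d)
    -- The outer exponents are twice the quotient and twice the remainder, so that the middle term
    -- (i₀ , j₀) gives both x and y the exponent d i₀ + j₀ = q.
    i₀ = q / d
    j₀ = q % d
    k = i₀ ℕ.+ i₀
    l = j₀ ℕ.+ j₀
    q≡ : q ≡ d ℕ.* i₀ ℕ.+ j₀
    q≡ = trans (m≡m%n+[m/n]*n q d) (trans (ℕ.+-comm j₀ (i₀ ℕ.* d)) (cong (ℕ._+ j₀) (ℕ.*-comm i₀ d)))
    q≡′ : q ≡ d ℕ.* (k ∸ i₀) ℕ.+ (l ∸ j₀)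
    q≡′ = trans q≡ (sym (cong₂ (λ a b → d ℕ.* a ℕ.+ b) (ℕ.m+n∸n≡m i₀ i₀) (ℕ.m+n∸n≡m j₀ j₀)))
    j₀<d : j₀ ℕ.< d
    j₀<d = m%n<n q d
    0<i₀ : 0 ℕ.< i₀
    0<i₀ = ℕ.n≢0⇒n>0 (λ i₀≡0 → ℕ.<⇒≱ j₀<d (ℕ.≤-trans d≤q (ℕ.≤-reflexive
             (trans q≡ (trans (cong (λ z → d ℕ.* z ℕ.+ j₀) i₀≡0) (cong (ℕ._+ j₀) (ℕ.*-zeroʳ d)))))))
    0<k : 0 ℕ.< k
    0<k = ℕ.≤-trans 0<i₀ (ℕ.m≤m+n i₀ i₀)
    k<q : k ℕ.< q
    k<q = double-quotient< q≡ 3≤d 0<i₀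
    l<p : l ℕ.< suc q
    l<p = ℕ.<-trans (double-remainder< q≡ j₀<d 0<i₀) (ℕ.n<1+n q)
    c : ℕ → ℕ → 𝔽
    c i j = (red (k C i) * red (l C j)) * ((- 1#) ^ (k ∸ i) * (- 1#) ^ (l ∸ j))
    -- Both upper indices k and l are below p, so p divides neither binomial coefficient.
    coeff≢0 : ¬ c i₀ j₀ ≡ 0#
    coeff≢0 = *≢0 (*≢0 (C≢0 (ℕ.m≤m+n i₀ i₀) (ℕ.<-trans k<q (ℕ.n<1+n q))) (C≢0 (ℕ.m≤m+n j₀ j₀) l<p))
                  (*≢0 (^≢0 (k ∸ i₀) -1≢0) (^≢0 (l ∸ j₀) -1≢0))
      where
      C≢0 : ∀ {n m} → m ℕ.≤ n → n ℕ.< suc q → ¬ red (n C m) ≡ 0#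
      C≢0 {n} {m} m≤n n<p e = prime∤C p-prime n m m≤n n<p (red≡0⇒p∣ (n C m) e)
    term : ℕ → ℕ → 𝔽
    term i j = c i j * (powerSum (d ℕ.* i ℕ.+ j) * powerSum (d ℕ.* (k ∸ i) ℕ.+ (l ∸ j)))
    F : 𝔽 → 𝔽 → 𝔽
    F x y = (y ^ d + - (x ^ d)) ^ k * (y + - x) ^ l
    Z = sumK (λ x → sumK (λ y → F x y))
    Z≡0 : Z ≡ 0#
    Z≡0 = begin
      sumK (λ x → sumK (λ y → F x y))        ≡⟨ ∑K.sum-cong-≗ {suc q} (λ x → sum-injective (+-injectiveˡ x) (F x)) ⟨
      sumK (λ x → sumK (λ a → F x (x + a)))  ≡⟨ ∑K.∑-comm (λ x a → F x (x + a)) ⟩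
      sumK (λ a → sumK (λ x → F x (x + a)))  ≡⟨ sum-zeroK (λ a → sumK (λ x → F x (x + a))) fibre ⟩
      0#                                     ∎
      where
      fibre : ∀ a → sumK (λ x → F x (x + a)) ≡ 0#
      fibre a with a ≟ 0#
      -- On the diagonal the base is zero, and its exponent k is positive because d ≤ q.
      ... | yes refl = sum-zeroK (λ x → F x (x + 0#)) (λ x → begin
        ((x + 0#) ^ d + - (x ^ d)) ^ k * (x + 0# + - x) ^ l
          ≡⟨ cong (λ z → (z ^ d + - (x ^ d)) ^ k * (x + 0# + - x) ^ l) (+-identityʳ x) ⟩
        (x ^ d + - (x ^ d)) ^ k * (x + 0# + - x) ^ l
          ≡⟨ cong (λ z → z ^ k * (x + 0# + - x) ^ l) (-‿inverseʳ (x ^ d)) ⟩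
        0# ^ k * (x + 0# + - x) ^ l
          ≡⟨ cong (_* (x + 0# + - x) ^ l) (0^ 0<k) ⟩
        0# * (x + 0# + - x) ^ l
          ≡⟨ zeroˡ _ ⟩
        0# ∎)
      ... | no a≢0 = begin
        sumK (λ x → F x (x + a))
          ≡⟨ ∑K.sum-cong-≗ {suc q} (λ x → cong (λ z → ((x + a) ^ d + - (x ^ d)) ^ k * z ^ l)
               (solve 2 (λ x a → (x :+ a) :+ :- x := a) refl x a)) ⟩
        sumK (λ x → ((x + a) ^ d + - (x ^ d)) ^ k * a ^ l)
          ≡⟨ ∑K.*-distribʳ-sum (a ^ l) (λ x → ((x + a) ^ d + - (x ^ d)) ^ k) ⟨
        sumK (λ x → ((x + a) ^ d + - (x ^ d)) ^ k) * a ^ l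
          ≡⟨ cong (_* a ^ l) (trans (sum-injective (inj a a≢0) (_^ k)) (powerSum≡0 k k<q)) ⟩
        0# * a ^ l
          ≡⟨ zeroˡ (a ^ l) ⟩
        0# ∎
    expandF : ∀ x y → F x y ≡ sumK {suc k} (λ i → sumK {suc l} (λ j →
      c (toℕ i) (toℕ j) * (y ^ (d ℕ.* toℕ i ℕ.+ toℕ j) * x ^ (d ℕ.* (k ∸ toℕ i) ℕ.+ (l ∸ toℕ j)))))
    expandF x y = begin
      F x y
        ≡⟨ cong₂ _*_ (binomial-red k (y ^ d) (- (x ^ d))) (binomial-red l y (- x)) ⟩
      sumK {suc k} A * sumK {suc l} B
        ≡⟨ sum-*-sum A B ⟩
      sumK {suc k} (λ i → sumK {suc l} (λ j → A i * B j))
        ≡⟨ ∑K.sum-cong-≗ {suc k} (λ i → ∑K.sum-cong-≗ {suc l} (λ j → monomial (toℕ i) (toℕ j))) ⟩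
      _ ∎
      where
      A = λ (i : Fin (suc k)) → red (k C toℕ i) * ((y ^ d) ^ toℕ i * (- (x ^ d)) ^ (k ∸ toℕ i))
      B = λ (j : Fin (suc l)) → red (l C toℕ j) * (y ^ toℕ j * (- x) ^ (l ∸ toℕ j))
      monomial : ∀ i j → (red (k C i) * ((y ^ d) ^ i * (- (x ^ d)) ^ (k ∸ i))) * (red (l C j) * (y ^ j * (- x) ^ (l ∸ j)))
                         ≡ c i j * (y ^ (d ℕ.* i ℕ.+ j) * x ^ (d ℕ.* (k ∸ i) ℕ.+ (l ∸ j)))
      monomial i j = begin
        (red (k C i) * ((y ^ d) ^ i * (- (x ^ d)) ^ (k ∸ i))) * (red (l C j) * (y ^ j * (- x) ^ (l ∸ j)))
          ≡⟨ cong₂ (λ u v → (red (k C i) * ((y ^ d) ^ i * u)) * (red (l C j) * (y ^ j * v)))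
               (neg-^ (x ^ d) (k ∸ i)) (neg-^ x (l ∸ j)) ⟩
        (red (k C i) * ((y ^ d) ^ i * ((- 1#) ^ (k ∸ i) * (x ^ d) ^ (k ∸ i)))) * (red (l C j) * (y ^ j * ((- 1#) ^ (l ∸ j) * x ^ (l ∸ j))))
          ≡⟨ solve 8 (λ a b s t y₁ y₂ x₁ x₂ → (a :* (y₁ :* (s :* x₁))) :* (b :* (y₂ :* (t :* x₂)))
                       := ((a :* b) :* (s :* t)) :* ((y₁ :* y₂) :* (x₁ :* x₂))) refl
               (red (k C i)) (red (l C j)) ((- 1#) ^ (k ∸ i)) ((- 1#) ^ (l ∸ j)) ((y ^ d) ^ i) (y ^ j) ((x ^ d) ^ (k ∸ i)) (x ^ (l ∸ j)) ⟩
        c i j * (((y ^ d) ^ i * y ^ j) * ((x ^ d) ^ (k ∸ i) * x ^ (l ∸ j)))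
          ≡⟨ cong₂ (λ u v → c i j * ((u * y ^ j) * (v * x ^ (l ∸ j)))) (^-assocʳ y d i) (^-assocʳ x d (k ∸ i)) ⟩
        c i j * ((y ^ (d ℕ.* i) * y ^ j) * (x ^ (d ℕ.* (k ∸ i)) * x ^ (l ∸ j)))
          ≡⟨ cong₂ (λ u v → c i j * (u * v)) (^-homo-* y (d ℕ.* i) j) (^-homo-* x (d ℕ.* (k ∸ i)) (l ∸ j)) ⟨
        c i j * (y ^ (d ℕ.* i ℕ.+ j) * x ^ (d ℕ.* (k ∸ i) ℕ.+ (l ∸ j))) ∎
    expand : Z ≡ sumK {suc k} (λ i → sumK {suc l} (λ j → term (toℕ i) (toℕ j)))
    expand = begin
      sumK (λ x → sumK (λ y → F x y))
        ≡⟨ ∑K.sum-cong-≗ {suc q} (λ x → ∑K.sum-cong-≗ {suc q} (λ y → expandF x y)) ⟩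
      sumK (λ x → sumK (λ y → sumK {suc k} (λ i → sumK {suc l} (λ j → G x y i j))))
        ≡⟨ sum-rotate {suc q} {suc q} {suc k} (λ x y i → sumK {suc l} (λ j → G x y i j)) ⟩
      sumK {suc k} (λ i → sumK (λ x → sumK (λ y → sumK {suc l} (λ j → G x y i j))))
        ≡⟨ ∑K.sum-cong-≗ {suc k} (λ i → sum-rotate {suc q} {suc q} {suc l} (λ x y j → G x y i j)) ⟩
      sumK {suc k} (λ i → sumK {suc l} (λ j → sumK (λ x → sumK (λ y → G x y i j))))
        ≡⟨ ∑K.sum-cong-≗ {suc k} (λ i → ∑K.sum-cong-≗ {suc l} (λ j → collect (toℕ i) (toℕ j))) ⟩
      sumK {suc k} (λ i → sumK {suc l} (λ j → term (toℕ i) (toℕ j))) ∎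
      where
      G : 𝔽 → 𝔽 → Fin (suc k) → Fin (suc l) → 𝔽
      G x y i j = c (toℕ i) (toℕ j) * (y ^ (d ℕ.* toℕ i ℕ.+ toℕ j) * x ^ (d ℕ.* (k ∸ toℕ i) ℕ.+ (l ∸ toℕ j)))
      collect : ∀ i j → sumK (λ x → sumK (λ y → c i j * (y ^ (d ℕ.* i ℕ.+ j) * x ^ (d ℕ.* (k ∸ i) ℕ.+ (l ∸ j))))) ≡ term i j
      collect i j = begin
        sumK (λ x → sumK (λ y → c i j * (y ^ u * x ^ v)))
          ≡⟨ ∑K.∑-comm (λ x y → c i j * (y ^ u * x ^ v)) ⟩
        sumK (λ y → sumK (λ x → c i j * (y ^ u * x ^ v)))
          ≡⟨ ∑K.sum-cong-≗ {suc q} (λ y → ∑K.*-distribˡ-sum (c i j) (λ x → y ^ u * x ^ v)) ⟨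
        sumK (λ y → c i j * sumK (λ x → y ^ u * x ^ v))
          ≡⟨ ∑K.*-distribˡ-sum (c i j) (λ y → sumK (λ x → y ^ u * x ^ v)) ⟨
        c i j * sumK (λ y → sumK (λ x → y ^ u * x ^ v))
          ≡⟨ cong (c i j *_) (sum-*-sum (λ y → y ^ u) (λ x → x ^ v)) ⟨
        c i j * (powerSum u * powerSum v) ∎
        where
        u = d ℕ.* i ℕ.+ j
        v = d ℕ.* (k ∸ i) ℕ.+ (l ∸ j)
    term≡0 : ∀ i j → i ℕ.≤ k → j ℕ.≤ l → ¬ (d ℕ.* i ℕ.+ j ≡ q) → term i j ≡ 0#
    term≡0 i j i≤k j≤l ne = trans (cong (c i j *_) (product≡0 (ℕ.<-cmp u q))) (zeroʳ (c i j))
      where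
      u = d ℕ.* i ℕ.+ j
      v = d ℕ.* (k ∸ i) ℕ.+ (l ∸ j)
      -- The two exponents add up to 2q, so unless both are q one of them is smaller and its power
      -- sum vanishes.
      u+v : u ℕ.+ v ≡ q ℕ.+ q
      u+v = trans (rearrange d i (k ∸ i) j (l ∸ j)) (trans (cong₂ (λ a b → d ℕ.* a ℕ.+ b) (ℕ.m+[n∸m]≡n i≤k) (ℕ.m+[n∸m]≡n j≤l))
              (trans (double d i₀ j₀) (cong (λ z → z ℕ.+ z) (sym q≡))))
        where
        rearrange : ∀ d a b x y → (d ℕ.* a ℕ.+ x) ℕ.+ (d ℕ.* b ℕ.+ y) ≡ d ℕ.* (a ℕ.+ b) ℕ.+ (x ℕ.+ y)
        rearrange = ℕ-Solver.solve-∀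
        double : ∀ d a x → d ℕ.* (a ℕ.+ a) ℕ.+ (x ℕ.+ x) ≡ (d ℕ.* a ℕ.+ x) ℕ.+ (d ℕ.* a ℕ.+ x)
        double = ℕ-Solver.solve-∀
      product≡0 : _ → powerSum u * powerSum v ≡ 0#
      product≡0 (tri< u<q _ _) = trans (cong (_* powerSum v) (powerSum≡0 u u<q)) (zeroˡ (powerSum v))
      product≡0 (tri≈ _ u≡q _) = ⊥-elim (ne u≡q)
      product≡0 (tri> _ _ q<u) = trans (cong (powerSum u *_) (powerSum≡0 v (ℕ.+-cancelˡ-< q v q
        (ℕ.<-≤-trans (ℕ.+-monoˡ-< v q<u) (ℕ.≤-reflexive u+v))))) (zeroʳ (powerSum u))
    single : sumK {suc k} (λ i → sumK {suc l} (λ j → term (toℕ i) (toℕ j))) ≡ term i₀ j₀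
    single = begin
      sumK {suc k} (λ i → sumK {suc l} (λ j → term (toℕ i) (toℕ j)))
        ≡⟨ sum-single _ (fromℕ< i₀<) (λ i i≢ → sum-zeroK {suc l} _ (λ j → vanish i j (i≢ ∘ proj₁))) ⟩
      sumK {suc l} (λ j → term (toℕ (fromℕ< i₀<)) (toℕ j))
        ≡⟨ sum-single {suc l} _ (fromℕ< j₀<) (λ j j≢ → vanish (fromℕ< i₀<) j (j≢ ∘ proj₂)) ⟩
      term (toℕ (fromℕ< i₀<)) (toℕ (fromℕ< j₀<))
        ≡⟨ cong₂ term (toℕ-fromℕ< i₀<) (toℕ-fromℕ< j₀<) ⟩
      term i₀ j₀ ∎
      where
      i₀< : i₀ ℕ.< suc k
      i₀< = ℕ.s≤s (ℕ.m≤m+n i₀ i₀)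
      j₀< : j₀ ℕ.< suc l
      j₀< = ℕ.s≤s (ℕ.m≤m+n j₀ j₀)
      vanish : ∀ i j → ¬ (i ≡ fromℕ< i₀< × j ≡ fromℕ< j₀<) → term (toℕ i) (toℕ j) ≡ 0#
      vanish i j ne = term≡0 (toℕ i) (toℕ j) (ℕ.s≤s⁻¹ (toℕ<n i)) (ℕ.s≤s⁻¹ (toℕ<n j))
        (λ e → let (e₁ , e₂) = quotient-unique q≡ j₀<d (ℕ.s≤s⁻¹ (toℕ<n j)) e in
          ne (toℕ-injective (trans e₁ (sym (toℕ-fromℕ< i₀<))) , toℕ-injective (trans e₂ (sym (toℕ-fromℕ< j₀<)))))

  -- Exponents are reduced modulo q but kept positive, so that x = 0 is included.
  ^-mod : ∀ x e m → x ^ suc (e ℕ.+ m ℕ.* q) ≡ x ^ suc e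
  ^-mod x e zero    = cong (λ z → x ^ suc z) (ℕ.+-identityʳ e)
  ^-mod x e (suc m) = begin
    x ^ suc (e ℕ.+ (q ℕ.+ m ℕ.* q))    ≡⟨ cong (x ^_) (rearrange e q (m ℕ.* q)) ⟩
    x ^ (suc q ℕ.+ (e ℕ.+ m ℕ.* q))    ≡⟨ ^-homo-* x (suc q) (e ℕ.+ m ℕ.* q) ⟩
    x ^ suc q * x ^ (e ℕ.+ m ℕ.* q)    ≡⟨ cong (_* x ^ (e ℕ.+ m ℕ.* q)) (fermat x) ⟩
    x ^ suc (e ℕ.+ m ℕ.* q)            ≡⟨ ^-mod x e m ⟩
    x ^ suc e                          ∎
    where
    rearrange : ∀ e q m → suc (e ℕ.+ (q ℕ.+ m)) ≡ suc q ℕ.+ (e ℕ.+ m)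
    rearrange = ℕ-Solver.solve-∀

  -- As a function of x the power depends only on the exponent reduced into the range from 1 to q.
  -- Exponent 1 has constant differences, and exponents from 3 on are excluded by
  -- `planar-power-degree<3`.
  planar-power≡square : ∀ d → 1 ℕ.≤ d → (∀ a → ¬ a ≡ 0# → Injective _≡_ _≡_ (λ x → (x + a) ^ d + - (x ^ d))) →
                        ∀ x → x ^ d ≡ x * x
  planar-power≡square (suc d) _ inj = reduced (d % q) refl
    where
    instance
      q-nonZero : NonZero q
      q-nonZero = ℕ.≢-nonZero q≢0
    reduce : ∀ x → x ^ suc d ≡ x ^ suc (d % q)
    reduce x = trans (cong (λ z → x ^ suc z) (m≡m%n+[m/n]*n d q)) (^-mod x (d % q) (d / q))
    inj′ : ∀ e → e ≡ d % q → ∀ a → ¬ a ≡ 0# → Injective _≡_ _≡_ (λ x → (x + a) ^ suc e + - (x ^ suc e))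
    inj′ e refl a a≢0 {x} {y} eq = inj a a≢0 (trans (trans (at x) eq) (sym (at y)))
      where
      at : ∀ x → (x + a) ^ suc d + - (x ^ suc d) ≡ (x + a) ^ suc (d % q) + - (x ^ suc (d % q))
      at x = cong₂ (λ u v → u + - v) (reduce (x + a)) (reduce x)
    reduced : ∀ e → e ≡ d % q → ∀ x → x ^ suc d ≡ x * x
    reduced zero e = ⊥-elim (1≢0 (inj′ zero e 1# 1≢0 {1#} {0#} (trans (difference 1#) (sym (difference 0#)))))
      where
      difference : ∀ x → (x + 1#) * 1# + - (x * 1#) ≡ 1#
      difference x = trans (cong₂ (λ u v → u + - v) (*-identityʳ (x + 1#)) (*-identityʳ x))
                           (solve 2 (λ x y → (x :+ y) :+ :- x := y) refl x 1#)
    reduced (suc zero) e x = trans (reduce x) (trans (cong (λ z → x ^ suc z) (sym e)) (cong (x *_) (*-identityʳ x)))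
    reduced (suc (suc e)) eq = ⊥-elim (planar-power-degree<3 (suc (suc (suc e))) (ℕ.s≤s (ℕ.s≤s (ℕ.s≤s ℕ.z≤n)))
      (ℕ.≤-trans (ℕ.≤-reflexive (cong suc eq)) (m%n<n d q)) (inj′ (suc (suc e)) eq))

sum-mono-≤ : ∀ {n} {f g : Fin n → ℤ} → (∀ i → f i ℤ.≤ g i) → sum f ℤ.≤ sum g
sum-mono-≤ {zero}  h = ℤ.≤-refl
sum-mono-≤ {suc n} h = ℤ.+-mono-≤ (h zero) (sum-mono-≤ (h ∘ suc))

0≤δ : ∀ {n} (i j : Fin n) → 0ℤ ℤ.≤ δ i j
0≤δ i j with does (i ≟ j)
... | true  = ℤ.+≤+ ℕ.z≤n
... | false = ℤ.≤-refl

sum-unique : ∀ {m n} (g : Fin m → Fin n) e y₀ → g y₀ ≡ e → (∀ y → g y ≡ e → y ≡ y₀) → sum (λ y → δ (g y) e) ≡ 1ℤ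
sum-unique {m} g e y₀ g≡ uniq = begin
  sum (λ y → δ (g y) e)       ≡⟨ ∑.sum-cong-≗ {m} (λ y → trans (δ-cong (uniq y) (λ { refl → g≡ })) (sym (ℤ.*-identityʳ (δ y y₀)))) ⟩
  sum (λ y → δ y y₀ ℤ.* 1ℤ)   ≡⟨ sum-δ y₀ (λ _ → 1ℤ) ⟩
  1ℤ                          ∎
  where open ≡-Reasoning

-- Integer sums over the plane of pairs.

module PlaneSums (p : ℕ) where

  open ≡-Reasoning

  Point : Set
  Point = Fin p × Fin p

  P : ℤ
  P = ℤ.+ p

  ∑² : (Point → ℤ) → ℤ
  ∑² h = sum (λ a → sum (λ b → h (a , b)))

  δ² : Point → Point → ℤ
  δ² (a , b) (c , d) = δ a c ℤ.* δ b d

  ∑²-cong : ∀ {h k} → (∀ x → h x ≡ k x) → ∑² h ≡ ∑² k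
  ∑²-cong e = ∑.sum-cong-≗ {p} (λ a → ∑.sum-cong-≗ {p} (λ b → e (a , b)))

  ∑²-+ : ∀ h k → ∑² (λ x → h x ℤ.+ k x) ≡ ∑² h ℤ.+ ∑² k
  ∑²-+ h k = trans (∑.sum-cong-≗ {p} (λ a → ∑.∑-distrib-+ (λ b → h (a , b)) (λ b → k (a , b))))
                   (∑.∑-distrib-+ (λ a → sum (λ b → h (a , b))) (λ a → sum (λ b → k (a , b))))

  ∑²-*ˡ : ∀ c h → ∑² (λ x → c ℤ.* h x) ≡ c ℤ.* ∑² h
  ∑²-*ˡ c h = sym (trans (∑.*-distribˡ-sum c (λ a → sum (λ b → h (a , b))))
                         (∑.sum-cong-≗ {p} (λ a → ∑.*-distribˡ-sum c (λ b → h (a , b)))))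

  ∑²-*ʳ : ∀ c h → ∑² (λ x → h x ℤ.* c) ≡ ∑² h ℤ.* c
  ∑²-*ʳ c h = trans (∑²-cong (λ x → ℤ.*-comm (h x) c)) (trans (∑²-*ˡ c h) (ℤ.*-comm c (∑² h)))

  ∑²-const : ∀ c → ∑² (λ _ → c) ≡ P ℤ.* (P ℤ.* c)
  ∑²-const c = trans (∑.sum-cong-≗ {p} (λ a → sum-const p c)) (sum-const p (P ℤ.* c))

  sum-∑²-comm : ∀ {m} (h : Fin m → Point → ℤ) → sum (λ e → ∑² (h e)) ≡ ∑² (λ x → sum (λ e → h e x))
  sum-∑²-comm h = trans (∑.∑-comm (λ e a → sum (λ b → h e (a , b))))
                        (∑.sum-cong-≗ {p} (λ a → ∑.∑-comm (λ e b → h e (a , b))))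

  ∑²-comm : ∀ (h : Point → Point → ℤ) → ∑² (λ x → ∑² (h x)) ≡ ∑² (λ y → ∑² (λ x → h x y))
  ∑²-comm h = trans (∑.sum-cong-≗ {p} (λ a → sum-∑²-comm (λ b → h (a , b)))) (sum-∑²-comm (λ a y → sum (λ b → h (a , b) y)))

  ∑²-mono-≤ : ∀ {h k} → (∀ x → h x ℤ.≤ k x) → ∑² h ℤ.≤ ∑² k
  ∑²-mono-≤ h≤k = sum-mono-≤ (λ a → sum-mono-≤ (λ b → h≤k (a , b)))

  ∑²-δ² : ∀ x₀ (h : Point → ℤ) → ∑² (λ x → δ² x x₀ ℤ.* h x) ≡ h x₀
  ∑²-δ² (c , d) h = begin
    sum (λ a → sum (λ b → (δ a c ℤ.* δ b d) ℤ.* h (a , b)))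
      ≡⟨ ∑.sum-cong-≗ {p} (λ a → trans (∑.sum-cong-≗ {p} (λ b → ℤ.*-assoc (δ a c) (δ b d) (h (a , b))))
           (sym (∑.*-distribˡ-sum (δ a c) (λ b → δ b d ℤ.* h (a , b))))) ⟩
    sum (λ a → δ a c ℤ.* sum (λ b → δ b d ℤ.* h (a , b)))
      ≡⟨ ∑.sum-cong-≗ {p} (λ a → cong (δ a c ℤ.*_) (sum-δ d (λ b → h (a , b)))) ⟩
    sum (λ a → δ a c ℤ.* h (a , d))
      ≡⟨ sum-δ c (λ a → h (a , d)) ⟩
    h (c , d) ∎

  δ²-≡ : ∀ {x y} → x ≡ y → δ² x y ≡ 1ℤ
  δ²-≡ {a , b} refl = cong₂ ℤ._*_ (δ-≡ {i = a} refl) (δ-≡ {i = b} refl)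

  δ²-≢ : ∀ {x y} → ¬ x ≡ y → δ² x y ≡ 0ℤ
  δ²-≢ {a , b} {c , d} ne with a ≟ c | b ≟ d
  ... | no _     | _        = refl
  ... | yes _    | no _     = refl
  ... | yes refl | yes refl = ⊥-elim (ne refl)

  _≟²_ : ∀ (x y : Point) → Dec (x ≡ y)
  _≟²_ = ≡-dec _≟_ _≟_

  δ²-cong : ∀ {x y z w} → (x ≡ y → z ≡ w) → (z ≡ w → x ≡ y) → δ² x y ≡ δ² z w
  δ²-cong {x} {y} f g with x ≟² y
  ... | yes e = trans (δ²-≡ e) (sym (δ²-≡ (f e)))
  ... | no ne = trans (δ²-≢ ne) (sym (δ²-≢ (ne ∘ g)))

  -- Expand h (D x) as a sum over y weighted by a delta and exchange the two sums: every fibre of D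
  -- consists of one point. This avoids encoding pairs as elements of a single `Fin`.
  ∑²-bijective : ∀ {D : Point → Point} → Bijective _≡_ _≡_ D → ∀ h → ∑² (h ∘ D) ≡ ∑² h
  ∑²-bijective {D} (inj , sur) h = begin
    ∑² (λ x → h (D x))
      ≡⟨ ∑²-cong (λ x → ∑²-δ² (D x) h) ⟨
    ∑² (λ x → ∑² (λ y → δ² y (D x) ℤ.* h y))
      ≡⟨ ∑²-comm (λ x y → δ² y (D x) ℤ.* h y) ⟩
    ∑² (λ y → ∑² (λ x → δ² y (D x) ℤ.* h y))
      ≡⟨ ∑²-cong (λ y → trans (∑²-*ʳ (h y) (λ x → δ² y (D x))) (trans (cong (ℤ._* h y) (fibre y)) (ℤ.*-identityˡ (h y)))) ⟩
    ∑² h ∎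
    where
    fibre : ∀ y → ∑² (λ x → δ² y (D x)) ≡ 1ℤ
    fibre y = begin
      ∑² (λ x → δ² y (D x))
        ≡⟨ ∑²-cong (λ x → trans (δ²-cong (λ e → inj (trans (sym e) (sym (proj₂ (sur y) refl)))) (λ { refl → sym (proj₂ (sur y) refl) }))
                                (sym (ℤ.*-identityʳ (δ² x (proj₁ (sur y)))))) ⟩
      ∑² (λ x → δ² x (proj₁ (sur y)) ℤ.* 1ℤ)
        ≡⟨ ∑²-δ² (proj₁ (sur y)) (λ _ → 1ℤ) ⟩
      1ℤ ∎

-- Value distribution of bent functions.

module Distribution {q : ℕ} (p-prime : Prime (suc q)) (0<q : 0 ℕ.< q) (K : PrimeField q) where

  open PowerSums p-prime K public
  open PlaneSums (suc q) public
  open ≡-Reasoning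
  infixl 6 _⊕_ _⊖_
  infixr 7 _•_

  _⊕_ _⊖_ : Point → Point → Point
  (a , b) ⊕ (c , d) = (a + c , b + d)
  (a , b) ⊖ (c , d) = (a - c , b - d)

  _•_ : 𝔽 → Point → Point
  l • (a , b) = (l * a , l * b)

  𝟎 : Point
  𝟎 = (0# , 0#)

  ⟨_,_⟩ : Point → Point → 𝔽
  ⟨ (a , b) , (c , d) ⟩ = a * c + b * d

  ⊕-bijective : ∀ x → Bijective _≡_ _≡_ (x ⊕_)
  ⊕-bijective (a , b) = (λ e → cong₂ _,_ (+-injectiveˡ a (cong proj₁ e)) (+-injectiveˡ b (cong proj₂ e)))
    , λ (c , d) → (- a + c , - b + d) , λ { refl → cong₂ _,_ (undo a c) (undo b d) }
    where
    undo : ∀ a x → a + (- a + x) ≡ x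
    undo = solve 2 (λ a x → a :+ (:- a :+ x) := x) refl

  •-bijective : ∀ {l} → ¬ l ≡ 0# → Bijective _≡_ _≡_ (l •_)
  •-bijective {l} l≢0 = (λ e → cong₂ _,_ (*-cancelˡ l≢0 (cong proj₁ e)) (*-cancelˡ l≢0 (cong proj₂ e)))
    , λ (c , d) → (l⁻¹ * c , l⁻¹ * d) , λ { refl → cong₂ _,_ (undo c) (undo d) }
    where
    l⁻¹ = proj₁ (inverse l≢0)
    undo : ∀ x → l * (l⁻¹ * x) ≡ x
    undo x = trans (sym (*-assoc l l⁻¹ x)) (trans (cong (_* x) (proj₂ (inverse l≢0))) (*-identityˡ x))

  -- A coordinate with nonzero coefficient can be solved for, once for each of the P values of the
  -- other coordinate.
  ∑²-δ-affine : ∀ {u} → ¬ u ≡ 𝟎 → ∀ e → ∑² (λ y → δ ⟨ u , y ⟩ e) ≡ P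
  ∑²-δ-affine {u₁ , u₂} u≢0 e with u₁ ≟ 0#
  ... | no u₁≢0 = trans (∑.∑-comm {suc q} {suc q} (λ a b → δ (u₁ * a + u₂ * b) e))
        (trans (∑.sum-cong-≗ {suc q} (λ b → one b)) (trans (sum-const (suc q) 1ℤ) (ℤ.*-identityʳ P)))
    where
    i = proj₁ (inverse u₁≢0)
    one : ∀ b → sum (λ a → δ (u₁ * a + u₂ * b) e) ≡ 1ℤ
    one b = sum-unique (λ a → u₁ * a + u₂ * b) e (i * (e + - (u₂ * b)))
      (trans (solve 5 (λ u i e v b → u :* (i :* (e :+ :- (v :* b))) :+ v :* b := (u :* i) :* (e :+ :- (v :* b)) :+ v :* b) refl u₁ i e u₂ b)
        (trans (cong (λ z → z * (e + - (u₂ * b)) + u₂ * b) (proj₂ (inverse u₁≢0)))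
          (trans (cong (_+ u₂ * b) (*-identityˡ (e + - (u₂ * b)))) (solve 2 (λ e x → (e :+ :- x) :+ x := e) refl e (u₂ * b)))))
      (λ { a refl → trans (sym (*-identityˡ a)) (trans (cong (_* a) (sym (proj₂ (inverse u₁≢0))))
        (solve 5 (λ u i a v b → (u :* i) :* a := i :* ((u :* a :+ v :* b) :+ :- (v :* b))) refl u₁ i a u₂ b)) })
  ... | yes refl = trans (∑.sum-cong-≗ {suc q} (λ a → one a)) (trans (sum-const (suc q) 1ℤ) (ℤ.*-identityʳ P))
    where
    u₂≢0 : ¬ u₂ ≡ 0#
    u₂≢0 refl = u≢0 refl
    i = proj₁ (inverse u₂≢0)
    one : ∀ a → sum (λ b → δ (0# * a + u₂ * b) e) ≡ 1ℤ
    one a = sum-unique (λ b → 0# * a + u₂ * b) e (i * e)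
      (trans (cong₂ _+_ (zeroˡ a) (trans (sym (*-assoc u₂ i e)) (trans (cong (_* e) (proj₂ (inverse u₂≢0))) (*-identityˡ e)))) (+-identityˡ e))
      (λ { b refl → trans (sym (*-identityˡ b)) (trans (cong (_* b) (sym (proj₂ (inverse u₂≢0))))
        (trans (trans (cong (_* b) (*-comm u₂ i)) (*-assoc i u₂ b))
          (cong (i *_) (trans (sym (+-identityˡ (u₂ * b))) (cong (_+ u₂ * b) (sym (zeroˡ a))))))) })

  count : (Point → 𝔽) → 𝔽 → ℤ
  count h e = ∑² (λ x → δ (h x) e)

  Bent : (Point → 𝔽) → Set
  Bent h = ∀ a → ¬ a ≡ 𝟎 → ∀ ε → ∑² (λ x → δ (h (x ⊕ a)) (h x + ε)) ≡ P

  count-total : ∀ h → sum (count h) ≡ P ℤ.* P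
  count-total h = begin
    sum (λ e → ∑² (λ x → δ (h x) e))    ≡⟨ sum-∑²-comm (λ e x → δ (h x) e) ⟩
    ∑² (λ x → sum (λ e → δ (h x) e))    ≡⟨ ∑²-cong (λ x → sum-unique-sym (h x)) ⟩
    ∑² (λ x → 1ℤ)                       ≡⟨ ∑²-const 1ℤ ⟩
    P ℤ.* (P ℤ.* 1ℤ)                    ≡⟨ cong (P ℤ.*_) (ℤ.*-identityʳ P) ⟩
    P ℤ.* P                             ∎
    where
    sum-unique-sym : ∀ a → sum (λ e → δ a e) ≡ 1ℤ
    sum-unique-sym a = trans (∑.sum-cong-≗ {suc q} (λ e → δ-cong {i = a} {e} {e} {a} sym sym)) (sum-unique (λ e → e) a a refl (λ _ e → e))

  -- The sum counts pairs (x , y) with h y = h x + ε. Put y = x ⊕ a: each of the P² - 1 nonzero a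
  -- contributes P by bentness, and a = 𝟎 contributes P² or 0 according to whether ε is zero.
  count-autocorrelation : ∀ h → Bent h → ∀ ε →
    sum (λ e → count h e ℤ.* count h (e + ε)) ≡ (P ℤ.* P ℤ.* P ℤ.- P) ℤ.+ (P ℤ.* P) ℤ.* δ ε 0#
  count-autocorrelation h bent ε = begin
    sum (λ e → count h e ℤ.* count h (e + ε))
      ≡⟨ ∑.sum-cong-≗ {suc q} (λ e → trans (sym (∑²-*ʳ (count h (e + ε)) (λ x → δ (h x) e)))
           (∑²-cong (λ x → sym (∑²-*ˡ (δ (h x) e) (λ y → δ (h y) (e + ε)))))) ⟩
    sum (λ e → ∑² (λ x → ∑² (λ y → δ (h x) e ℤ.* δ (h y) (e + ε))))
      ≡⟨ trans (sum-∑²-comm (λ e x → ∑² (λ y → δ (h x) e ℤ.* δ (h y) (e + ε))))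
               (∑²-cong (λ x → sum-∑²-comm (λ e y → δ (h x) e ℤ.* δ (h y) (e + ε)))) ⟩
    ∑² (λ x → ∑² (λ y → sum (λ e → δ (h x) e ℤ.* δ (h y) (e + ε))))
      ≡⟨ ∑²-cong (λ x → ∑²-cong (λ y → trans
           (∑.sum-cong-≗ {suc q} (λ e → cong (ℤ._* δ (h y) (e + ε)) (δ-cong {i = h x} {e} {e} {h x} sym sym)))
           (sum-δ (h x) (λ e → δ (h y) (e + ε))))) ⟩
    ∑² (λ x → ∑² (λ y → δ (h y) (h x + ε)))
      ≡⟨ ∑²-cong (λ x → ∑²-bijective (⊕-bijective x) (λ y → δ (h y) (h x + ε))) ⟨
    ∑² (λ x → ∑² (λ a → δ (h (x ⊕ a)) (h x + ε)))
      ≡⟨ ∑²-comm (λ x a → δ (h (x ⊕ a)) (h x + ε)) ⟩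
    ∑² G
      ≡⟨ ∑²-cong split ⟩
    ∑² (λ a → P ℤ.+ δ² a 𝟎 ℤ.* (G 𝟎 ℤ.- P))
      ≡⟨ ∑²-+ (λ _ → P) (λ a → δ² a 𝟎 ℤ.* (G 𝟎 ℤ.- P)) ⟩
    ∑² (λ a → P) ℤ.+ ∑² (λ a → δ² a 𝟎 ℤ.* (G 𝟎 ℤ.- P))
      ≡⟨ cong₂ ℤ._+_ (∑²-const P) (∑²-δ² 𝟎 (λ _ → G 𝟎 ℤ.- P)) ⟩
    P ℤ.* (P ℤ.* P) ℤ.+ (G 𝟎 ℤ.- P)
      ≡⟨ cong (λ z → P ℤ.* (P ℤ.* P) ℤ.+ (z ℤ.- P)) G𝟎 ⟩
    P ℤ.* (P ℤ.* P) ℤ.+ (P ℤ.* (P ℤ.* δ ε 0#) ℤ.- P)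
      ≡⟨ ring P (δ ε 0#) ⟩
    (P ℤ.* P ℤ.* P ℤ.- P) ℤ.+ (P ℤ.* P) ℤ.* δ ε 0# ∎
    where
    G : Point → ℤ
    G a = ∑² (λ x → δ (h (x ⊕ a)) (h x + ε))
    ring : ∀ P d → P ℤ.* (P ℤ.* P) ℤ.+ (P ℤ.* (P ℤ.* d) ℤ.- P) ≡ (P ℤ.* P ℤ.* P ℤ.- P) ℤ.+ (P ℤ.* P) ℤ.* d
    ring = solve-∀
    ring₁ : ∀ P g → g ≡ P ℤ.+ 1ℤ ℤ.* (g ℤ.- P)
    ring₁ = solve-∀
    ring₀ : ∀ P g → P ≡ P ℤ.+ 0ℤ ℤ.* g
    ring₀ = solve-∀
    split : ∀ a → G a ≡ P ℤ.+ δ² a 𝟎 ℤ.* (G 𝟎 ℤ.- P)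
    split a with a ≟² 𝟎
    ... | yes refl = trans (ring₁ P (G 𝟎)) (cong (λ z → P ℤ.+ z ℤ.* (G 𝟎 ℤ.- P)) (sym (δ²-≡ {𝟎} refl)))
    ... | no a≢0   = trans (bent a a≢0 ε) (trans (ring₀ P (G 𝟎 ℤ.- P)) (cong (λ z → P ℤ.+ z ℤ.* (G 𝟎 ℤ.- P)) (sym (δ²-≢ a≢0))))
    G𝟎 : G 𝟎 ≡ P ℤ.* (P ℤ.* δ ε 0#)
    G𝟎 = trans (∑²-cong (λ x → trans (cong (λ y → δ (h y) (h x + ε)) (cong₂ _,_ (+-identityʳ (proj₁ x)) (+-identityʳ (proj₂ x))))
                 (δ-cong {i = h x} {h x + ε} {ε} {0#}
                   (λ e → +-injectiveˡ (h x) (trans (sym e) (sym (+-identityʳ (h x)))))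
                   (λ e → sym (trans (cong (h x +_) e) (+-identityʳ (h x)))))))
               (∑²-const (δ ε 0#))

  -- The autocorrelation is constant modulo p², so all counts are congruent modulo p. Their total is
  -- p² and, from ε = 0, their sum of squares is p³ + p² - p: the input of `two-valued`.
  bent-distribution : ∀ h → Bent h → ∃₂ λ c j → Unit c × (∀ e → count h e ≡ (P ℤ.+ c) ℤ.- (c ℤ.* P) ℤ.* δ e j)
  bent-distribution h bent = two-valued p-prime (count h) (proj₁ mod-p) (λ e → proj₁ (proj₂ mod-p) (toℕ e))
    (λ e → trans (cong (count h) (sym (red-toℕ e))) (proj₂ (proj₂ mod-p) (toℕ e)))
    (count-total h)
    (begin
      sum (λ e → count h e ℤ.* count h e)         ≡⟨ ∑.sum-cong-≗ {suc q} (λ e → cong (λ z → count h e ℤ.* count h z) (+-identityʳ e)) ⟨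
      sum (λ e → count h e ℤ.* count h (e + 0#))  ≡⟨ count-autocorrelation h bent 0# ⟩
      (P ℤ.* P ℤ.* P ℤ.- P) ℤ.+ (P ℤ.* P) ℤ.* δ 0# 0# ≡⟨ cong (λ d → (P ℤ.* P ℤ.* P ℤ.- P) ℤ.+ (P ℤ.* P) ℤ.* d) (δ-≡ {i = 0#} refl) ⟩
      (P ℤ.* P ℤ.* P ℤ.- P) ℤ.+ (P ℤ.* P) ℤ.* 1ℤ  ≡⟨ ring P ⟩
      (P ℤ.* P ℤ.* P ℤ.+ P ℤ.* P) ℤ.- P           ∎)
    where
    ring : ∀ P → (P ℤ.* P ℤ.* P ℤ.- P) ℤ.+ (P ℤ.* P) ℤ.* 1ℤ ≡ (P ℤ.* P ℤ.* P ℤ.+ P ℤ.* P) ℤ.- P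
    ring = solve-∀
    open Periodicity p-prime 0<q using (Periodic; R; module FlatAutocorrelation)
    periodic : Periodic (count h ∘ red)
    periodic m = cong (count h) (trans (red-+ m (suc q)) (trans (cong (red m +_) red-p) (+-identityʳ (red m))))
    flat : ∀ ε → R (count h ∘ red) (count h ∘ red) ε ≡ (P ℤ.* P ℤ.* P ℤ.- P) ℤ.+ (P ℤ.* P) ℤ.* δ (red ε) 0#
    flat ε = trans (∑.sum-cong-≗ {suc q} (λ e → cong₂ (λ a b → count h a ℤ.* count h b) (red-toℕ e)
                     (trans (red-+ (toℕ e) ε) (cong (_+ red ε) (red-toℕ e)))))
                   (count-autocorrelation h bent (red ε))
    mod-p = FlatAutocorrelation.V≡const[mod-p] (count h ∘ red) periodic (P ℤ.* P ℤ.* P ℤ.- P) (λ ε → δ (red ε) 0#) flat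

units-congruent⇒≡ : ∀ {P a b} → 3 ℕ.< P → Unit a → Unit b → ℤ.+ P ∣ a ℤ.- b → a ≡ b
units-congruent⇒≡ 3<P (inj₁ refl) (inj₁ refl) d = refl
units-congruent⇒≡ 3<P (inj₁ refl) (inj₂ refl) d = ⊥-elim (ℕ.<⇒≱ 3<P (ℕ.≤-trans (ℕ.∣⇒≤ (∣⇒∣ᵤ d)) (ℕ.n≤1+n 2)))
units-congruent⇒≡ 3<P (inj₂ refl) (inj₁ refl) d = ⊥-elim (ℕ.<⇒≱ 3<P (ℕ.≤-trans (ℕ.∣⇒≤ (∣⇒∣ᵤ d)) (ℕ.n≤1+n 2)))
units-congruent⇒≡ 3<P (inj₂ refl) (inj₂ refl) d = refl

-- Counting points on the affine line s = 1.

module AffineSection {q : ℕ} (p-prime : Prime (suc q)) (3<p : 3 ℕ.< suc q) (K : PrimeField q) where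

  0<q : 0 ℕ.< q
  0<q = ℕ.≤-trans (ℕ.s≤s ℕ.z≤n) (ℕ.s≤s⁻¹ 3<p)

  open Distribution p-prime 0<q K public
  open ≡-Reasoning

  2≢0 : ¬ red 2 ≡ 0#
  2≢0 = red≢0 (ℕ.s≤s ℕ.z≤n) (ℕ.≤-trans (ℕ.n≤1+n 3) 3<p)

  -- Given one root r, the difference of the two equations factors as (b - r)(j (b + r) + 1) = 0, so
  -- any other root satisfies j b = w. The equation may degenerate to a linear one, as j is
  -- arbitrary.
  quadratic-roots≤2 : ∀ j e → sum (λ b → δ (e + - b) (b * b * j)) ℤ.≤ ℤ.+ 2
  quadratic-roots≤2 j e with any? (λ r → e + - r ≟ r * r * j)
  ... | no none = ℤ.≤-trans (ℤ.≤-reflexive (sum-zero {suc q} (λ b → δ-≢ {i = e + - b} {b * b * j} (λ root → none (b , root))))) (ℤ.+≤+ ℕ.z≤n)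
  ... | yes (r , e-r) = ℤ.≤-trans (sum-mono-≤ bound)
      (ℤ.≤-trans (ℤ.≤-reflexive (∑.∑-distrib-+ (λ b → δ b r) (λ b → δ (j * b) w)))
        (ℤ.+-mono-≤ (ℤ.≤-reflexive (sum-unique (λ b → b) r r refl (λ _ x → x))) other≤1))
    where
    w = - (j * r) + - 1#
    other≤1 : sum (λ b → δ (j * b) w) ℤ.≤ 1ℤ
    other≤1 with j ≟ 0#
    -- For j = 0 the second factor is the constant 1, so r is the only root.
    ... | yes refl = ℤ.≤-trans (ℤ.≤-reflexive (sum-zero {suc q} (λ b → δ-≢ {i = 0# * b} {w} (λ x → 1≢0 (begin
          1#                               ≡⟨ solve 3 (λ z r o → o := :- (z :* r) :+ :- (:- (z :* r) :+ :- o)) refl 0# r 1# ⟩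
          - (0# * r) + - w                 ≡⟨ cong₂ (λ u v → - u + - v) (zeroˡ r) (trans (sym x) (zeroˡ b)) ⟩
          - 0# + - 0#                      ≡⟨ cong (λ z → z + z) -0#≈0# ⟩
          0# + 0#                          ≡⟨ +-identityˡ 0# ⟩
          0#                               ∎))))) (ℤ.+≤+ ℕ.z≤n)
    ... | no j≢0 = ℤ.≤-reflexive (sum-unique (j *_) w (j⁻¹ * w)
          (trans (sym (*-assoc j j⁻¹ w)) (trans (cong (_* w) jj⁻¹) (*-identityˡ w)))
          (λ b x → trans (sym (trans (sym (*-assoc j⁻¹ j b)) (trans (cong (_* b) (trans (*-comm j⁻¹ j) jj⁻¹)) (*-identityˡ b)))) (cong (j⁻¹ *_) x)))
      where
      j⁻¹ = proj₁ (inverse j≢0)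
      jj⁻¹ = proj₂ (inverse j≢0)
    bound : ∀ b → δ (e + - b) (b * b * j) ℤ.≤ δ b r ℤ.+ δ (j * b) w
    bound b with e + - b ≟ b * b * j | b ≟ r
    ... | no _    | yes _ = ℤ.+-mono-≤ {0ℤ} {1ℤ} (ℤ.+≤+ ℕ.z≤n) (0≤δ (j * b) w)
    ... | no _    | no _  = ℤ.+-mono-≤ {0ℤ} {0ℤ} ℤ.≤-refl (0≤δ (j * b) w)
    ... | yes _   | yes _ = ℤ.+-mono-≤ {1ℤ} {1ℤ} ℤ.≤-refl (0≤δ (j * b) w)
    ... | yes e-b | no b≢r = ℤ.+-mono-≤ {0ℤ} {0ℤ} ℤ.≤-refl (ℤ.≤-reflexive (sym (δ-≡ {i = j * b} {w} jb≡w)))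
      where
      jb≡w : j * b ≡ w
      jb≡w = x+-y≡0⇒x≡y (x≢0∧x*y≡0⇒y≡0 {b + - r} (b≢r ∘ x+-y≡0⇒x≡y) (begin
        (b + - r) * (j * b + - w)
          ≡⟨ solve 5 (λ b r j e o → (b :+ :- r) :* (j :* b :+ :- (:- (j :* r) :+ :- o))
               := (b :* b :* j :+ :- (e :+ :- (o :* b))) :+ :- (r :* r :* j :+ :- (e :+ :- (o :* r)))) refl b r j e 1# ⟩
        (b * b * j + - (e + - (1# * b))) + - (r * r * j + - (e + - (1# * r)))
          ≡⟨ cong₂ (λ u v → (b * b * j + - (e + - u)) + - (r * r * j + - (e + - v))) (*-identityˡ b) (*-identityˡ r) ⟩
        (b * b * j + - (e + - b)) + - (r * r * j + - (e + - r))
          ≡⟨ cong₂ (λ u v → (b * b * j + - u) + - (r * r * j + - v)) e-b e-r ⟩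
        (b * b * j + - (b * b * j)) + - (r * r * j + - (r * r * j))
          ≡⟨ cong₂ (λ u v → u + - v) (-‿inverseʳ (b * b * j)) (-‿inverseʳ (r * r * j)) ⟩
        0# + - 0#
          ≡⟨ -‿inverseʳ 0# ⟩
        0# ∎))

  module _ (g : Point → 𝔽) (g-homogeneous : ∀ l x → g (l • x) ≡ (l * l) * g x)
           (σ : Point) (σ≢0 : ¬ σ ≡ 𝟎)
           (bent : ∀ b → Bent (λ x → g x + - (b * ⟨ σ , x ⟩))) where

    private
      s : Point → 𝔽
      s x = ⟨ σ , x ⟩

      h : 𝔽 → Point → 𝔽
      h b x = g x + - (b * s x)

      s-homogeneous : ∀ l x → s (l • x) ≡ l * s x
      s-homogeneous l x = solve 5 (λ a b l x y → a :* (l :* x) :+ b :* (l :* y) := l :* (a :* x :+ b :* y)) refl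
        (proj₁ σ) (proj₂ σ) l (proj₁ x) (proj₂ x)

    N : 𝔽 → ℤ
    N e = ∑² (λ x → δ (s x) 1# ℤ.* δ (g x) e)

    -- Σ_b count (h b) (e - b) runs over the lines through (1 , e) in the plane of pairs (s x , g x).
    pencil : ∀ e → sum (λ b → count (h b) (e + - b)) ≡ (P ℤ.* P ℤ.- P) ℤ.+ P ℤ.* N e
    pencil e = begin
      sum (λ b → ∑² (λ x → δ (h b x) (e + - b)))
        ≡⟨ sum-∑²-comm (λ b x → δ (h b x) (e + - b)) ⟩
      ∑² (λ x → sum (λ b → δ (h b x) (e + - b)))
        ≡⟨ ∑²-cong (λ x → through (s x) (g x)) ⟩
      ∑² (λ x → (1ℤ ℤ.+ -1ℤ ℤ.* δ (s x) 1#) ℤ.+ P ℤ.* (δ (s x) 1# ℤ.* δ (g x) e))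
        ≡⟨ ∑²-+ (λ x → 1ℤ ℤ.+ -1ℤ ℤ.* δ (s x) 1#) (λ x → P ℤ.* (δ (s x) 1# ℤ.* δ (g x) e)) ⟩
      ∑² (λ x → 1ℤ ℤ.+ -1ℤ ℤ.* δ (s x) 1#) ℤ.+ ∑² (λ x → P ℤ.* (δ (s x) 1# ℤ.* δ (g x) e))
        ≡⟨ cong₂ ℤ._+_ (trans (∑²-+ (λ _ → 1ℤ) (λ x → -1ℤ ℤ.* δ (s x) 1#))
             (cong₂ ℤ._+_ (∑²-const 1ℤ) (trans (∑²-*ˡ -1ℤ (λ x → δ (s x) 1#)) (cong (-1ℤ ℤ.*_) (∑²-δ-affine σ≢0 1#)))))
             (∑²-*ˡ P (λ x → δ (s x) 1# ℤ.* δ (g x) e)) ⟩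
      (P ℤ.* (P ℤ.* 1ℤ) ℤ.+ -1ℤ ℤ.* P) ℤ.+ P ℤ.* N e
        ≡⟨ ring P (P ℤ.* N e) ⟩
      (P ℤ.* P ℤ.- P) ℤ.+ P ℤ.* N e ∎
      where
      ring : ∀ P n → (P ℤ.* (P ℤ.* 1ℤ) ℤ.+ -1ℤ ℤ.* P) ℤ.+ n ≡ (P ℤ.* P ℤ.- P) ℤ.+ n
      ring = solve-∀
      -- The condition reads b (1 - u) = e - v. If u = 1 it holds for all b or for none; otherwise
      -- b₀ is its only solution.
      through : ∀ u v → sum (λ b → δ (v + - (b * u)) (e + - b)) ≡ (1ℤ ℤ.+ -1ℤ ℤ.* δ u 1#) ℤ.+ P ℤ.* (δ u 1# ℤ.* δ v e)
      through u v with u ≟ 1#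
      ... | yes refl = trans (∑.sum-cong-≗ {suc q} (λ b → δ-cong {i = v + - (b * 1#)} {e + - b} {v} {e}
               (λ x → +-injectiveˡ (- b) (trans (+-comm (- b) v) (trans (trans (cong (λ z → v + - z) (sym (*-identityʳ b))) x) (+-comm e (- b)))))
               (λ { refl → cong (λ z → v + - z) (*-identityʳ b) })))
               (trans (sum-const (suc q) (δ v e)) (ring₁ P (δ v e)))
        where
        ring₁ : ∀ P d → P ℤ.* d ≡ (1ℤ ℤ.+ -1ℤ ℤ.* 1ℤ) ℤ.+ P ℤ.* (1ℤ ℤ.* d)
        ring₁ = solve-∀
      ... | no u≢1 = trans (∑.sum-cong-≗ {suc q} (λ b → δ-cong {i = v + - (b * u)} {e + - b} {b} {b₀} (to b) (from b)))
               (trans (sum-unique (λ b → b) b₀ b₀ refl (λ _ x → x)) (ring₂ P (δ v e)))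
        where
        ring₂ : ∀ P d → 1ℤ ≡ (1ℤ ℤ.+ -1ℤ ℤ.* 0ℤ) ℤ.+ P ℤ.* (0ℤ ℤ.* d)
        ring₂ = solve-∀
        1-u≢0 : ¬ 1# + - u ≡ 0#
        1-u≢0 x = u≢1 (sym (x+-y≡0⇒x≡y x))
        i = proj₁ (inverse 1-u≢0)
        ii = proj₂ (inverse 1-u≢0)
        b₀ = i * (e + - v)
        back : ∀ x → (1# + - u) * (i * x) ≡ x
        back x = trans (sym (*-assoc (1# + - u) i x)) (trans (cong (_* x) ii) (*-identityˡ x))
        to : ∀ b → v + - (b * u) ≡ e + - b → b ≡ b₀
        to b x = *-cancelˡ 1-u≢0 (trans (begin
          (1# + - u) * b             ≡⟨ solve 4 (λ o u b v → (o :+ :- u) :* b := (o :* b :+ :- v) :+ (v :+ :- (b :* u))) refl 1# u b v ⟩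
          (1# * b + - v) + (v + - (b * u)) ≡⟨ cong₂ (λ z y → (z + - v) + y) (*-identityˡ b) x ⟩
          (b + - v) + (e + - b)      ≡⟨ solve 3 (λ b v e → (b :+ :- v) :+ (e :+ :- b) := e :+ :- v) refl b v e ⟩
          e + - v                    ∎) (sym (back (e + - v))))
        from : ∀ b → b ≡ b₀ → v + - (b * u) ≡ e + - b
        from b refl = begin
          v + - (b * u)              ≡⟨ solve 4 (λ o u b v → v :+ :- (b :* u) := (v :+ (o :+ :- u) :* b) :+ :- (o :* b)) refl 1# u b v ⟩
          (v + (1# + - u) * b) + - (1# * b) ≡⟨ cong₂ (λ z y → (v + z) + - y) (back (e + - v)) (*-identityˡ b) ⟩
          (v + (e + - v)) + - b      ≡⟨ cong (_+ - b) (solve 2 (λ v e → v :+ (e :+ :- v) := e) refl v e) ⟩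
          e + - b                    ∎

    -- Substituting l • x multiplies g by l² and s by l, so `h (l * b)` becomes l² times `h b`.
    count-scale : ∀ {l} → ¬ l ≡ 0# → ∀ b e → count (h (l * b)) ((l * l) * e) ≡ count (h b) e
    count-scale {l} l≢0 b e = begin
      ∑² (λ x → δ (h (l * b) x) ((l * l) * e))
        ≡⟨ ∑²-bijective (•-bijective l≢0) (λ x → δ (h (l * b) x) ((l * l) * e)) ⟨
      ∑² (λ x → δ (h (l * b) (l • x)) ((l * l) * e))
        ≡⟨ ∑²-cong (λ x → δ-cong {i = h (l * b) (l • x)} {(l * l) * e} {h b x} {e}
             (λ y → *-cancelˡ (*≢0 l≢0 l≢0) (trans (sym (scale x)) y))
             (λ y → trans (scale x) (cong ((l * l) *_) y))) ⟩
      ∑² (λ x → δ (h b x) e) ∎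
      where
      scale : ∀ x → h (l * b) (l • x) ≡ (l * l) * h b x
      scale x = trans (cong₂ (λ u v → u + - ((l * b) * v)) (g-homogeneous l x) (s-homogeneous l x))
        (solve 4 (λ l b g s → (l :* l) :* g :+ :- ((l :* b) :* (l :* s)) := (l :* l) :* (g :+ :- (b :* s))) refl l b (g x) (s x))

    Distributed : 𝔽 → ℤ → 𝔽 → Set
    Distributed b c j = ∀ e → count (h b) e ≡ (P ℤ.+ c) ℤ.- (c ℤ.* P) ℤ.* δ e j

    module _ (c₀ : ℤ) (j₀ : 𝔽) (c₀-unit : Unit c₀) (count₀ : Distributed 0# c₀ j₀)
             (c₁ : ℤ) (j₁ : 𝔽) (c₁-unit : Unit c₁) (count₁ : Distributed 1# c₁ j₁) where

      -- Scaling by 2 fixes b = 0 and multiplies values by 4, so the counts at 4 j₀ and j₀ agree.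
      -- But j₀ is the only exceptional value, and 4 j₀ = j₀ forces j₀ = 0 because 3 is invertible.
      j₀≡0 : j₀ ≡ 0#
      j₀≡0 with j₀ ≟ 0#
      ... | yes e = e
      ... | no j₀≢0 = ⊥-elim (absurd c₀-unit (begin
          c₀ ℤ.* P                              ≡⟨ ring (P ℤ.+ c₀) (c₀ ℤ.* P) ⟩
          ((P ℤ.+ c₀) ℤ.- (c₀ ℤ.* P) ℤ.* 0ℤ) ℤ.- ((P ℤ.+ c₀) ℤ.- (c₀ ℤ.* P) ℤ.* 1ℤ)
            ≡⟨ cong₂ (λ u v → ((P ℤ.+ c₀) ℤ.- (c₀ ℤ.* P) ℤ.* u) ℤ.- ((P ℤ.+ c₀) ℤ.- (c₀ ℤ.* P) ℤ.* v))
                 (δ-≢ {i = 4j} {j₀} 4j≢j) (δ-≡ {i = j₀} refl) ⟨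
          ((P ℤ.+ c₀) ℤ.- (c₀ ℤ.* P) ℤ.* δ 4j j₀) ℤ.- ((P ℤ.+ c₀) ℤ.- (c₀ ℤ.* P) ℤ.* δ j₀ j₀)
            ≡⟨ cong₂ ℤ._-_ (count₀ 4j) (count₀ j₀) ⟨
          count (h 0#) 4j ℤ.- count (h 0#) j₀
            ≡⟨ cong (λ z → count (h z) 4j ℤ.- count (h 0#) j₀) (zeroʳ two) ⟨
          count (h (two * 0#)) 4j ℤ.- count (h 0#) j₀
            ≡⟨ cong (ℤ._- count (h 0#) j₀) (count-scale 2≢0 0# j₀) ⟩
          count (h 0#) j₀ ℤ.- count (h 0#) j₀   ≡⟨ ℤ.+-inverseʳ (count (h 0#) j₀) ⟩
          0ℤ                                    ∎))
        where
        ring : ∀ a c → c ≡ (a ℤ.- c ℤ.* 0ℤ) ℤ.- (a ℤ.- c ℤ.* 1ℤ)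
        ring = solve-∀
        absurd : ∀ {c} → Unit c → c ℤ.* P ≡ 0ℤ → ⊥
        absurd (inj₁ refl) ()
        absurd (inj₂ refl) ()
        two = red 2
        4j = (two * two) * j₀
        4j≢j : ¬ 4j ≡ j₀
        4j≢j e = *≢0 (red≢0 (ℕ.s≤s ℕ.z≤n) 3<p) j₀≢0 (begin
          red 3 * j₀            ≡⟨ solve 1 (λ x → con (ℤ.+ 3) :* x := (con (ℤ.+ 2) :* con (ℤ.+ 2)) :* x :+ :- x) refl j₀ ⟩
          4j + - j₀             ≡⟨ cong (_+ - j₀) e ⟩
          j₀ + - j₀             ≡⟨ -‿inverseʳ j₀ ⟩
          0#                    ∎)

      -- A nonzero b is scaled to 1. The slope b = 0 cannot be, and the last summand corrects for
      -- its possibly different sign c₀.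
      count-through : ∀ e b → count (h b) (e + - b) ≡
        ((P ℤ.+ c₁) ℤ.+ (ℤ.- (c₁ ℤ.* P)) ℤ.* δ (e + - b) (b * b * j₁)) ℤ.+ δ b 0# ℤ.* ((c₀ ℤ.- c₁) ℤ.- (c₀ ℤ.- c₁) ℤ.* P ℤ.* δ e 0#)
      count-through e b with b ≟ 0#
      ... | yes refl = begin
        count (h 0#) (e + - 0#)
          ≡⟨ cong (count (h 0#)) e-0 ⟩
        count (h 0#) e
          ≡⟨ count₀ e ⟩
        (P ℤ.+ c₀) ℤ.- (c₀ ℤ.* P) ℤ.* δ e j₀
          ≡⟨ cong (λ z → (P ℤ.+ c₀) ℤ.- (c₀ ℤ.* P) ℤ.* δ e z) j₀≡0 ⟩
        (P ℤ.+ c₀) ℤ.- (c₀ ℤ.* P) ℤ.* δ e 0#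
          ≡⟨ ring P c₀ c₁ (δ e 0#) ⟩
        ((P ℤ.+ c₁) ℤ.+ (ℤ.- (c₁ ℤ.* P)) ℤ.* δ e 0#) ℤ.+ 1ℤ ℤ.* ((c₀ ℤ.- c₁) ℤ.- (c₀ ℤ.- c₁) ℤ.* P ℤ.* δ e 0#)
          ≡⟨ cong₂ (λ u v → ((P ℤ.+ c₁) ℤ.+ (ℤ.- (c₁ ℤ.* P)) ℤ.* δ u v) ℤ.+ 1ℤ ℤ.* ((c₀ ℤ.- c₁) ℤ.- (c₀ ℤ.- c₁) ℤ.* P ℤ.* δ e 0#))
               (sym e-0) (sym (trans (cong (_* j₁) (zeroˡ 0#)) (zeroˡ j₁))) ⟩
        ((P ℤ.+ c₁) ℤ.+ (ℤ.- (c₁ ℤ.* P)) ℤ.* δ (e + - 0#) (0# * 0# * j₁)) ℤ.+ 1ℤ ℤ.* ((c₀ ℤ.- c₁) ℤ.- (c₀ ℤ.- c₁) ℤ.* P ℤ.* δ e 0#) ∎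
        where
        e-0 : e + - 0# ≡ e
        e-0 = trans (cong (e +_) -0#≈0#) (+-identityʳ e)
        ring : ∀ P c₀ c₁ d → (P ℤ.+ c₀) ℤ.- (c₀ ℤ.* P) ℤ.* d ≡
          ((P ℤ.+ c₁) ℤ.+ (ℤ.- (c₁ ℤ.* P)) ℤ.* d) ℤ.+ 1ℤ ℤ.* ((c₀ ℤ.- c₁) ℤ.- (c₀ ℤ.- c₁) ℤ.* P ℤ.* d)
        ring = solve-∀
      ... | no b≢0 = begin
        count (h b) (e + - b)
          ≡⟨ cong₂ (λ u v → count (h u) v) (sym (*-identityʳ b)) (sym b²e′) ⟩
        count (h (b * 1#)) ((b * b) * e′)
          ≡⟨ count-scale b≢0 1# e′ ⟩
        count (h 1#) e′
          ≡⟨ count₁ e′ ⟩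
        (P ℤ.+ c₁) ℤ.- (c₁ ℤ.* P) ℤ.* δ e′ j₁
          ≡⟨ cong (λ z → (P ℤ.+ c₁) ℤ.- (c₁ ℤ.* P) ℤ.* z) (δ-cong {i = e′} {j₁} {e + - b} {b * b * j₁}
               (λ x → trans (sym b²e′) (cong ((b * b) *_) x))
               (λ x → *-cancelˡ (*≢0 b≢0 b≢0) (trans b²e′ x))) ⟩
        (P ℤ.+ c₁) ℤ.- (c₁ ℤ.* P) ℤ.* δ (e + - b) (b * b * j₁)
          ≡⟨ ring (P ℤ.+ c₁) (c₁ ℤ.* P) (δ (e + - b) (b * b * j₁)) ((c₀ ℤ.- c₁) ℤ.- (c₀ ℤ.- c₁) ℤ.* P ℤ.* δ e 0#) ⟩
        ((P ℤ.+ c₁) ℤ.+ (ℤ.- (c₁ ℤ.* P)) ℤ.* δ (e + - b) (b * b * j₁)) ℤ.+ 0ℤ ℤ.* ((c₀ ℤ.- c₁) ℤ.- (c₀ ℤ.- c₁) ℤ.* P ℤ.* δ e 0#) ∎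
        where
        ring : ∀ a b d x → a ℤ.- b ℤ.* d ≡ (a ℤ.+ (ℤ.- b) ℤ.* d) ℤ.+ 0ℤ ℤ.* x
        ring = solve-∀
        b² = inverse (*≢0 b≢0 b≢0)
        e′ = proj₁ b² * (e + - b)
        b²e′ : (b * b) * e′ ≡ e + - b
        b²e′ = trans (sym (*-assoc (b * b) (proj₁ b²) (e + - b))) (trans (cong (_* (e + - b)) (proj₂ b²)) (*-identityˡ (e + - b)))

      M : 𝔽 → ℤ
      M e = sum (λ b → δ (e + - b) (b * b * j₁))

      -- The difference c₀ - c₁ is deliberately left outside the multiple of P: the equation then
      -- shows that P divides it.
      N-equation : ∀ e → P ℤ.* N e ≡ P ℤ.* (1ℤ ℤ.+ c₁ ℤ.- c₁ ℤ.* M e ℤ.- (c₀ ℤ.- c₁) ℤ.* δ e 0#) ℤ.+ (c₀ ℤ.- c₁)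
      N-equation e = begin
        P ℤ.* N e
          ≡⟨ ring₁ (P ℤ.* P ℤ.- P) (P ℤ.* N e) ⟩
        ((P ℤ.* P ℤ.- P) ℤ.+ P ℤ.* N e) ℤ.- (P ℤ.* P ℤ.- P)
          ≡⟨ cong (ℤ._- (P ℤ.* P ℤ.- P)) (trans (sym (pencil e)) (∑.sum-cong-≗ {suc q} (count-through e))) ⟩
        sum (λ b → A b ℤ.+ δ b 0# ℤ.* X) ℤ.- (P ℤ.* P ℤ.- P)
          ≡⟨ cong (ℤ._- (P ℤ.* P ℤ.- P)) (trans (∑.∑-distrib-+ A (λ b → δ b 0# ℤ.* X))
               (cong₂ ℤ._+_ (sum-affine (P ℤ.+ c₁) (ℤ.- (c₁ ℤ.* P)) (λ b → δ (e + - b) (b * b * j₁))) (sum-δ 0# (λ _ → X)))) ⟩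
        ((P ℤ.* (P ℤ.+ c₁) ℤ.+ (ℤ.- (c₁ ℤ.* P)) ℤ.* M e) ℤ.+ X) ℤ.- (P ℤ.* P ℤ.- P)
          ≡⟨ ring₂ P c₀ c₁ (M e) (δ e 0#) ⟩
        P ℤ.* (1ℤ ℤ.+ c₁ ℤ.- c₁ ℤ.* M e ℤ.- (c₀ ℤ.- c₁) ℤ.* δ e 0#) ℤ.+ (c₀ ℤ.- c₁) ∎
        where
        X = (c₀ ℤ.- c₁) ℤ.- (c₀ ℤ.- c₁) ℤ.* P ℤ.* δ e 0#
        A : 𝔽 → ℤ
        A b = (P ℤ.+ c₁) ℤ.+ (ℤ.- (c₁ ℤ.* P)) ℤ.* δ (e + - b) (b * b * j₁)
        ring₁ : ∀ a b → b ≡ (a ℤ.+ b) ℤ.- a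
        ring₁ = solve-∀
        ring₂ : ∀ P c₀ c₁ M d → ((P ℤ.* (P ℤ.+ c₁) ℤ.+ (ℤ.- (c₁ ℤ.* P)) ℤ.* M) ℤ.+ ((c₀ ℤ.- c₁) ℤ.- (c₀ ℤ.- c₁) ℤ.* P ℤ.* d)) ℤ.- (P ℤ.* P ℤ.- P)
          ≡ P ℤ.* (1ℤ ℤ.+ c₁ ℤ.- c₁ ℤ.* M ℤ.- (c₀ ℤ.- c₁) ℤ.* d) ℤ.+ (c₀ ℤ.- c₁)
        ring₂ = solve-∀

      -- Modulo P the equation yields c₀ = c₁, and the rest is N e = 1 + c - c M e. For c = 1 this
      -- is 2 - M e with M e nonnegative; for c = -1 it is M e, the number of roots of a quadratic
      -- equation.
      N≤2′ : ∀ e → N e ℤ.≤ ℤ.+ 2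
      N≤2′ e = bound c₁-unit (ℤ.*-cancelˡ-≡ P (N e) (1ℤ ℤ.+ c₁ ℤ.- c₁ ℤ.* M e) (begin
          P ℤ.* N e
            ≡⟨ N-equation e ⟩
          P ℤ.* (1ℤ ℤ.+ c₁ ℤ.- c₁ ℤ.* M e ℤ.- (c₀ ℤ.- c₁) ℤ.* δ e 0#) ℤ.+ (c₀ ℤ.- c₁)
            ≡⟨ cong (λ z → P ℤ.* (1ℤ ℤ.+ c₁ ℤ.- c₁ ℤ.* M e ℤ.- (z ℤ.- c₁) ℤ.* δ e 0#) ℤ.+ (z ℤ.- c₁)) c₀≡c₁ ⟩
          P ℤ.* (1ℤ ℤ.+ c₁ ℤ.- c₁ ℤ.* M e ℤ.- (c₁ ℤ.- c₁) ℤ.* δ e 0#) ℤ.+ (c₁ ℤ.- c₁)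
            ≡⟨ ring₁ P c₁ (M e) (δ e 0#) ⟩
          P ℤ.* (1ℤ ℤ.+ c₁ ℤ.- c₁ ℤ.* M e) ∎))
        where
        ring₁ : ∀ P c M d → P ℤ.* (1ℤ ℤ.+ c ℤ.- c ℤ.* M ℤ.- (c ℤ.- c) ℤ.* d) ℤ.+ (c ℤ.- c) ≡ P ℤ.* (1ℤ ℤ.+ c ℤ.- c ℤ.* M)
        ring₁ = solve-∀
        ring₂ : ∀ P n x d → P ℤ.* n ≡ P ℤ.* x ℤ.+ d → d ≡ (n ℤ.- x) ℤ.* P
        ring₂ P n x d e = trans (ring P x d) (trans (cong (ℤ._- P ℤ.* x) (sym e)) (ring′ P n x))
          where
          ring : ∀ P x d → d ≡ (P ℤ.* x ℤ.+ d) ℤ.- P ℤ.* x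
          ring = solve-∀
          ring′ : ∀ P n x → P ℤ.* n ℤ.- P ℤ.* x ≡ (n ℤ.- x) ℤ.* P
          ring′ = solve-∀
        c₀≡c₁ : c₀ ≡ c₁
        c₀≡c₁ = units-congruent⇒≡ 3<p c₀-unit c₁-unit (divides (N e ℤ.- x) (ring₂ P (N e) x (c₀ ℤ.- c₁) (N-equation e)))
          where x = 1ℤ ℤ.+ c₁ ℤ.- c₁ ℤ.* M e ℤ.- (c₀ ℤ.- c₁) ℤ.* δ e 0#
        0≤M : 0ℤ ℤ.≤ M e
        0≤M = ℤ.≤-trans (ℤ.≤-reflexive (sym (sum-zero {suc q} (λ _ → refl)))) (sum-mono-≤ (λ b → 0≤δ (e + - b) (b * b * j₁)))
        bound : ∀ {c} → Unit c → N e ≡ 1ℤ ℤ.+ c ℤ.- c ℤ.* M e → N e ℤ.≤ ℤ.+ 2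
        bound (inj₁ refl) eq = ℤ.≤-trans (ℤ.≤-reflexive (trans eq (ring (M e)))) (ℤ.≤-trans (ℤ.+-monoʳ-≤ (ℤ.+ 2) (ℤ.neg-mono-≤ 0≤M)) ℤ.≤-refl)
          where
          ring : ∀ m → 1ℤ ℤ.+ 1ℤ ℤ.- 1ℤ ℤ.* m ≡ ℤ.+ 2 ℤ.+ ℤ.- m
          ring = solve-∀
        bound (inj₂ refl) eq = ℤ.≤-trans (ℤ.≤-reflexive (trans eq (ring (M e)))) (quadratic-roots≤2 j₁ e)
          where
          ring : ∀ m → 1ℤ ℤ.+ -1ℤ ℤ.- -1ℤ ℤ.* m ≡ m
          ring = solve-∀

    N≤2 : ∀ e → N e ℤ.≤ ℤ.+ 2
    N≤2 = from (bent-distribution (h 0#) (bent 0#)) (bent-distribution (h 1#) (bent 1#))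
      where
      from : (∃₂ λ c j → Unit c × Distributed 0# c j) → (∃₂ λ c j → Unit c × Distributed 1# c j) → ∀ e → N e ℤ.≤ ℤ.+ 2
      from (c₀ , j₀ , c₀-unit , count₀) (c₁ , j₁ , c₁-unit , count₁) = N≤2′ c₀ j₀ c₀-unit count₀ c₁ j₁ c₁-unit count₁

    no-three-points : ∀ e x₁ x₂ x₃ → ¬ x₁ ≡ x₂ → ¬ x₁ ≡ x₃ → ¬ x₂ ≡ x₃ →
      s x₁ ≡ 1# → s x₂ ≡ 1# → s x₃ ≡ 1# → g x₁ ≡ e → g x₂ ≡ e → g x₃ ≡ e → ⊥
    no-three-points e x₁ x₂ x₃ n₁₂ n₁₃ n₂₃ s₁ s₂ s₃ g₁ g₂ g₃ = 3≰2 (ℤ.≤-trans (ℤ.≤-reflexive (sym total)) (ℤ.≤-trans (∑²-mono-≤ covered) (N≤2 e)))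
      where
      3≰2 : ¬ ℤ.+ 3 ℤ.≤ ℤ.+ 2
      3≰2 (ℤ.+≤+ (ℕ.s≤s (ℕ.s≤s ())))
      I : Point → ℤ
      I x = δ (s x) 1# ℤ.* δ (g x) e
      0≤I : ∀ x → 0ℤ ℤ.≤ I x
      0≤I x with does (s x ≟ 1#) | does (g x ≟ e)
      ... | true  | true  = ℤ.+≤+ ℕ.z≤n
      ... | true  | false = ℤ.≤-refl
      ... | false | _               = ℤ.≤-refl
      I≡1 : ∀ x → s x ≡ 1# → g x ≡ e → I x ≡ 1ℤ
      I≡1 x s≡ g≡ = cong₂ ℤ._*_ (δ-≡ {i = s x} s≡) (δ-≡ {i = g x} g≡)
      total : ∑² (λ x → δ² x x₁ ℤ.+ (δ² x x₂ ℤ.+ δ² x x₃)) ≡ ℤ.+ 3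
      total = trans (∑²-+ (λ x → δ² x x₁) (λ x → δ² x x₂ ℤ.+ δ² x x₃))
        (cong₂ ℤ._+_ (one x₁) (trans (∑²-+ (λ x → δ² x x₂) (λ x → δ² x x₃)) (cong₂ ℤ._+_ (one x₂) (one x₃))))
        where
        one : ∀ y → ∑² (λ x → δ² x y) ≡ 1ℤ
        one y = trans (∑²-cong (λ x → sym (ℤ.*-identityʳ (δ² x y)))) (∑²-δ² y (λ _ → 1ℤ))
      covered : ∀ x → δ² x x₁ ℤ.+ (δ² x x₂ ℤ.+ δ² x x₃) ℤ.≤ I x
      covered x with x ≟² x₁ | x ≟² x₂ | x ≟² x₃
      ... | yes refl | _ | _ = ℤ.≤-reflexive (trans (cong₂ ℤ._+_ (δ²-≡ {x} refl) (cong₂ ℤ._+_ (δ²-≢ n₁₂) (δ²-≢ n₁₃))) (sym (I≡1 x s₁ g₁)))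
      ... | no n₁ | yes refl | _ = ℤ.≤-reflexive (trans (cong₂ ℤ._+_ (δ²-≢ n₁) (cong₂ ℤ._+_ (δ²-≡ {x} refl) (δ²-≢ n₂₃))) (sym (I≡1 x s₂ g₂)))
      ... | no n₁ | no n₂ | yes refl = ℤ.≤-reflexive (trans (cong₂ ℤ._+_ (δ²-≢ n₁) (cong₂ ℤ._+_ (δ²-≢ n₂) (δ²-≡ {x} refl))) (sym (I≡1 x s₃ g₃)))
      ... | no n₁ | no n₂ | no n₃ = ℤ.≤-trans (ℤ.≤-reflexive (cong₂ ℤ._+_ (δ²-≢ n₁) (cong₂ ℤ._+_ (δ²-≢ n₂) (δ²-≢ n₃)))) (0≤I x)

-- Planar functions that are homogeneous of degree two.

module PlanarGeometry {q : ℕ} (p-prime : Prime (suc q)) (3<p : 3 ℕ.< suc q) (K : PrimeField q) where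

  open AffineSection p-prime 3<p K public
  open ≡-Reasoning

  Parallel : Point → Point → Set
  Parallel x y = ∃ λ l → ¬ l ≡ 0# × y ≡ l • x

  •-• : ∀ k l x → k • (l • x) ≡ (k * l) • x
  •-• k l (a , b) = cong₂ _,_ (sym (*-assoc k l a)) (sym (*-assoc k l b))

  1•x≡x : ∀ x → 1# • x ≡ x
  1•x≡x (a , b) = cong₂ _,_ (*-identityˡ a) (*-identityˡ b)

  0•x≡𝟎 : ∀ x → 0# • x ≡ 𝟎
  0•x≡𝟎 (a , b) = cong₂ _,_ (zeroˡ a) (zeroˡ b)

  parallel-sym : ∀ {x y} → Parallel x y → Parallel y x
  parallel-sym {x} (l , l≢0 , refl) = l⁻¹ , (λ e → 1≢0 (trans (sym ll⁻¹) (trans (cong (l *_) e) (zeroʳ l))))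
    , sym (trans (•-• l⁻¹ l x) (trans (cong (_• x) (trans (*-comm l⁻¹ l) ll⁻¹)) (1•x≡x x)))
    where
    l⁻¹ = proj₁ (inverse l≢0)
    ll⁻¹ = proj₂ (inverse l≢0)

  ⟨⟩-• : ∀ u l x → ⟨ u , l • x ⟩ ≡ l * ⟨ u , x ⟩
  ⟨⟩-• (u , v) l (a , b) = solve 5 (λ u v l a b → u :* (l :* a) :+ v :* (l :* b) := l :* (u :* a :+ v :* b)) refl u v l a b

  ⟨⟩-⊖ : ∀ u x y → ⟨ u , x ⊖ y ⟩ ≡ ⟨ u , x ⟩ + - ⟨ u , y ⟩
  ⟨⟩-⊖ (u , v) (a , b) (c , d) = trans (cong₂ (λ z w → u * z + v * w) (minus a c) (minus b d))
    (solve 6 (λ u v a b c d → u :* (a :+ :- c) :+ v :* (b :+ :- d) := (u :* a :+ v :* b) :+ :- (u :* c :+ v :* d)) refl u v a b c d)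

  ⟨⟩-⊕ : ∀ u x y → ⟨ u , x ⊕ y ⟩ ≡ ⟨ u , x ⟩ + ⟨ u , y ⟩
  ⟨⟩-⊕ (u , v) (a , b) (c , d) =
    solve 6 (λ u v a b c d → u :* (a :+ c) :+ v :* (b :+ d) := (u :* a :+ v :* b) :+ (u :* c :+ v :* d)) refl u v a b c d

  ⊖≡𝟎⇒≡ : ∀ {x y} → x ⊖ y ≡ 𝟎 → x ≡ y
  ⊖≡𝟎⇒≡ {a , b} {c , d} e = cong₂ _,_ (x+-y≡0⇒x≡y (trans (sym (minus a c)) (cong proj₁ e))) (x+-y≡0⇒x≡y (trans (sym (minus b d)) (cong proj₂ e)))

  ⊕-⊖ : ∀ x y → x ⊕ (y ⊖ x) ≡ y
  ⊕-⊖ x y = cong₂ _,_ (add (proj₁ x) (proj₁ y)) (add (proj₂ x) (proj₂ y))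
    where
    add : ∀ a b → a + (b - a) ≡ b
    add a b = trans (cong (a +_) (minus b a)) (solve 2 (λ a b → a :+ (b :+ :- a) := b) refl a b)

  -- Cramer's rule: two vectors annihilated by σ ≠ 0 have vanishing determinant.
  kernel-line : ∀ {σ x y} → ¬ σ ≡ 𝟎 → ¬ x ≡ 𝟎 → ⟨ σ , x ⟩ ≡ 0# → ⟨ σ , y ⟩ ≡ 0# → ∃ λ l → y ≡ l • x
  kernel-line {σ₁ , σ₂} {a , b} {c , d} σ≢0 x≢0 sx sy with a ≟ 0# | b ≟ 0#
  ... | yes refl | yes refl = ⊥-elim (x≢0 refl)
  ... | no a≢0 | _ = a⁻¹ * c , cong₂ _,_ (scaled a≢0 c) (*-cancelˡ a≢0 (trans ad≡bc (trans (cong (b *_) (scaled a≢0 c))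
        (solve 4 (λ b i c a → b :* ((i :* c) :* a) := a :* ((i :* c) :* b)) refl b a⁻¹ c a))))
    where
    a⁻¹ = proj₁ (inverse a≢0)
    scaled : ∀ {a} (a≢0 : ¬ a ≡ 0#) z → z ≡ (proj₁ (inverse a≢0) * z) * a
    scaled {a} a≢0 z = trans (sym (*-identityˡ z)) (trans (cong (_* z) (sym (proj₂ (inverse a≢0))))
      (solve 3 (λ a i z → (a :* i) :* z := (i :* z) :* a) refl a (proj₁ (inverse a≢0)) z))
    det : a * d + - (b * c) ≡ 0#
    det with σ₁ ≟ 0#
    ... | no σ₁≢0 = x≢0∧x*y≡0⇒y≡0 σ₁≢0 (begin
      σ₁ * (a * d + - (b * c))
        ≡⟨ solve 6 (λ s t a b c d → s :* (a :* d :+ :- (b :* c)) := (s :* a :+ t :* b) :* d :+ :- ((s :* c :+ t :* d) :* b)) refl σ₁ σ₂ a b c d ⟩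
      (σ₁ * a + σ₂ * b) * d + - ((σ₁ * c + σ₂ * d) * b)
        ≡⟨ cong₂ (λ u v → u * d + - (v * b)) sx sy ⟩
      0# * d + - (0# * b)
        ≡⟨ cong₂ (λ u v → u + - v) (zeroˡ d) (zeroˡ b) ⟩
      0# + - 0#
        ≡⟨ -‿inverseʳ 0# ⟩
      0# ∎)
    ... | yes refl = x≢0∧x*y≡0⇒y≡0 {σ₂} (λ { refl → σ≢0 refl }) (begin
      σ₂ * (a * d + - (b * c))
        ≡⟨ solve 6 (λ s t a b c d → t :* (a :* d :+ :- (b :* c)) := (s :* c :+ t :* d) :* a :+ :- ((s :* a :+ t :* b) :* c)) refl 0# σ₂ a b c d ⟩
      (0# * c + σ₂ * d) * a + - ((0# * a + σ₂ * b) * c)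
        ≡⟨ cong₂ (λ u v → u * a + - (v * c)) sy sx ⟩
      0# * a + - (0# * c)
        ≡⟨ cong₂ (λ u v → u + - v) (zeroˡ a) (zeroˡ c) ⟩
      0# + - 0#
        ≡⟨ -‿inverseʳ 0# ⟩
      0# ∎)
    ad≡bc : a * d ≡ b * c
    ad≡bc = x+-y≡0⇒x≡y det
  ... | yes refl | no b≢0 = b⁻¹ * d , cong₂ _,_
        (trans (x≢0∧x*y≡0⇒y≡0 σ₁≢0 σ₁c≡0) (sym (zeroʳ (b⁻¹ * d))))
        (trans (sym (*-identityˡ d)) (trans (cong (_* d) (sym (proj₂ (inverse b≢0))))
          (solve 3 (λ a i z → (a :* i) :* z := (i :* z) :* a) refl b b⁻¹ d)))
    where
    b⁻¹ = proj₁ (inverse b≢0)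
    σ₂≡0 : σ₂ ≡ 0#
    σ₂≡0 = x≢0∧x*y≡0⇒y≡0 b≢0 (trans (*-comm b σ₂) (trans (sym (+-identityˡ (σ₂ * b))) (trans (cong (_+ σ₂ * b) (sym (zeroʳ σ₁))) sx)))
    σ₁≢0 : ¬ σ₁ ≡ 0#
    σ₁≢0 e = σ≢0 (cong₂ _,_ e σ₂≡0)
    σ₁c≡0 : σ₁ * c ≡ 0#
    σ₁c≡0 = trans (sym (+-identityʳ (σ₁ * c))) (trans (cong (σ₁ * c +_) (sym (trans (cong (_* d) σ₂≡0) (zeroˡ d)))) sy)

  kernel-parallel : ∀ {σ x y} → ¬ σ ≡ 𝟎 → ¬ x ≡ 𝟎 → ¬ y ≡ 𝟎 → ⟨ σ , x ⟩ ≡ 0# → ⟨ σ , y ⟩ ≡ 0# → Parallel x y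
  kernel-parallel {x = x} σ≢0 x≢0 y≢0 sx sy with kernel-line σ≢0 x≢0 sx sy
  ... | l , e = l , (λ { refl → y≢0 (trans e (0•x≡𝟎 x)) }) , e

  Planar : (Point → Point) → Set
  Planar f = ∀ a → ¬ a ≡ 𝟎 → Bijective _≡_ _≡_ (λ x → (f (x ⊕ a) ⊖ f x) ⊖ f a)

  module PlanarQuadratic (f : Point → Point) (planar : Planar f) (f-homogeneous : ∀ l x → f (l • x) ≡ (l * l) • f x) where

    f-even : ∀ x → f ((- 1#) • x) ≡ f x
    f-even x = trans (f-homogeneous (- 1#) x) (trans (cong (_• f x)
      (trans (solve 1 (λ o → :- o :* :- o := o :* o) refl 1#) (*-identityˡ 1#))) (1•x≡x (f x)))

    f𝟎≡𝟎 : f 𝟎 ≡ 𝟎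
    f𝟎≡𝟎 = trans (cong f (sym (0•x≡𝟎 𝟎))) (trans (f-homogeneous 0# 𝟎) (trans (cong (_• f 𝟎) (zeroˡ 0#)) (0•x≡𝟎 (f 𝟎))))

    D : Point → Point → Point
    D a x = (f (x ⊕ a) ⊖ f x) ⊖ f a

    D-injective : ∀ {a} → ¬ a ≡ 𝟎 → ∀ {x y} → D a x ≡ D a y → x ≡ y
    D-injective a≢0 = proj₁ (planar _ a≢0)

    half : ∃ λ c → c + c ≡ 1#
    half = proj₁ i , trans (solve 1 (λ c → c :+ c := con (ℤ.+ 2) :* c) refl (proj₁ i)) (proj₂ i)
      where i = inverse (2≢0)

    -- Let a = y ⊖ x and m = -a/2, so that m ⊕ a = -m. As f is even, the difference of f in
    -- direction a vanishes at m as well as at x, and planarity gives x = m, hence y = -x.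
    f-fibres : ∀ {x y} → f x ≡ f y → y ≡ x ⊎ y ≡ (- 1#) • x
    f-fibres {x} {y} fx≡fy with (y ⊖ x) ≟² 𝟎
    ... | yes e = inj₁ (⊖≡𝟎⇒≡ e)
    ... | no a≢0 = inj₂ (begin
        y              ≡⟨ x⊕a≡y ⟨
        x ⊕ a          ≡⟨ cong (_⊕ a) x≡m ⟩
        m ⊕ a          ≡⟨ m⊕a ⟩
        (- 1#) • m     ≡⟨ cong ((- 1#) •_) x≡m ⟨
        (- 1#) • x     ∎)
      where
      a = y ⊖ x
      c = proj₁ half
      m = (- c) • a
      x⊕a≡y : x ⊕ a ≡ y
      x⊕a≡y = ⊕-⊖ x y
      m⊕a : m ⊕ a ≡ (- 1#) • m
      m⊕a = cong₂ _,_ (neg (proj₁ a)) (neg (proj₂ a))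
        where
        neg : ∀ a → - c * a + a ≡ - 1# * (- c * a)
        neg a = begin
          - c * a + a              ≡⟨ cong (- c * a +_) (trans (sym (*-identityˡ a)) (cong (_* a) (sym (proj₂ half)))) ⟩
          - c * a + (c + c) * a    ≡⟨ solve 2 (λ c a → :- c :* a :+ (c :+ c) :* a := :- con (ℤ.+ 1) :* (:- c :* a)) refl c a ⟩
          - red 1 * (- c * a)      ≡⟨ cong (λ z → - z * (- c * a)) red-1 ⟩
          - 1# * (- c * a)         ∎
      x≡m : x ≡ m
      x≡m = D-injective a≢0 (cong (_⊖ f a) (begin
        f (x ⊕ a) ⊖ f x   ≡⟨ cong (λ z → f z ⊖ f x) x⊕a≡y ⟩
        f y ⊖ f x         ≡⟨ cong (_⊖ f x) fx≡fy ⟨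
        f x ⊖ f x         ≡⟨ self (f x) (f m) ⟩
        f m ⊖ f m         ≡⟨ cong (_⊖ f m) (trans (cong f m⊕a) (f-even m)) ⟨
        f (m ⊕ a) ⊖ f m   ∎))
        where
        self : ∀ x y → x ⊖ x ≡ y ⊖ y
        self (a , b) (c , d) = cong₂ _,_ (trans (zero-sub a) (sym (zero-sub c))) (trans (zero-sub b) (sym (zero-sub d)))
          where
          zero-sub : ∀ a → a - a ≡ 0#
          zero-sub a = trans (minus a a) (-‿inverseʳ a)

    f≡𝟎⇒≡𝟎 : ∀ {x} → f x ≡ 𝟎 → x ≡ 𝟎
    f≡𝟎⇒≡𝟎 {x} e with f-fibres {𝟎} {x} (trans f𝟎≡𝟎 (sym e))
    ... | inj₁ x≡𝟎 = x≡𝟎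
    ... | inj₂ x≡-𝟎 = trans x≡-𝟎 (cong₂ _,_ (zeroʳ (- 1#)) (zeroʳ (- 1#)))

    -- The increment of h in direction a differs from ⟨ u , D a x ⟩ by a quantity independent of x:
    -- the linear term only shifts the target value. `D a` is a bijection and the form of u is
    -- balanced.
    component-bent : ∀ {u} → ¬ u ≡ 𝟎 → ∀ σ b → Bent (λ x → ⟨ u , f x ⟩ + - (b * ⟨ σ , x ⟩))
    component-bent {u} u≢0 σ b a a≢0 ε = begin
      ∑² (λ x → δ (h (x ⊕ a)) (h x + ε))
        ≡⟨ ∑²-cong (λ x → δ-cong {i = h (x ⊕ a)} {h x + ε} {⟨ u , D a x ⟩} {e} (to x) (from x)) ⟩
      ∑² (λ x → δ ⟨ u , D a x ⟩ e)
        ≡⟨ ∑²-bijective (planar a a≢0) (λ y → δ ⟨ u , y ⟩ e) ⟩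
      ∑² (λ y → δ ⟨ u , y ⟩ e)
        ≡⟨ ∑²-δ-affine u≢0 e ⟩
      P ∎
      where
      h : Point → 𝔽
      h x = ⟨ u , f x ⟩ + - (b * ⟨ σ , x ⟩)
      e = (ε + b * ⟨ σ , a ⟩) + - ⟨ u , f a ⟩
      uD : ∀ x → ⟨ u , D a x ⟩ ≡ (⟨ u , f (x ⊕ a) ⟩ + - ⟨ u , f x ⟩) + - ⟨ u , f a ⟩
      uD x = trans (⟨⟩-⊖ u (f (x ⊕ a) ⊖ f x) (f a)) (cong (_+ - ⟨ u , f a ⟩) (⟨⟩-⊖ u (f (x ⊕ a)) (f x)))
      h⊕ : ∀ x → h (x ⊕ a) ≡ ⟨ u , f (x ⊕ a) ⟩ + - (b * (⟨ σ , x ⟩ + ⟨ σ , a ⟩))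
      h⊕ x = cong (λ z → ⟨ u , f (x ⊕ a) ⟩ + - (b * z)) (⟨⟩-⊕ σ x a)
      to : ∀ x → h (x ⊕ a) ≡ h x + ε → ⟨ u , D a x ⟩ ≡ e
      to x eq = begin
        ⟨ u , D a x ⟩
          ≡⟨ uD x ⟩
        (F + - G) + - H
          ≡⟨ solve 6 (λ F G H b s t → (F :+ :- G) :+ :- H := ((F :+ :- (b :* (s :+ t))) :+ :- (G :+ :- (b :* s))) :+ (b :* t :+ :- H)) refl F G H b ⟨ σ , x ⟩ ⟨ σ , a ⟩ ⟩
        ((F + - (b * (⟨ σ , x ⟩ + ⟨ σ , a ⟩))) + - h x) + (b * ⟨ σ , a ⟩ + - H)
          ≡⟨ cong (λ z → (z + - h x) + (b * ⟨ σ , a ⟩ + - H)) (trans (sym (h⊕ x)) eq) ⟩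
        ((h x + ε) + - h x) + (b * ⟨ σ , a ⟩ + - H)
          ≡⟨ solve 5 (λ g ε b t H → ((g :+ ε) :+ :- g) :+ (b :* t :+ :- H) := (ε :+ b :* t) :+ :- H) refl (h x) ε b ⟨ σ , a ⟩ H ⟩
        e ∎
        where
        F = ⟨ u , f (x ⊕ a) ⟩
        G = ⟨ u , f x ⟩
        H = ⟨ u , f a ⟩
      from : ∀ x → ⟨ u , D a x ⟩ ≡ e → h (x ⊕ a) ≡ h x + ε
      from x eq = begin
        h (x ⊕ a)
          ≡⟨ h⊕ x ⟩
        F + - (b * (⟨ σ , x ⟩ + ⟨ σ , a ⟩))
          ≡⟨ solve 6 (λ F G H b s t → F :+ :- (b :* (s :+ t)) := ((G :+ :- (b :* s)) :+ ((F :+ :- G) :+ :- H)) :+ (H :+ :- (b :* t))) refl F G H b ⟨ σ , x ⟩ ⟨ σ , a ⟩ ⟩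
        (h x + ((F + - G) + - H)) + (H + - (b * ⟨ σ , a ⟩))
          ≡⟨ cong (λ z → (h x + z) + (H + - (b * ⟨ σ , a ⟩))) (trans (sym (uD x)) eq) ⟩
        (h x + e) + (H + - (b * ⟨ σ , a ⟩))
          ≡⟨ solve 5 (λ g ε b t H → (g :+ ((ε :+ b :* t) :+ :- H)) :+ (H :+ :- (b :* t)) := g :+ ε) refl (h x) ε b ⟨ σ , a ⟩ H ⟩
        h x + ε ∎
        where
        F = ⟨ u , f (x ⊕ a) ⟩
        G = ⟨ u , f x ⟩
        H = ⟨ u , f a ⟩

    module _ {σ : Point} (σ≢0 : ¬ σ ≡ 𝟎) where

      private
        s : Point → 𝔽
        s x = ⟨ σ , x ⟩

      -- D v (ν v) = 2ν f(v) already takes every value in ⟨f(v)⟩.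
      tangent : ∀ {u x y z} → ¬ u ≡ 𝟎 → ¬ x ≡ 𝟎 → s x ≡ 0# → ⟨ u , f x ⟩ ≡ 0# →
                s y ≡ 1# → s z ≡ 1# → ⟨ u , f y ⟩ ≡ ⟨ u , f z ⟩ → y ≡ z
      tangent {u} {x} {y} {z} u≢0 x≢0 sx gx sy sz gy≡gz with (y ⊖ z) ≟² 𝟎
      ... | yes e = ⊖≡𝟎⇒≡ e
      ... | no v≢0 = ⊥-elim (1≢0 (trans (sym sz) (trans (cong s z≡ν•v) (trans (⟨⟩-• σ ν v) (trans (cong (ν *_) sv) (zeroʳ ν))))))
        where
        v = y ⊖ z
        sv : s v ≡ 0#
        sv = trans (⟨⟩-⊖ σ y z) (trans (cong₂ (λ a b → a + - b) sy sz) (-‿inverseʳ 1#))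
        v∥x = kernel-line σ≢0 x≢0 sx sv
        l = proj₁ v∥x
        gv : ⟨ u , f v ⟩ ≡ 0#
        gv = trans (cong (λ w → ⟨ u , f w ⟩) (proj₂ v∥x)) (trans (cong ⟨ u ,_⟩ (f-homogeneous l x))
          (trans (⟨⟩-• u (l * l) (f x)) (trans (cong ((l * l) *_) gx) (zeroʳ (l * l)))))
        gy-gz : ⟨ u , f y ⊖ f z ⟩ ≡ 0#
        gy-gz = trans (⟨⟩-⊖ u (f y) (f z)) (trans (cong (_+ - ⟨ u , f z ⟩) gy≡gz) (-‿inverseʳ ⟨ u , f z ⟩))
        -- Both f v and f y ⊖ f z are annihilated by u, and f v is nonzero, so the second is a
        -- multiple μ of the first.
        fy-fz = kernel-line u≢0 (λ e → v≢0 (f≡𝟎⇒≡𝟎 e)) gv gy-gz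
        μ = proj₁ fy-fz
        c = proj₁ half
        -- Solves 2ν + 1 = μ, because f ((ν + 1) v) - f (ν v) = (2ν + 1) f v.
        ν = c * (μ + - 1#)
        z⊕v≡y : z ⊕ v ≡ y
        z⊕v≡y = ⊕-⊖ z y
        ν•v⊕v : (ν • v) ⊕ v ≡ (ν + 1#) • v
        ν•v⊕v = cong₂ _,_ (expand (proj₁ v)) (expand (proj₂ v))
          where
          expand : ∀ a → ν * a + a ≡ (ν + 1#) * a
          expand a = trans (cong (ν * a +_) (sym (*-identityˡ a))) (sym (distribʳ a ν 1#))
        z≡ν•v : z ≡ ν • v
        z≡ν•v = D-injective v≢0 (cong (_⊖ f v) (begin
          f (z ⊕ v) ⊖ f z                    ≡⟨ cong (λ w → f w ⊖ f z) z⊕v≡y ⟩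
          f y ⊖ f z                          ≡⟨ proj₂ fy-fz ⟩
          μ • f v                            ≡⟨ cong₂ _,_ (difference (proj₁ (f v))) (difference (proj₂ (f v))) ⟨
          (((ν + 1#) * (ν + 1#)) • f v) ⊖ ((ν * ν) • f v)
            ≡⟨ cong₂ _⊖_ (f-homogeneous (ν + 1#) v) (f-homogeneous ν v) ⟨
          f ((ν + 1#) • v) ⊖ f (ν • v)       ≡⟨ cong (λ w → f w ⊖ f (ν • v)) ν•v⊕v ⟨
          f ((ν • v) ⊕ v) ⊖ f (ν • v)        ∎))
          where
          difference : ∀ a → ((ν + 1#) * (ν + 1#)) * a - (ν * ν) * a ≡ μ * a
          difference a = trans (minus (((ν + 1#) * (ν + 1#)) * a) ((ν * ν) * a)) (begin
            ((ν + 1#) * (ν + 1#)) * a + - ((ν * ν) * a)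
              ≡⟨ solve 4 (λ c m o a → ((c :* (m :+ :- o) :+ o) :* (c :* (m :+ :- o) :+ o)) :* a :+ :- ((c :* (m :+ :- o) :* (c :* (m :+ :- o))) :* a)
                   := (((c :+ c) :* (m :+ :- o)) :* o :+ o :* o) :* a) refl c μ 1# a ⟩
            (((c + c) * (μ + - 1#)) * 1# + 1# * 1#) * a
              ≡⟨ cong₂ (λ z w → (z + w) * a) (*-identityʳ ((c + c) * (μ + - 1#))) (*-identityˡ 1#) ⟩
            ((c + c) * (μ + - 1#) + 1#) * a
              ≡⟨ cong (λ z → (z + 1#) * a) (trans (cong (_* (μ + - 1#)) (proj₂ half)) (*-identityˡ (μ + - 1#))) ⟩
            ((μ + - 1#) + 1#) * a
              ≡⟨ cong (_* a) (solve 2 (λ m o → (m :+ :- o) :+ o := m) refl μ 1#) ⟩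
            μ * a ∎)

      normalise : ∀ {x} → ¬ s x ≡ 0# → ∃ λ x′ → s x′ ≡ 1# × x ≡ s x • x′ × Parallel x x′
      normalise {x} sx≢0 = i • x , trans (⟨⟩-• σ i x) (trans (*-comm i (s x)) (proj₂ (inverse sx≢0)))
        , sym (trans (•-• (s x) i x) (trans (cong (_• x) (proj₂ (inverse sx≢0))) (1•x≡x x)))
        , i , (λ e → 1≢0 (trans (sym (proj₂ (inverse sx≢0))) (trans (cong (s x *_) e) (zeroʳ (s x))))) , refl
        where i = proj₁ (inverse sx≢0)

      -- A line of the projective plane pulled back along x. Both terms are multiplied by l² when x
      -- is replaced by l • x, so this is a condition on classes.
      OnConic : 𝔽 → Point → Point → Set
      OnConic a u x = a * (s x * s x) + ⟨ u , f x ⟩ ≡ 0#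

      normalised-value : ∀ {a u x x′} → OnConic a u x → ¬ s x ≡ 0# → s x′ ≡ 1# → x ≡ s x • x′ → ⟨ u , f x′ ⟩ ≡ - a
      normalised-value {a} {u} {x} {x′} on sx≢0 sx′ x≡ = *-cancelˡ (*≢0 sx≢0 sx≢0) (begin
        (s x * s x) * ⟨ u , f x′ ⟩
          ≡⟨ trans (sym (⟨⟩-• u (s x * s x) (f x′))) (cong ⟨ u ,_⟩ (sym (f-homogeneous (s x) x′))) ⟩
        ⟨ u , f (s x • x′) ⟩
          ≡⟨ sym (cong (λ w → ⟨ u , f w ⟩) x≡) ⟩
        ⟨ u , f x ⟩
          ≡⟨ solve 3 (λ a r g → g := (a :* r :+ g) :+ r :* :- a) refl a (s x * s x) ⟨ u , f x ⟩ ⟩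
        (a * (s x * s x) + ⟨ u , f x ⟩) + (s x * s x) * - a
          ≡⟨ trans (cong (_+ (s x * s x) * - a) on) (+-identityˡ ((s x * s x) * - a)) ⟩
        (s x * s x) * - a ∎)

      normalised-≢ : ∀ {x y x′ y′} → ¬ Parallel x y → Parallel x x′ → ¬ s y ≡ 0# → y ≡ s y • y′ → ¬ x′ ≡ y′
      normalised-≢ {x} {y} ¬∥ (k , k≢0 , refl) sy≢0 y≡ refl = ¬∥ (s y * k , *≢0 sy≢0 k≢0 , trans y≡ (•-• (s y) k x))

      -- The kernel of σ is a single class, that of x, so y and z can be normalised to s = 1. There
      -- both forms take the value - a, and `tangent` identifies the two points.
      no-tangent : ∀ {a u x y z} → ¬ u ≡ 𝟎 → ¬ x ≡ 𝟎 → ¬ y ≡ 𝟎 → ¬ z ≡ 𝟎 → ¬ Parallel x y → ¬ Parallel x z → ¬ Parallel y z →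
        OnConic a u x → OnConic a u y → OnConic a u z → s x ≡ 0# → ⊥
      no-tangent {a} {u} {x} {y} {z} u≢0 x≢0 y≢0 z≢0 ¬xy ¬xz ¬yz ox oy oz sx =
        let y′ , sy′ , y≡ , y∥ = normalise sy≢0
            z′ , sz′ , z≡ , z∥ = normalise sz≢0
        in normalised-≢ ¬yz y∥ sz≢0 z≡ (tangent u≢0 x≢0 sx gx sy′ sz′
             (trans (normalised-value oy sy≢0 sy′ y≡) (sym (normalised-value oz sz≢0 sz′ z≡))))
        where
        sy≢0 : ¬ s y ≡ 0#
        sy≢0 e = ¬xy (kernel-parallel σ≢0 x≢0 y≢0 sx e)
        sz≢0 : ¬ s z ≡ 0#
        sz≢0 e = ¬xz (kernel-parallel σ≢0 x≢0 z≢0 sx e)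
        gx : ⟨ u , f x ⟩ ≡ 0#
        gx = trans (sym (+-identityˡ ⟨ u , f x ⟩)) (trans (cong (_+ ⟨ u , f x ⟩)
               (sym (trans (cong (λ w → a * (w * w)) sx) (trans (cong (a *_) (zeroˡ 0#)) (zeroʳ a))))) ox)

      -- For u = 𝟎 the conic is s² = 0, which contains one class only. Otherwise either some class
      -- has s = 0 and `no-tangent` applies with that class in front, or all three can be normalised
      -- to s = 1.
      no-three-on-conic : ∀ {a u x y z} → ¬ (a ≡ 0# × u ≡ 𝟎) → ¬ x ≡ 𝟎 → ¬ y ≡ 𝟎 → ¬ z ≡ 𝟎 →
        ¬ Parallel x y → ¬ Parallel x z → ¬ Parallel y z → OnConic a u x → OnConic a u y → OnConic a u z → ⊥
      no-three-on-conic {a} {u} {x} {y} {z} au≢0 x≢0 y≢0 z≢0 ¬xy ¬xz ¬yz ox oy oz with u ≟² 𝟎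
      ... | yes refl = ¬xy (kernel-parallel σ≢0 x≢0 y≢0 (vanish ox) (vanish oy))
        where
        vanish : ∀ {x} → OnConic a 𝟎 x → s x ≡ 0#
        vanish {x} o with x*y≡0⇒x≡0⊎y≡0 (trans (sym (trans (cong (a * (s x * s x) +_)
                            (trans (cong₂ _+_ (zeroˡ (proj₁ (f x))) (zeroˡ (proj₂ (f x)))) (+-identityˡ 0#))) (+-identityʳ (a * (s x * s x))))) o)
        ... | inj₁ a≡0 = ⊥-elim (au≢0 (a≡0 , refl))
        ... | inj₂ ss≡0 = x*x≡0⇒x≡0 ss≡0
      ... | no u≢0 with s x ≟ 0# | s y ≟ 0# | s z ≟ 0#
      ... | yes sx | _ | _ = no-tangent u≢0 x≢0 y≢0 z≢0 ¬xy ¬xz ¬yz ox oy oz sx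
      ... | no _ | yes sy | _ = no-tangent u≢0 y≢0 x≢0 z≢0 (¬xy ∘ parallel-sym) ¬yz ¬xz oy ox oz sy
      ... | no _ | no _ | yes sz = no-tangent u≢0 z≢0 x≢0 y≢0 (¬xz ∘ parallel-sym) (¬yz ∘ parallel-sym) ¬xy oz ox oy sz
      ... | no sx≢0 | no sy≢0 | no sz≢0 =
        let x′ , sx′ , x≡ , x∥ = normalise sx≢0
            y′ , sy′ , y≡ , y∥ = normalise sy≢0
            z′ , sz′ , z≡ , z∥ = normalise sz≢0
        in no-three-points (λ x → ⟨ u , f x ⟩) (λ l x → trans (cong ⟨ u ,_⟩ (f-homogeneous l x)) (⟨⟩-• u (l * l) (f x)))
             σ σ≢0 (component-bent u≢0 σ) (- a) x′ y′ z′
             (normalised-≢ ¬xy x∥ sy≢0 y≡) (normalised-≢ ¬xz x∥ sz≢0 z≡) (normalised-≢ ¬yz y∥ sz≢0 z≡)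
             sx′ sy′ sz′ (normalised-value ox sx≢0 sx′ x≡) (normalised-value oy sy≢0 sy′ y≡) (normalised-value oz sz≢0 sz′ z≡)

      -- If s x is nonzero, the ratio r = s y / s x satisfies r² = l, so f (r • x) = f y and y is r
      -- • x up to sign. The first coordinate is what makes l a square. If s x = 0, both points lie
      -- in the kernel of σ.
      image-parallel : ∀ {x y l} → ¬ x ≡ 𝟎 → ¬ y ≡ 𝟎 → ¬ l ≡ 0# → s y * s y ≡ l * (s x * s x) → f y ≡ l • f x → Parallel x y
      image-parallel {x} {y} {l} x≢0 y≢0 l≢0 ss ff with s x ≟ 0#
      ... | yes sx = kernel-parallel σ≢0 x≢0 y≢0 sx (x*x≡0⇒x≡0 (trans ss (trans (cong (λ w → l * (w * w)) sx) (trans (cong (l *_) (zeroˡ 0#)) (zeroʳ l)))))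
      ... | no sx≢0 = fibre (f-fibres (trans (f-homogeneous r x) (trans (cong (_• f x) r²≡l) (sym ff))))
        where
        i = proj₁ (inverse sx≢0)
        r = s y * i
        r²≡l : r * r ≡ l
        r²≡l = begin
          (s y * i) * (s y * i)          ≡⟨ solve 2 (λ y i → (y :* i) :* (y :* i) := (y :* y) :* (i :* i)) refl (s y) i ⟩
          (s y * s y) * (i * i)          ≡⟨ cong (_* (i * i)) ss ⟩
          (l * (s x * s x)) * (i * i)    ≡⟨ solve 3 (λ l x i → (l :* (x :* x)) :* (i :* i) := l :* ((x :* i) :* (x :* i))) refl l (s x) i ⟩
          l * ((s x * i) * (s x * i))    ≡⟨ cong (λ w → l * (w * w)) (proj₂ (inverse sx≢0)) ⟩
          l * (1# * 1#)                  ≡⟨ trans (cong (l *_) (*-identityˡ 1#)) (*-identityʳ l) ⟩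
          l                              ∎
        r≢0 : ¬ r ≡ 0#
        r≢0 e = l≢0 (trans (sym r²≡l) (trans (cong (_* r) e) (zeroˡ r)))
        fibre : y ≡ r • x ⊎ y ≡ (- 1#) • (r • x) → Parallel x y
        fibre (inj₁ e) = r , r≢0 , e
        fibre (inj₂ e) = - 1# * r , *≢0 -1≢0 r≢0 , trans e (•-• (- 1#) r x)

  -- The p + 1 directions of the plane: the vertical one, then the one of slope i for each i.
  representative : Fin (suc (suc q)) → Point
  representative zero    = (0# , 1#)
  representative (suc i) = (1# , i)

  representative≢𝟎 : ∀ i → ¬ representative i ≡ 𝟎
  representative≢𝟎 zero    e = 1≢0 (cong proj₂ e)
  representative≢𝟎 (suc i) e = 1≢0 (cong proj₁ e)

  representative-injective : ∀ i j → Parallel (representative i) (representative j) → i ≡ j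
  representative-injective zero    zero    _ = refl
  representative-injective zero    (suc j) (l , _ , e) = ⊥-elim (1≢0 (trans (cong proj₁ e) (zeroʳ l)))
  representative-injective (suc i) zero    (l , l≢0 , e) = ⊥-elim (l≢0 (trans (sym (*-identityʳ l)) (sym (cong proj₁ e))))
  representative-injective (suc i) (suc j) (l , _ , e) = cong suc (sym (trans (cong proj₂ e)
    (trans (cong (_* i) (trans (sym (*-identityʳ l)) (sym (cong proj₁ e)))) (*-identityˡ i))))

  representative-surjective : ∀ x → ¬ x ≡ 𝟎 → ∃ λ i → Parallel (representative i) x
  representative-surjective (a , b) x≢0 with a ≟ 0#
  ... | yes refl = zero , b , (λ { refl → x≢0 refl }) , cong₂ _,_ (sym (zeroʳ b)) (sym (*-identityʳ b))
  ... | no a≢0 = suc (proj₁ (inverse a≢0) * b) , a , a≢0 , cong₂ _,_ (sym (*-identityʳ a))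
        (sym (trans (sym (*-assoc a (proj₁ (inverse a≢0)) b)) (trans (cong (_* b) (proj₂ (inverse a≢0))) (*-identityˡ b))))

-- The quadratic extension, its Frobenius map and the trace.

module QuadraticExtension {q : ℕ} (p-prime : Prime (suc q)) (3<p : 3 ℕ.< suc q) (K : PrimeField q) (n : Fin (suc q)) where

  open PlanarGeometry p-prime 3<p K public
  open ≡-Reasoning
  infixl 7 _⊛_
  infixr 8 _⊛^_

  _⊛_ : Point → Point → Point
  (a , b) ⊛ (c , d) = ((a * c) + (n * (b * d)) , (a * d) + (b * c))

  𝟏 : Point
  𝟏 = (1# , 0#)

  _⊛^_ : Point → ℕ → Point
  x ⊛^ zero  = 𝟏
  x ⊛^ suc k = x ⊛ (x ⊛^ k)

  embed : 𝔽 → Point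
  embed a = (a , 0#)

  extension : CommutativeRing 0ℓ 0ℓ
  extension = record
    { Carrier = Point ; _≈_ = _≡_ ; _+_ = _⊕_ ; _*_ = _⊛_ ; -_ = 𝟎 ⊖_ ; 0# = 𝟎 ; 1# = 𝟏
    ; isCommutativeRing = record
      { isRing = record
        { +-isAbelianGroup = record
          { isGroup = record
            { isMonoid = record
              { isSemigroup = record
                { isMagma = record { isEquivalence = isEquivalence ; ∙-cong = cong₂ _⊕_ }
                ; assoc = λ x y z → cong₂ _,_ (+-assoc (proj₁ x) (proj₁ y) (proj₁ z)) (+-assoc (proj₂ x) (proj₂ y) (proj₂ z)) }
              ; identity = (λ x → cong₂ _,_ (+-identityˡ (proj₁ x)) (+-identityˡ (proj₂ x)))
                         , (λ x → cong₂ _,_ (+-identityʳ (proj₁ x)) (+-identityʳ (proj₂ x))) }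
            ; inverse = (λ x → cong₂ _,_ (-‿inverseˡ (proj₁ x)) (-‿inverseˡ (proj₂ x)))
                      , (λ x → cong₂ _,_ (-‿inverseʳ (proj₁ x)) (-‿inverseʳ (proj₂ x)))
            ; ⁻¹-cong = cong (𝟎 ⊖_) }
          ; comm = λ x y → cong₂ _,_ (+-comm (proj₁ x) (proj₁ y)) (+-comm (proj₂ x) (proj₂ y)) }
        ; *-cong = cong₂ _⊛_
        ; *-assoc = assoc
        ; *-identity = identityˡ , λ x → trans (comm x 𝟏) (identityˡ x)
        ; distrib = distˡ , λ x y z → trans (comm (y ⊕ z) x) (trans (distˡ x y z) (cong₂ _⊕_ (comm x y) (comm x z))) }
      ; *-comm = comm } }
    where
    assoc : ∀ x y z → (x ⊛ y) ⊛ z ≡ x ⊛ (y ⊛ z)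
    assoc (a , b) (c , d) (e , f) = cong₂ _,_
      (solve 7 (λ n a b c d e f → (a :* c :+ n :* (b :* d)) :* e :+ n :* ((a :* d :+ b :* c) :* f)
        := a :* (c :* e :+ n :* (d :* f)) :+ n :* (b :* (c :* f :+ d :* e))) refl n a b c d e f)
      (solve 7 (λ n a b c d e f → (a :* c :+ n :* (b :* d)) :* f :+ (a :* d :+ b :* c) :* e
        := a :* (c :* f :+ d :* e) :+ b :* (c :* e :+ n :* (d :* f))) refl n a b c d e f)
    comm : ∀ x y → x ⊛ y ≡ y ⊛ x
    comm (a , b) (c , d) = cong₂ _,_
      (solve 5 (λ n a b c d → a :* c :+ n :* (b :* d) := c :* a :+ n :* (d :* b)) refl n a b c d)
      (solve 4 (λ a b c d → a :* d :+ b :* c := c :* b :+ d :* a) refl a b c d)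
    identityˡ : ∀ x → 𝟏 ⊛ x ≡ x
    identityˡ (a , b) = cong₂ _,_
      (trans (cong₂ _+_ (*-identityˡ a) (trans (cong (n *_) (zeroˡ b)) (zeroʳ n))) (+-identityʳ a))
      (trans (cong₂ _+_ (*-identityˡ b) (zeroˡ a)) (+-identityʳ b))
    distˡ : ∀ x y z → x ⊛ (y ⊕ z) ≡ (x ⊛ y) ⊕ (x ⊛ z)
    distˡ (a , b) (c , d) (e , f) = cong₂ _,_
      (solve 7 (λ n a b c d e f → a :* (c :+ e) :+ n :* (b :* (d :+ f)) := (a :* c :+ n :* (b :* d)) :+ (a :* e :+ n :* (b :* f))) refl n a b c d e f)
      (solve 6 (λ a b c d e f → a :* (d :+ f) :+ b :* (c :+ e) := (a :* d :+ b :* c) :+ (a :* f :+ b :* e)) refl a b c d e f)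

  embed-⊛ : ∀ l x → embed l ⊛ x ≡ l • x
  embed-⊛ l (a , b) = cong₂ _,_
    (trans (cong (l * a +_) (trans (cong (n *_) (zeroˡ b)) (zeroʳ n))) (+-identityʳ (l * a)))
    (trans (cong (l * b +_) (zeroˡ a)) (+-identityʳ (l * b)))

  embed-⊛^ : ∀ l k → embed l ⊛^ k ≡ embed (l ^ k)
  embed-⊛^ l zero    = refl
  embed-⊛^ l (suc k) = trans (embed-⊛ l (embed l ⊛^ k)) (trans (cong (l •_) (embed-⊛^ l k)) (cong (l * l ^ k ,_) (zeroʳ l)))

  private
    open Mult (CommutativeRing.semiring extension) using () renaming (_×_ to _⨯ᴱ_)
    open Exp (CommutativeRing.commutativeSemiring extension) using () renaming (_^_ to _^ᴱ_)

    ⨯ᴱ≡ : ∀ m x → m ⨯ᴱ x ≡ (m ⨯ proj₁ x , m ⨯ proj₂ x)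
    ⨯ᴱ≡ zero    x = refl
    ⨯ᴱ≡ (suc m) x = cong (x ⊕_) (⨯ᴱ≡ m x)

    ^ᴱ≡⊛^ : ∀ x k → x ^ᴱ k ≡ x ⊛^ k
    ^ᴱ≡⊛^ x zero    = refl
    ^ᴱ≡⊛^ x (suc k) = cong (x ⊛_) (^ᴱ≡⊛^ x k)

    p⨯≡0 : ∀ x → suc q ⨯ x ≡ 0#
    p⨯≡0 x = trans (⨯≡red* (suc q) x) (trans (cong (_* x) red-p) (zeroˡ x))

    module FrobE = Frobenius extension p-prime (trans (⨯ᴱ≡ (suc q) 𝟏) (cong₂ _,_ (p⨯≡0 1#) (p⨯≡0 0#)))

  ⊛^p-⊕ : ∀ x y → (x ⊕ y) ⊛^ suc q ≡ (x ⊛^ suc q) ⊕ (y ⊛^ suc q)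
  ⊛^p-⊕ x y = trans (sym (^ᴱ≡⊛^ (x ⊕ y) (suc q))) (trans (FrobE.^p-+ x y) (cong₂ _⊕_ (^ᴱ≡⊛^ x (suc q)) (^ᴱ≡⊛^ y (suc q))))

  q-even : ∃ λ m → q ≡ m ℕ.* 2
  q-even = from (q % 2) refl (m%n<n q 2)
    where
    from : ∀ r → r ≡ q % 2 → r ℕ.< 2 → ∃ λ m → q ≡ m ℕ.* 2
    from zero          e _ = q / 2 , trans (m≡m%n+[m/n]*n q 2) (cong (ℕ._+ (q / 2) ℕ.* 2) (sym e))
    from (suc zero)    e _ with prime⇒irreducible p-prime (ℕ.divides (suc (q / 2)) (cong suc (trans (m≡m%n+[m/n]*n q 2) (cong (ℕ._+ (q / 2) ℕ.* 2) (sym e)))))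
    ... | inj₁ ()
    ... | inj₂ 2≡p = ⊥-elim (ℕ.<⇒≱ 3<p (subst (ℕ._≤ 3) 2≡p (ℕ.n≤1+n 2)))
    from (suc (suc r)) e (ℕ.s≤s (ℕ.s≤s ()))

  pure-power : ∀ b m → proj₂ ((0# , b) ⊛^ (m ℕ.* 2)) ≡ 0# × proj₁ ((0# , b) ⊛^ suc (m ℕ.* 2)) ≡ 0#
  pure-power b m = even m , odd {m ℕ.* 2} (even m)
    where
    odd : ∀ {k} → proj₂ ((0# , b) ⊛^ k) ≡ 0# → proj₁ ((0# , b) ⊛^ suc k) ≡ 0#
    odd {k} e = trans (cong₂ _+_ (zeroˡ (proj₁ ((0# , b) ⊛^ k))) (trans (cong (λ z → n * (b * z)) e) (trans (cong (n *_) (zeroʳ b)) (zeroʳ n)))) (+-identityʳ 0#)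
    even : ∀ m → proj₂ ((0# , b) ⊛^ (m ℕ.* 2)) ≡ 0#
    even zero    = refl
    even (suc m) = trans (cong₂ _+_ (zeroˡ _) (trans (cong (b *_) (odd {m ℕ.* 2} (even m))) (zeroʳ b))) (+-identityʳ 0#)

  -- Write x = a + bω. Then x^p = a^p + (bω)^p with a^p = a, and as p is odd (bω)^p is a multiple of
  -- ω, without a component in the prime field.
  frobenius₁ : ∀ x → proj₁ (x ⊛^ suc q) ≡ proj₁ x
  frobenius₁ (a , b) = begin
    proj₁ ((a , b) ⊛^ suc q)
      ≡⟨ cong (λ x → proj₁ (x ⊛^ suc q)) (cong₂ _,_ (sym (+-identityʳ a)) (sym (+-identityˡ b))) ⟩
    proj₁ ((embed a ⊕ (0# , b)) ⊛^ suc q)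
      ≡⟨ cong proj₁ (⊛^p-⊕ (embed a) (0# , b)) ⟩
    proj₁ (embed a ⊛^ suc q) + proj₁ ((0# , b) ⊛^ suc q)
      ≡⟨ cong₂ _+_ (trans (cong proj₁ (embed-⊛^ a (suc q))) (fermat a))
           (trans (cong (λ k → proj₁ ((0# , b) ⊛^ suc k)) (proj₂ q-even)) (proj₂ (pure-power b (proj₁ q-even)))) ⟩
    a + 0#
      ≡⟨ +-identityʳ a ⟩
    a ∎

  -- Since f fixes 𝟏, it sends an element l of the prime field to l^d. Planarity in the directions
  -- of the prime field makes this power planar, hence the squaring map.
  degree-two : ∀ {d f} → 1 ℕ.≤ d → Planar f → (∀ l x → f (embed l ⊛ x) ≡ (embed l ⊛^ d) ⊛ f x) → f 𝟏 ≡ 𝟏 →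
               ∀ l x → f (l • x) ≡ (l * l) • f x
  degree-two {d} {f} 1≤d planar hom f𝟏 l x = trans (homogeneous l x) (cong (_• f x) (planar-power≡square d 1≤d injective l))
    where
    homogeneous : ∀ l x → f (l • x) ≡ (l ^ d) • f x
    homogeneous l x = trans (cong f (sym (embed-⊛ l x))) (trans (hom l x)
      (trans (cong (_⊛ f x) (embed-⊛^ l d)) (embed-⊛ (l ^ d) (f x))))
    f-embed : ∀ l → f (embed l) ≡ embed (l ^ d)
    f-embed l = trans (cong f (sym (•𝟏 l))) (trans (homogeneous l 𝟏) (trans (cong ((l ^ d) •_) f𝟏) (•𝟏 (l ^ d))))
      where
      •𝟏 : ∀ l → l • 𝟏 ≡ embed l
      •𝟏 l = cong₂ _,_ (*-identityʳ l) (zeroʳ l)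
    injective : ∀ a → ¬ a ≡ 0# → Injective _≡_ _≡_ (λ x → (x + a) ^ d + - (x ^ d))
    injective a a≢0 {x} {y} e = cong proj₁ (proj₁ (planar (embed a) (a≢0 ∘ cong proj₁)) (cong (_⊖ f (embed a))
      (trans (difference x) (trans (cong embed e) (sym (difference y))))))
      where
      difference : ∀ x → f (embed x ⊕ embed a) ⊖ f (embed x) ≡ embed ((x + a) ^ d + - (x ^ d))
      difference x = trans (cong₂ _⊖_ (trans (cong f (cong (x + a ,_) (+-identityʳ 0#))) (f-embed (x + a))) (f-embed x))
        (cong₂ _,_ (minus ((x + a) ^ d) (x ^ d)) (trans (minus 0# 0#) (-‿inverseʳ 0#)))

  -- A nonzero element of the prime field has q-th power 1, which differs from -1.
  imaginary≢0 : ∀ {β} → ¬ β ≡ 𝟎 → β ⊛^ q ≡ 𝟎 ⊖ 𝟏 → ¬ proj₂ β ≡ 0#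
  imaginary≢0 {b , _} β≢0 β^q refl = 2≢0 (begin
    red 2            ≡⟨ red-+ 1 1 ⟩
    red 1 + red 1    ≡⟨ cong₂ _+_ red-1 red-1 ⟩
    1# + 1#          ≡⟨ cong (_+ 1#) (trans (sym (x^q≡1 (λ { refl → β≢0 refl }))) (trans (sym (cong proj₁ (embed-⊛^ b q))) (cong proj₁ β^q))) ⟩
    (0# - 1#) + 1#   ≡⟨ -‿inverseˡ 1# ⟩
    0#               ∎)

  -- Projective points and the conics cut out by lines.

  Triple : Set
  Triple = 𝔽 × 𝔽 × 𝔽

  infixr 7 _·_
  _·_ : 𝔽 → Triple → Triple
  l · (a , b , c) = (l * a , l * b , l * c)

  infix 4 _∼_
  _∼_ : Triple → Triple → Set
  u ∼ v = ∃ λ l → ¬ l ≡ 0# × v ≡ l · u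

  ·-· : ∀ k l u → k · (l · u) ≡ (k * l) · u
  ·-· k l (a , b , c) = cong₂ _,_ (sym (*-assoc k l a)) (cong₂ _,_ (sym (*-assoc k l b)) (sym (*-assoc k l c)))

  ∼-refl : ∀ {u} → u ∼ u
  ∼-refl {a , b , c} = 1# , 1≢0 , cong₂ _,_ (sym (*-identityˡ a)) (cong₂ _,_ (sym (*-identityˡ b)) (sym (*-identityˡ c)))

  ∼-trans : ∀ {u v w} → u ∼ v → v ∼ w → u ∼ w
  ∼-trans {u} (l , l≢0 , refl) (k , k≢0 , refl) = k * l , *≢0 k≢0 l≢0 , ·-· k l u

  ∼-sym : ∀ {u v} → u ∼ v → v ∼ u
  ∼-sym {a , b , c} (l , l≢0 , refl) = l⁻¹ , (λ e → 1≢0 (trans (sym ll⁻¹) (trans (cong (l *_) e) (zeroʳ l)))) ,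
    cong₂ _,_ (undo a) (cong₂ _,_ (undo b) (undo c))
    where
    l⁻¹ = proj₁ (inverse l≢0)
    ll⁻¹ = proj₂ (inverse l≢0)
    undo : ∀ a → a ≡ l⁻¹ * (l * a)
    undo a = trans (sym (*-identityˡ a)) (trans (cong (_* a) (sym ll⁻¹)) (solve 3 (λ l i a → (l :* i) :* a := i :* (l :* a)) refl l l⁻¹ a))

  -- The value of x + x^p at x = a + bω, by `frobenius₁`.
  trace : Point → 𝔽
  trace x = red 2 * proj₁ x

  module TracePoints (n≢0 : ¬ n ≡ 0#) (f : Point → Point) (planar : Planar f) (f-homogeneous : ∀ l x → f (l • x) ≡ (l * l) • f x)
                     {β t : Point} (β₂≢0 : ¬ proj₂ β ≡ 0#) (t≢0 : ¬ t ≡ 𝟎) where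

    open PlanarQuadratic f planar f-homogeneous

    private
      -- The coefficient vector of the form x ↦ Tr(tx); it is nonzero because 2 and n are
      -- invertible.
      σ : Point
      σ = (red 2 * proj₁ t , red 2 * (n * proj₂ t))

      σ≢0 : ¬ σ ≡ 𝟎
      σ≢0 e = t≢0 (cong₂ _,_ (x≢0∧x*y≡0⇒y≡0 2≢0 (cong proj₁ e)) (x≢0∧x*y≡0⇒y≡0 n≢0 (x≢0∧x*y≡0⇒y≡0 2≢0 (cong proj₂ e))))

      s : Point → 𝔽
      s x = trace (t ⊛ x)

      s≡ : ∀ x → s x ≡ ⟨ σ , x ⟩
      s≡ x = solve 6 (λ z n t u a b → z :* (t :* a :+ n :* (u :* b)) := (z :* t) :* a :+ (z :* (n :* u)) :* b) refl
        (red 2) n (proj₁ t) (proj₂ t) (proj₁ x) (proj₂ x)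

    point : Point → Triple
    point x = (s x * s x , trace (f x) , trace (β ⊛ f x))

    private
      -- The first trace determines y₁; given y₁, the second determines y₂ because n and the
      -- ω-component of β are nonzero.
      coordinates : ∀ l x y → trace y ≡ l * trace x → trace (β ⊛ y) ≡ l * trace (β ⊛ x) → y ≡ l • x
      coordinates l (x₁ , x₂) (y₁ , y₂) e₁ e₂ = cong₂ _,_ y₁≡ (*-cancelˡ β₂≢0 (*-cancelˡ n≢0 (+-injectiveˡ (β₁ * y₁) (begin
        β₁ * y₁ + n * (β₂ * y₂)
          ≡⟨ *-cancelˡ 2≢0 (trans e₂ (solve 3 (λ l z w → l :* (z :* w) := z :* (l :* w)) refl l (red 2) (β₁ * x₁ + n * (β₂ * x₂)))) ⟩
        l * (β₁ * x₁ + n * (β₂ * x₂))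
          ≡⟨ solve 6 (λ l b c n x y → l :* (b :* x :+ n :* (c :* y)) := b :* (l :* x) :+ n :* (c :* (l :* y))) refl l β₁ β₂ n x₁ x₂ ⟩
        β₁ * (l * x₁) + n * (β₂ * (l * x₂))
          ≡⟨ cong (λ z → β₁ * z + n * (β₂ * (l * x₂))) y₁≡ ⟨
        β₁ * y₁ + n * (β₂ * (l * x₂)) ∎))))
        where
        β₁ = proj₁ β
        β₂ = proj₂ β
        y₁≡ : y₁ ≡ l * x₁
        y₁≡ = *-cancelˡ 2≢0 (trans e₁ (solve 3 (λ l z w → l :* (z :* w) := z :* (l :* w)) refl l (red 2) x₁))

      -- The coefficient vector of y ↦ Tr(By) with B = b + cβ.
      functional : 𝔽 → 𝔽 → Point
      functional b c = (red 2 * (b + c * proj₁ β) , red 2 * (c * (n * proj₂ β)))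

      functional≡ : ∀ b c y → b * trace y + c * trace (β ⊛ y) ≡ ⟨ functional b c , y ⟩
      functional≡ b c (y₁ , y₂) = solve 8 (λ z b c u v n y w → b :* (z :* y) :+ c :* (z :* (u :* y :+ n :* (v :* w)))
          := (z :* (b :+ c :* u)) :* y :+ (z :* (c :* (n :* v))) :* w) refl (red 2) b c (proj₁ β) (proj₂ β) n y₁ y₂

      functional≡0 : ∀ {b c} → functional b c ≡ 𝟎 → b ≡ 0# × c ≡ 0#
      functional≡0 {b} {c} e = b≡0 , c≡0
        where
        c≡0 : c ≡ 0#
        c≡0 with x*y≡0⇒x≡0⊎y≡0 (x≢0∧x*y≡0⇒y≡0 2≢0 (cong proj₂ e))
        ... | inj₁ c≡0 = c≡0
        ... | inj₂ nβ≡0 = ⊥-elim (*≢0 n≢0 β₂≢0 nβ≡0)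
        b≡0 : b ≡ 0#
        b≡0 = trans (sym (trans (cong (b +_) (trans (cong (_* proj₁ β) c≡0) (zeroˡ (proj₁ β)))) (+-identityʳ b)))
                    (x≢0∧x*y≡0⇒y≡0 2≢0 (cong proj₁ e))

      OnLine : Triple → Triple → Set
      OnLine (a , b , c) (x , y , z) = ((a * x) + (b * y)) + (c * z) ≡ 0#

      conic : ∀ {L x v} → point x ∼ v → OnLine L v → OnConic σ≢0 (proj₁ L) (functional (proj₁ (proj₂ L)) (proj₂ (proj₂ L))) x
      conic {a , b , c} {x} (l , l≢0 , refl) on = begin
        a * (⟨ σ , x ⟩ * ⟨ σ , x ⟩) + ⟨ functional b c , f x ⟩
          ≡⟨ cong₂ (λ u v → a * (u * u) + v) (sym (s≡ x)) (sym (functional≡ b c (f x))) ⟩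
        a * (s x * s x) + (b * trace (f x) + c * trace (β ⊛ f x))
          ≡⟨ sym (+-assoc (a * (s x * s x)) (b * trace (f x)) (c * trace (β ⊛ f x))) ⟩
        (a * (s x * s x) + b * trace (f x)) + c * trace (β ⊛ f x)
          ≡⟨ x≢0∧x*y≡0⇒y≡0 l≢0 (trans (solve 7 (λ l a b c x y z → l :* ((a :* x :+ b :* y) :+ c :* z) := (a :* (l :* x) :+ b :* (l :* y)) :+ c :* (l :* z))
               refl l a b c (s x * s x) (trace (f x)) (trace (β ⊛ f x))) on) ⟩
        0# ∎

    point-nonzero : ∀ {x v} → ¬ x ≡ 𝟎 → point x ∼ v → ¬ (proj₁ v ≡ 0# × proj₁ (proj₂ v) ≡ 0# × proj₂ (proj₂ v) ≡ 0#)
    point-nonzero {x} x≢0 (l , l≢0 , refl) (_ , e₁ , e₂) = x≢0 (f≡𝟎⇒≡𝟎 (trans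
      (coordinates 0# 𝟎 (f x) (vanish e₁) (vanish e₂)) (0•x≡𝟎 𝟎)))
      where
      vanish : ∀ {a b} → l * a ≡ 0# → a ≡ 0# * b
      vanish {b = b} e = trans (x≢0∧x*y≡0⇒y≡0 l≢0 e) (sym (zeroˡ b))

    point-∼⇒parallel : ∀ {x y} → ¬ x ≡ 𝟎 → ¬ y ≡ 𝟎 → point x ∼ point y → Parallel x y
    point-∼⇒parallel {x} {y} x≢0 y≢0 (l , l≢0 , e) = image-parallel σ≢0 x≢0 y≢0 l≢0
      (trans (cong (λ z → z * z) (sym (s≡ y))) (trans (cong proj₁ e) (cong (λ z → l * (z * z)) (s≡ x))))
      (coordinates l (f x) (f y) (cong (proj₁ ∘ proj₂) e) (cong (proj₂ ∘ proj₂) e))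

    parallel⇒point-∼ : ∀ {x y} → Parallel x y → point x ∼ point y
    parallel⇒point-∼ {x} (l , l≢0 , refl) = l * l , *≢0 l≢0 l≢0 , cong₂ _,_ squares (cong₂ _,_ traces βtraces)
      where
      squares : s (l • x) * s (l • x) ≡ (l * l) * (s x * s x)
      squares = trans (cong (λ z → z * z) (trans (s≡ (l • x)) (trans (⟨⟩-• σ l x) (cong (l *_) (sym (s≡ x))))))
        (solve 2 (λ l s → (l :* s) :* (l :* s) := (l :* l) :* (s :* s)) refl l (s x))
      traces : trace (f (l • x)) ≡ (l * l) * trace (f x)
      traces = trans (cong trace (f-homogeneous l x)) (solve 3 (λ z l a → z :* (l :* a) := l :* (z :* a)) refl (red 2) (l * l) (proj₁ (f x)))
      βtraces : trace (β ⊛ f (l • x)) ≡ (l * l) * trace (β ⊛ f x)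
      βtraces = trans (cong (λ w → trace (β ⊛ w)) (f-homogeneous l x))
        (solve 7 (λ z l n b c x y → z :* (b :* (l :* x) :+ n :* (c :* (l :* y))) := l :* (z :* (b :* x :+ n :* (c :* y)))) refl
          (red 2) (l * l) n (proj₁ β) (proj₂ β) (proj₁ (f x)) (proj₂ (f x)))

    point-no-three-collinear : ∀ {x y z u v w L} → ¬ x ≡ 𝟎 → ¬ y ≡ 𝟎 → ¬ z ≡ 𝟎 → point x ∼ u → point y ∼ v → point z ∼ w →
      ¬ u ∼ v → ¬ u ∼ w → ¬ v ∼ w → ¬ (proj₁ L ≡ 0# × proj₁ (proj₂ L) ≡ 0# × proj₂ (proj₂ L) ≡ 0#) →
      OnLine L u → OnLine L v → OnLine L w → ⊥
    point-no-three-collinear {x} {y} {z} {L = L} x≢0 y≢0 z≢0 xu yv zw ¬uv ¬uw ¬vw L≢0 Lu Lv Lw =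
      no-three-on-conic σ≢0 (λ (a≡0 , e) → L≢0 (a≡0 , functional≡0 e)) x≢0 y≢0 z≢0
        (λ ∥ → ¬uv (∼-trans (∼-sym xu) (∼-trans (parallel⇒point-∼ ∥) yv)))
        (λ ∥ → ¬uw (∼-trans (∼-sym xu) (∼-trans (parallel⇒point-∼ ∥) zw)))
        (λ ∥ → ¬vw (∼-trans (∼-sym yv) (∼-trans (parallel⇒point-∼ ∥) zw)))
        (conic {L} {x} xu Lu) (conic {L} {y} yv Lv) (conic {L} {z} zw Lw)

theorem3p1 : (p : ℕ) .{{_ : NonZero p}} → Prime p → 11 ≤ p →
    (n : Field.Fp p) → Field.NonSquare p n →
    (d : ℕ) → 1 ≤ d → (f : Field.Ext.F p n → Field.Ext.F p n) →
    (β γ : Field.Ext.F p n) →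
    ¬ (β ≡ Field.Ext.0F p n) →
    Field.Ext._^F_ p n β (p ∸ 1) ≡ Field.Ext.-F_ p n (Field.Ext.1F p n) →
    Field.Ext.Primitive p n γ →
    Field.Ext.Planar p n f →
    (∀ (l : Field.Fp p) (x : Field.Ext.F p n) →
      f (Field.Ext._*F_ p n (Field.Ext.ι p n l) x)
        ≡ Field.Ext._*F_ p n (Field.Ext._^F_ p n (Field.Ext.ι p n l) d) (f x)) →
    f (Field.Ext.1F p n) ≡ Field.Ext.1F p n →
    f β ≡ Field.Ext._^F_ p n β 2 →
    f γ ≡ Field.Ext._^F_ p n γ 2 →
    (t : Field.Ext.F p n) → ¬ (t ≡ Field.Ext.0F p n) →
    Field.Oval p (Field.SetS.S p n f β t)
theorem3p1 zero _ ()
theorem3p1 (suc q) p-prime 11≤p n nonSquare d 1≤d f β γ β≢0 β^q _ planar homogeneous f1 _ _ t t≢0 =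
  (λ u (x , x≢0 , xu) → point-nonzero x≢0 (∼-from x xu)) ,
  ( (λ i → Triple-at (representative i))
  , (λ i → representative i , representative≢𝟎 i , ∼-refl)
  , (λ i j ij → representative-injective i j (point-∼⇒parallel (representative≢𝟎 i) (representative≢𝟎 j)
      (subst₂ _∼_ (Triple-at≡ (representative i)) (Triple-at≡ (representative j)) ij)))
  , (λ u (x , x≢0 , xu) → let i , ∥ = representative-surjective x x≢0 in
      i , ∼-trans (subst₂ _∼_ (sym (Triple-at≡ (representative i))) (sym (Triple-at≡ x)) (parallel⇒point-∼ ∥)) xu)) ,
  (λ u v w (x , x≢0 , xu) (y , y≢0 , yv) (z , z≢0 , zw) ¬uv ¬uw ¬vw (L , L≢0 , Lu , Lv , Lw) →
    point-no-three-collinear {L = L} x≢0 y≢0 z≢0 (∼-from x xu) (∼-from y yv) (∼-from z zw) ¬uv ¬uw ¬vw L≢0 Lu Lv Lw)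
  where
  3<p : 3 ℕ.< suc q
  3<p = ℕ.≤-trans (ℕ.m≤n+m 4 7) 11≤p
  open Field (suc q) using (_+ₚ_; _*ₚ_; 0ₚ)
  open Field.Ext (suc q) n using (F; _^F_; Tr; _*F_)
  -- For this instance the abstract operations, planarity and projective equivalence unfold to those
  -- of the statement, so the hypotheses can be passed on as they are.
  open QuadraticExtension p-prime 3<p (residueField q) n

  ^F≡⊛^ : ∀ x k → x ^F k ≡ x ⊛^ k
  ^F≡⊛^ x zero    = refl
  ^F≡⊛^ x (suc k) = cong (x ⊛_) (^F≡⊛^ x k)

  Tr≡trace : ∀ x → Tr x ≡ trace x
  Tr≡trace x = trans (cong (proj₁ x +_) (trans (cong proj₁ (^F≡⊛^ x (suc q))) (frobenius₁ x)))
    (trans (solve 1 (λ a → a :+ a := con (ℤ.+ 2) :* a) refl (proj₁ x)) refl)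

  n≢0 : ¬ n ≡ 0#
  n≢0 n≡0 = nonSquare 0# (trans (zeroˡ 0#) (sym n≡0))

  f-homogeneous : ∀ l x → f (l • x) ≡ (l * l) • f x
  f-homogeneous = degree-two {d} {f} 1≤d planar
    (λ l x → trans (homogeneous l x) (cong (_⊛ f x) (^F≡⊛^ (embed l) d))) f1

  open TracePoints n≢0 f planar f-homogeneous {β} {t} (imaginary≢0 β≢0 (trans (sym (^F≡⊛^ β q)) β^q)) t≢0

  Triple-at : F → Triple
  Triple-at x = (Tr (t *F x) *ₚ Tr (t *F x) , Tr (f x) , Tr (β *F f x))

  Triple-at≡ : ∀ x → Triple-at x ≡ point x
  Triple-at≡ x = cong₂ _,_ (cong (λ z → z * z) (Tr≡trace (t ⊛ x))) (cong₂ _,_ (Tr≡trace (f x)) (Tr≡trace (β ⊛ f x)))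

  ∼-from : ∀ x {u} → Triple-at x ∼ u → point x ∼ u
  ∼-from x {u} = subst (_∼ u) (Triple-at≡ x)
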